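{- Let $a,m\ge 2$ and $\tau=12\cdots(m-1)m^a$. Let $y=A(x,0)=\sum_{n\ge 0}\big(\sum_{\pi\in NC_n}q^{\mu_\tau(\pi)}\big)x^n$ denote the generating function counting members of $NC_n$ for $n\ge 0$ according to the number of occurrences of the subword $\tau$. Then $y$ satisfies the polynomial equation $$xy^2-y+1+(q-1)x^{a+m-2}y^{m-1}(y-1)=0.$$ More generally, the generating function $\sum_{n\ge 0}\big(\sum_{\pi\in NC_n}v^{\mathrm{rep}(\pi)}q^{\mu_\tau(\pi)}\big)x^n$ counting members of $NC_n$ jointly according to the smallest repeated letter and the number of occurrences of $\tau$ is given by $$vA(x,0,v)+\frac{1}{1-x}\qquad\text{if } a=2,$$ and by $$vA(x,0,v)+\frac{1}{1-x}+\frac{v^2x^aC_{a-1}-v^2x^2}{1-vx}+v\sum_{i=2}^{a-1}C_ix^i+(v-1)\sum_{n\ge 2}\sum_{j=r}^{n-1}C_{n-j}v^jx^n\qquad\text{if } a\ge 3,$$ where $r=\max\{1,n-a+2\}$ and $$A(x,0,v)=\frac{(y-1)(A(x,vx)-y)}{v}-M(x,0,v)+\frac{(q-1)v^{m-1}x^{a+m-2}(y-1)}{1-vx},$$ with $A(x,u)$ given by $$A(x,u)=\frac{x-u}{xy-u}\biggl(\frac{x^aC_{a-1}}{(1-u)(1-x)}+\frac{(1-q)x^{a-1}\big(u^m(1-x)-x^m(1-u)\big)(y-1)}{(1-u)(1-x)(x-u)}+\frac{x(y-1)}{x-u}A(x,x)-M(x,u,1)+L(x,u)\biggr),$$ in which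 $$A(x,x)=\frac{(q-1)x^{a-2}\big((xy)^m(1-x)-x^m(1-xy)\big)}{(1-x)(1-xy)}-M(x,xy,1)+\frac{x^aC_{a-1}}{(1-x)(1-xy)}+L(x,xy).$$
   Context: A set partition of $[n]=\{1,\dots,n\}$ with blocks $B_1,\dots,B_k$ ordered so that $\min B_1<\cdots<\min B_k$ is represented by its canonical sequential form $\pi=\pi_1\cdots\pi_n$, where $i\in B_{\pi_i}$ for each $i$. It is non-crossing if $\pi$ contains no (not necessarily consecutive) subsequence of the form $a\,b\,a\,b$ with $a<b$. $NC_n$ denotes the set of non-crossing partitions of $[n]$, identified with their canonical sequential forms ($NC_0$ consists of the empty partition). $C_n=\frac1{n+1}\binom{2n}{n}$. An occurrence of a word $\tau=\tau_1\cdots\tau_k$ as a subword in a sequence $\sigma_1\cdots\sigma_n$ is an index $i\in[n-k+1]$ such that the string of consecutive letters $\sigma_i\cdots\sigma_{i+k-1}$ is order-isomorphic to $\tau$ (same relative order, including equalities). $\mu_\tau(\pi)$ denotes the number of occurrences of $\tau$ in $\pi$. Here $\tau=12\cdots(m-1)m^a$, i.e. $1,2,\dots,m-1$ followed by $a$ copies of $m$. For $\pi\in NC_n$ other than $12\cdots n$, $\mathrm{rep}(\pi)$ is the smallest letter occurring at least twice in $\pi$; $\mathrm{rep}(12\cdots n)=0$ (including $n=0$). $NC_{n,i}$, $1\le i\le n-1$, is the set of $\pi\in NC_n$ with smallest repeated letter $i$. For $\ell\ge 0$, $\mu_\tau^{(\ell)}(\pi)$ is the number of occurrences of $\tau$ in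 the sequence $12\cdots\ell(\pi+\ell)$, where $\pi+\ell$ is obtained by adding $\ell$ to each entry of $\pi$. Define $a^{(\ell)}(n,i)=\sum_{\pi\in NC_{n,i}}q^{\mu_\tau^{(\ell)}(\pi)}$ for $n\ge2$, $1\le i\le n-1$, and $a^{(\ell)}(n)=\sum_{\pi\in NC_n}q^{\mu_\tau^{(\ell)}(\pi)}$ for $n\ge 1$, with $a^{(\ell)}(0)=1$. Define the formal power series $$A(x,u)=\sum_{n\ge0}\sum_{\ell\ge0}a^{(\ell)}(n)u^\ell x^n,\qquad A(x,u,v)=\sum_{n\ge a}\sum_{\ell\ge0}\sum_{i=1}^{n-a+1}a^{(\ell)}(n,i)u^\ell v^{i-1}x^n.$$ (So $A(x,0)$ is $A(x,u)$ at $u=0$, $A(x,vx)$ is $A(x,u)$ at $u=vx$, and so on.) Further, $L(x,u)=\frac{1}{1-u}\sum_{j=0}^{a-1}C_jx^j$, and $M(x,u,v)=0$ if $a=2$, while $M(x,u,v)=\frac{x}{(1-u)(1-vx)}\sum_{j=0}^{a-3}\sum_{i=1}^{a-2-j}C_iC_jx^{i+j}$ if $a\ge3$. -}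

module Defs where

open import Algebra.Bundles.Raw using (RawRing)
import Algebra.Definitions.RawSemiring as RawSemiringDefs
open import Data.Fin.Base using (toℕ)
open import Data.List.Base
  using (List; []; _∷_; _++_; map; foldr; filter; length; take; tails; head;
         applyUpTo; replicate; zip; cartesianProductWith)
open import Data.List.Extrema.Nat using (max)
open import Data.List.Membership.DecPropositional using (_∈?_)
open import Data.List.Membership.Propositional using (_∈_)
open import Data.List.Relation.Binary.Sublist.DecPropositional using (_⊆?_)
open import Data.List.Relation.Binary.Sublist.Propositional
  using (_⊆_; lookup)
open import Data.List.Relation.Unary.All as All using (All)
open import Data.List.Relation.Unary.AllPairs as AllPairs using (AllPairs)
open import Data.List.Relation.Unary.Any using (here; there)
open import Data.Maybe.Base using (fromMaybe)
open import Data.Nat as ℕ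
  using (ℕ; zero; suc; _∸_; _<_; _≤_; _<?_; _≤?_; _≟_)
open import Data.Nat.Combinatorics using (_C_)
open import Data.Nat.DivMod using (_/_)
open import Data.Product.Base using (_×_; _,_; uncurry)
open import Function.Base using (_∘_)
open import Function.Bundles using (_⇔_; mk⇔; Equivalence)
open import Relation.Binary.PropositionalEquality using (_≡_; refl)
open import Relation.Nullary using (Dec; ¬_; ¬?; _×-dec_; _→-dec_; does)
open import Relation.Nullary.Decidable using (map′)
open import Relation.Unary using (Decidable)
open import Data.Bool.Base using (if_then_else_)

catalan : ℕ → ℕ
catalan n = ((2 ℕ.* n) C n) / suc n

------------------------------------------------------------------------
-- Non-crossing partitions

-- A word π₁…πₙ stands for the family of blocks B_j = { i | π_i = j }.

Word : Set
Word = List ℕ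

-- 1 2 … n
ascending : ℕ → Word
ascending = applyUpTo suc

-- All words of length n over {1,…,k}.
words : (k n : ℕ) → List Word
words k zero    = [] ∷ []
words k (suc n) = cartesianProductWith _∷_ (ascending k) (words k n)

-- 0-based position of the first occurrence of j, i.e. min B_j - 1 when
-- B_j is non-empty.
firstPos : ℕ → Word → ℕ
firstPos j []      = 0
firstPos j (x ∷ π) = if does (j ≟ x) then 0 else suc (firstPos j π)

-- With k the largest letter, the blocks are B_1,…,B_k; they must all be
-- non-empty, cover every position, and satisfy min B_1 < ⋯ < min B_k.
Canonical : Word → Set
Canonical π =
  All (1 ≤_) π ×
  All (_∈ π) (ascending (max 0 π)) ×
  AllPairs (λ i j → firstPos i π < firstPos j π) (ascending (max 0 π))

canonical? : Decidable Canonical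
canonical? π =
  All.all? (1 ≤?_) π ×-dec
  All.all? (λ j → _∈?_ _≟_ j π) (ascending (max 0 π)) ×-dec
  AllPairs.allPairs? (λ i j → firstPos i π <? firstPos j π) (ascending (max 0 π))

NonCrossing : Word → Set
NonCrossing π = ∀ a b → a < b → ¬ (a ∷ b ∷ a ∷ b ∷ [] ⊆ π)

nonCrossing? : Decidable NonCrossing
nonCrossing? π = map′ to from
  (All.all? (λ a → All.all? (λ b →
     (a <? b) →-dec ¬? (_⊆?_ _≟_ (a ∷ b ∷ a ∷ b ∷ []) π)) π) π)
  where
  Bounded : Set
  Bounded = All (λ a → All (λ b → a < b → ¬ (a ∷ b ∷ a ∷ b ∷ [] ⊆ π)) π) π

  to : Bounded → NonCrossing π
  to h a b a<b s =
    All.lookup (All.lookup h (lookup s (here refl)))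
               (lookup s (there (here refl))) a<b s

  from : NonCrossing π → Bounded
  from h = All.tabulate λ {a} _ → All.tabulate λ {b} _ → h a b

NC : ℕ → List Word
NC n = filter (λ π → canonical? π ×-dec nonCrossing? π) (words n n)

occurrences : ℕ → Word → ℕ
occurrences j π = length (filter (j ≟_) π)

-- The value is 0 when no letter repeats; among canonical forms of length n
-- this happens exactly for 12…n.
rep : Word → ℕ
rep π = fromMaybe 0
  (head (filter (λ j → 2 ≤? occurrences j π) (ascending (length π))))

-- NC_{n,i}, meaningful for i ≥ 1.
NCᵢ : ℕ → ℕ → List Word
NCᵢ n i = filter (λ π → rep π ≟ i) (NC n)

------------------------------------------------------------------------
-- Subwords

SameOrder : ℕ × ℕ → ℕ × ℕ → Set
SameOrder (s , t) (s′ , t′) = (s < s′ ⇔ t < t′) × (s ≡ s′ ⇔ t ≡ t′)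

OrderIsomorphic : Word → Word → Set
OrderIsomorphic σ τ =
  length σ ≡ length τ × All (λ p → All (SameOrder p) pairs) pairs
  where pairs = zip σ τ

_⇔-dec_ : ∀ {a b} {A : Set a} {B : Set b} → Dec A → Dec B → Dec (A ⇔ B)
A? ⇔-dec B? = map′ (uncurry mk⇔)
  (λ e → Equivalence.to e , Equivalence.from e)
  ((A? →-dec B?) ×-dec (B? →-dec A?))

orderIsomorphic? : ∀ σ τ → Dec (OrderIsomorphic σ τ)
orderIsomorphic? σ τ =
  (length σ ≟ length τ) ×-dec
  All.all? (λ p → All.all? (sameOrder? p) pairs) pairs
  where
  pairs = zip σ τ

  sameOrder? : ∀ p p′ → Dec (SameOrder p p′)
  sameOrder? (s , t) (s′ , t′) =
    ((s <? s′) ⇔-dec (t <? t′)) ×-dec ((s ≟ s′) ⇔-dec (t ≟ t′))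

-- One suffix for each starting index; a suffix shorter than τ fails the
-- length condition of OrderIsomorphic.
μ : Word → Word → ℕ
μ τ σ = length
  (filter (λ s → orderIsomorphic? (take (length τ) s) τ) (tails σ))

-- Occurrences of τ in 12…l(π+l).
μ⁽_⁾ : ℕ → Word → Word → ℕ
μ⁽ l ⁾ τ π = μ τ (ascending l ++ map (ℕ._+ l) π)

-- 12…(m-1)mᵃ
pattern-τ : (a m : ℕ) → Word
pattern-τ a m = ascending (m ∸ 1) ++ replicate a m

------------------------------------------------------------------------
-- Formal power series

module RingNotation {c ℓ} (R : RawRing c ℓ) where
  open RawRing R public using (Carrier; _≈_; _+_; _*_; -_; 0#; 1#)
  open RawSemiringDefs (RawRing.rawSemiring R) public using (_^_; sum)

  infixl 6 _-_
  _-_ : Carrier → Carrier → Carrier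
  x - y = x + (- y)

  ι : ℕ → Carrier
  ι n = RawSemiringDefs._×_ (RawRing.rawSemiring R) n 1#

  sumOver : ∀ {a} {A : Set a} → List A → (A → Carrier) → Carrier
  sumOver xs f = foldr (λ x s → f x + s) 0# xs

-- A series is its sequence of coefficients.
module Series {c ℓ} (R : RawRing c ℓ) where
  private module K = RingNotation R

  const : K.Carrier → (ℕ → K.Carrier)
  const k zero    = k
  const k (suc _) = K.0#

  series : RawRing c ℓ
  series = record
    { Carrier = ℕ → K.Carrier
    ; _≈_     = λ f g → ∀ n → f n K.≈ g n
    ; _+_     = λ f g n → f n K.+ g n
    ; _*_     = λ f g n → K.sum {suc n} (λ i → f (toℕ i) K.* g (n ∸ toℕ i))
    ; -_      = λ f n → K.- f n
    ; 0#      = λ _ → K.0#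
    ; 1#      = const K.1#
    }

  open RingNotation series

  var : Carrier
  var 1 = K.1#
  var _ = K.0#

  -- Σ_k gᵏ, the inverse of 1 - g.  The truncation at k ≤ n is exact, and the
  -- notation meaningful, only when g has zero constant coefficient.
  1/[1-_] : Carrier → Carrier
  1/[1- g ] n = K.sum {suc n} (λ k → (g ^ toℕ k) n)

-- The coefficient ring and its elements q, v are arbitrary: polynomial
-- identities in indeterminates q and v are the case R = ℤ[q,v], and imply the
-- general case.
module GeneratingFunctions
  {c ℓ} (R : RawRing c ℓ) (q v : RawRing.Carrier R) (a m : ℕ) where

  private
    module K = RingNotation R
    module S₁ = Series R
    module S₂ = Series S₁.series

  -- R[[x]]
  open RingNotation S₁.series public
  open S₁ public using (1/[1-_])

  -- R[[x]][[u]]: F l n is the coefficient of uˡxⁿ.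
  open RingNotation S₂.series public using ()
    renaming (Carrier to Carrier₂; _≈_ to _≈₂_; _+_ to _+₂_; _-_ to _-₂_;
              _*_ to _*₂_; _^_ to _^₂_; 1# to 1₂)
  open S₂ public using () renaming (1/[1-_] to 1/[1-_]₂; const to infix 9 ↑_)

  X Q V : Carrier
  X = S₁.var
  Q = S₁.const q
  V = S₁.const v

  U : Carrier₂
  U = S₂.var

  -- F(x,g).  The truncation at l ≤ n is exact, and the substitution
  -- meaningful, only when g has zero constant coefficient.
  infixl 9 _⟨_⟩
  _⟨_⟩ : Carrier₂ → Carrier → Carrier
  (F ⟨ g ⟩) n = K.sum {suc n} (λ l → (F (toℕ l) * g ^ toℕ l) n)

  τ : Word
  τ = pattern-τ a m

  y : Carrier
  y n = K.sumOver (NC n) (λ π → q K.^ μ τ π)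

  jointGF : Carrier
  jointGF n = K.sumOver (NC n) (λ π → (v K.^ rep π) K.* (q K.^ μ τ π))

  a⁽_⁾ : ℕ → ℕ → K.Carrier
  a⁽ l ⁾ zero        = K.1#
  a⁽ l ⁾ n@(suc _) = K.sumOver (NC n) (λ π → q K.^ μ⁽ l ⁾ τ π)

  aᵢ⁽_⁾ : ℕ → ℕ → ℕ → K.Carrier
  aᵢ⁽ l ⁾ n i = K.sumOver (NCᵢ n i) (λ π → q K.^ μ⁽ l ⁾ τ π)

  A : Carrier₂
  A l n = a⁽ l ⁾ n

  -- A(x,u,w).  The range 1 ≤ i ≤ n-a+1 is indexed by i-1; it is empty for
  -- n < a.
  A₃ : K.Carrier → Carrier₂
  A₃ w l n = K.sum {suc n ∸ a}
    (λ i → aᵢ⁽ l ⁾ n (suc (toℕ i)) K.* (w K.^ toℕ i))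

  L : Carrier₂
  L = 1/[1- U ]₂ *₂ ↑ sum {a} (λ j → ι (catalan (toℕ j)) * X ^ toℕ j)

  -- M(x,u,w).  The ranges are 0 ≤ j ≤ a-3 and 1 ≤ i ≤ a-2-j, the latter
  -- indexed by i-1; for a = 2 the sum is empty.
  M : K.Carrier → Carrier₂
  M w = 1/[1- U ]₂ *₂ ↑ (X * 1/[1- S₁.const w * X ] *
    sum {a ∸ 2} (λ j → sum {a ∸ 2 ∸ toℕ j} (λ i →
      ι (catalan (suc (toℕ i)) ℕ.* catalan (toℕ j))
        * X ^ (suc (toℕ i) ℕ.+ toℕ j))))

  -- Σ_{i=2}^{a-1} C_i xⁱ
  catalanPart : Carrier
  catalanPart = sum {a ∸ 2}
    (λ i → ι (catalan (2 ℕ.+ toℕ i)) * X ^ (2 ℕ.+ toℕ i))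

  -- Σ_{n≥2} Σ_{j=r}^{n-1} C_{n-j} vʲ xⁿ with r = max{1,n-a+2}.  Truncated
  -- subtraction is harmless inside the maximum; for n ≤ 1 and a ≥ 2 the
  -- range of j is empty.
  doubleSum : Carrier
  doubleSum n = K.sum {n ∸ r}
    (λ i → K.ι (catalan (n ∸ (r ℕ.+ toℕ i))) K.* (v K.^ (r ℕ.+ toℕ i)))
    where r = 1 ℕ.⊔ (n ℕ.+ 2 ∸ a)

-- Read a non-crossing canonical form from left to right, keeping the blocks that
-- can still be continued on a stack: the next letter either opens a block or
-- pops the stack down to an older one.  An occurrence of 12⋯(m-1)mᵃ ends a run of
-- ascending letters followed by copies of the last of them, so the weight of a
-- continuation depends on the stack only through its depth d, by a factor yᵈ.
-- This yields, for the coefficient A_l of uˡ in A(x,u),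
--   A_l = 1 + x y A_{l+1} + [l ≥ m-1] (q-1) x^{a-1} (y-1).
-- Iterating from l = 0 gives the polynomial equation, and summing against uˡ, xˡ
-- or (vx)ˡ gives the closed forms.  A word in which 1 is not repeated is 1(π+1),
-- so the words with smallest repeated letter i have the series
-- x^{i-1} (A_{i-1} - 1 - x A_i).  The sums of Catalan numbers collapse by
-- C_{n+1} = Σ C_i C_{n-i}; this follows from the case q = 1, where
-- y = 1 + x y² and x d/dx turn into (n+2) c_{n+1} = 2(2n+1) c_n.

module Submission where

open import Algebra.Bundles using (CommutativeRing)
open import Data.Bool.Base using (Bool; false; if_then_else_; not; true)
open import Data.Empty using (⊥; ⊥-elim)
open import Data.Fin.Base using (toℕ)
open import Data.Integer.Base as ℤ using (+_; -[1+_]; ℤ)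
import Data.Integer.Properties as ℤₚ
open import Data.List.Base
  using (List; []; _∷_; _++_; map; filter; head; length; take; zip; replicate; applyUpTo;
         cartesianProductWith)
open import Data.List.Extrema.Nat using (argmax-sel; max; v≤max⁺)
open import Data.List.Membership.Propositional using (_∈_; _∉_)
import Data.List.Properties as Listₚ
open import Data.List.Relation.Binary.Sublist.Propositional as Sublist using (_∷_; _∷ʳ_; _⊆_)
open import Data.List.Relation.Unary.All as All using (All; []; _∷_)
import Data.List.Relation.Unary.All.Properties as Allₚ
open import Data.List.Relation.Unary.AllPairs using (AllPairs; []; _∷_)
import Data.List.Relation.Unary.AllPairs.Properties as AllPairsₚ
open import Data.List.Relation.Unary.Any as Any using (Any; here; there)
open import Data.Maybe.Base using (Maybe; fromMaybe; just; nothing)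
open import Data.Nat as ℕ using (_!; _<_; _∸_; _≟_; _≤?_; _≤_; _⊔_; suc; s≤s; zero; z≤n; ℕ)
open import Data.Nat.Combinatorics using (_C_; k![n∸k]!∣n!)
open import Data.Nat.Combinatorics.Specification using (nCk≡n!/k![n-k]!)
open import Data.Nat.DivMod using (m*n/n≡m; m/n*n≡m)
import Data.Nat.Properties as ℕₚ
import Data.Nat.Tactic.RingSolver as ℕ-Solver
open import Data.Product using (_,_; _×_; proj₁; proj₂)
open import Data.Sum.Base using (inj₁; inj₂)
open import Data.Unit.Base using (tt; ⊤)
open import Defs
open import Function.Base using (_∘_; id)
open import Function.Bundles using (Equivalence; _⇔_; mk⇔)
import Function.Properties.Equivalence as ⇔
open import Relation.Binary.Bundles using (Setoid)
open import Relation.Binary.PropositionalEquality as ≡ using (_≡_; _≢_)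
import Relation.Binary.Reasoning.Setoid as SetoidReasoning
open import Relation.Nullary using (Dec; _×-dec_; contradiction; does; no; yes; ¬_)
open import Relation.Nullary.Decidable using (dec-false; dec-true)
open import Relation.Unary using (Decidable)

-- The formulas divide by v, x - u, xy - u, y - 1 and n + 1, none of which need be invertible over
-- an arbitrary coefficient ring. The first three are cleared in the statement. The factor y - 1 is
-- x times a series with constant coefficient 1, hence cancellable. Division by n + 1 happens in ℤ,
-- and only the division-free Catalan convolution is carried over to the ring.
--
-- The factor yᵈ resists induction at a fixed depth, since opening a block raises d. It is proved
-- modulo x^N by induction on N, for all depths and runs at once, because every further letter costs
-- a factor x.
--
-- The Catalan corrections to A(x,0,v) and to the joint series come from the range i ≤ n-a+1: it
-- omits the words whose part after the i-1 unrepeated initial letters is shorter than a. Such a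
-- part has no a equal letters, so `τ` does not occur even behind 12⋯l, and the omitted series is
-- the same for every l. The Catalan terms in A(x,u) merely spell out 1/((1-x)(1-u)).

-- Ring solving, finite sums and the ring of formal power series

-- Ring solver with integer coefficients, so that x - x is recognised as 0.
module IntegerSolver {c ℓ} (R : CommutativeRing c ℓ) where
  open import Algebra.Solver.Ring.AlmostCommutativeRing
    using (fromCommutativeRing; _-Raw-AlmostCommutative⟶_)
  open CommutativeRing R
  open import Algebra.Properties.Ring ring
    using (-‿involutive; -0#≈0#; -‿distribˡ-*; -‿distribʳ-*)
  open import Algebra.Properties.AbelianGroup +-abelianGroup using (⁻¹-∙-comm)
  open import Algebra.Properties.Semiring.Mult.TCOptimised semiring
    using (×-homo-+; ×1-homo-*; 1+×) renaming (_×_ to _·_)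
  open import Relation.Binary.Reasoning.Setoid setoid

  ⟦_⟧ℤ : ℤ → Carrier
  ⟦ + n ⟧ℤ      = n · 1#
  ⟦ -[1+ n ] ⟧ℤ = - (suc n · 1#)

  neg-homo : ∀ i → ⟦ ℤ.- i ⟧ℤ ≈ - ⟦ i ⟧ℤ
  neg-homo (+ zero)   = sym -0#≈0#
  neg-homo (+ suc n)  = refl
  neg-homo (-[1+ n ]) = sym (-‿involutive _)

  -- Both numbers are lowered together; inserting `1# + - 1#` supplies the two units that the
  -- multiples on the right absorb.
  ⊖-homo : ∀ m n → ⟦ m ℤ.⊖ n ⟧ℤ ≈ m · 1# + - (n · 1#)
  ⊖-homo m zero = sym (trans (+-congˡ -0#≈0#) (+-identityʳ _))
  ⊖-homo zero (suc n) = sym (+-identityˡ _)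
  ⊖-homo (suc m) (suc n) = begin
    ⟦ suc m ℤ.⊖ suc n ⟧ℤ
      ≡⟨ ≡.cong ⟦_⟧ℤ (ℤₚ.[1+m]⊖[1+n]≡m⊖n m n) ⟩
    ⟦ m ℤ.⊖ n ⟧ℤ                                 ≈⟨ ⊖-homo m n ⟩
    m · 1# + - (n · 1#)                          ≈⟨ +-congʳ (+-identityˡ _) ⟨
    0# + m · 1# + - (n · 1#)                     ≈⟨ +-congʳ (+-congʳ (-‿inverseʳ 1#)) ⟨
    1# + - 1# + m · 1# + - (n · 1#)
      ≈⟨ +-congʳ (trans (+-assoc _ _ _) (trans (+-congˡ (+-comm _ _)) (sym (+-assoc _ _ _)))) ⟩
    1# + m · 1# + - 1# + - (n · 1#)              ≈⟨ +-assoc _ _ _ ⟩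
    1# + m · 1# + (- 1# + - (n · 1#))            ≈⟨ +-cong (sym (1+× m 1#)) (⁻¹-∙-comm _ _) ⟩
    suc m · 1# + - (1# + n · 1#)                 ≈⟨ +-congˡ (-‿cong (1+× n 1#)) ⟨
    suc m · 1# + - (suc n · 1#)                  ∎

  +-homo : ∀ i j → ⟦ i ℤ.+ j ⟧ℤ ≈ ⟦ i ⟧ℤ + ⟦ j ⟧ℤ
  +-homo (+ m)      (+ n)      = ×-homo-+ 1# m n
  +-homo (+ m)      (-[1+ n ]) = ⊖-homo m (suc n)
  +-homo (-[1+ m ]) (+ n)      = trans (⊖-homo n (suc m)) (+-comm _ _)
  +-homo (-[1+ m ]) (-[1+ n ]) = begin
    - (suc (suc (m ℕ.+ n)) · 1#)      ≡⟨ ≡.cong (λ k → - (suc k · 1#)) (ℕₚ.+-suc m n) ⟨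
    - ((suc m ℕ.+ suc n) · 1#)        ≈⟨ -‿cong (×-homo-+ 1# (suc m) (suc n)) ⟩
    - (suc m · 1# + suc n · 1#)       ≈⟨ ⁻¹-∙-comm _ _ ⟨
    - (suc m · 1#) + - (suc n · 1#)   ∎

  pos-*-homo : ∀ m j → ⟦ + m ℤ.* j ⟧ℤ ≈ ⟦ + m ⟧ℤ * ⟦ j ⟧ℤ
  pos-*-homo m (+ n) =
    trans (reflexive (≡.cong ⟦_⟧ℤ (≡.sym (ℤₚ.pos-* m n)))) (×1-homo-* m n)
  pos-*-homo m (-[1+ n ]) = begin
    ⟦ + m ℤ.* ℤ.- (+ suc n) ⟧ℤ
      ≡⟨ ≡.cong ⟦_⟧ℤ (ℤₚ.neg-distribʳ-* (+ m) (+ suc n)) ⟨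
    ⟦ ℤ.- (+ m ℤ.* + suc n) ⟧ℤ      ≈⟨ neg-homo (+ m ℤ.* + suc n) ⟩
    - ⟦ + m ℤ.* + suc n ⟧ℤ          ≈⟨ -‿cong (pos-*-homo m (+ suc n)) ⟩
    - (⟦ + m ⟧ℤ * (suc n · 1#))     ≈⟨ -‿distribʳ-* _ _ ⟩
    ⟦ + m ⟧ℤ * - (suc n · 1#)       ∎

  *-homo : ∀ i j → ⟦ i ℤ.* j ⟧ℤ ≈ ⟦ i ⟧ℤ * ⟦ j ⟧ℤ
  *-homo (+ m) j = pos-*-homo m j
  *-homo (-[1+ m ]) j = begin
    ⟦ ℤ.- (+ suc m) ℤ.* j ⟧ℤ        ≡⟨ ≡.cong ⟦_⟧ℤ (ℤₚ.neg-distribˡ-* (+ suc m) j) ⟨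
    ⟦ ℤ.- (+ suc m ℤ.* j) ⟧ℤ        ≈⟨ neg-homo (+ suc m ℤ.* j) ⟩
    - ⟦ + suc m ℤ.* j ⟧ℤ            ≈⟨ -‿cong (pos-*-homo (suc m) j) ⟩
    - ((suc m · 1#) * ⟦ j ⟧ℤ)       ≈⟨ -‿distribˡ-* _ _ ⟩
    - (suc m · 1#) * ⟦ j ⟧ℤ         ∎

  private
    morphism : ℤ.+-*-rawRing -Raw-AlmostCommutative⟶ fromCommutativeRing R
    morphism = record
      { ⟦_⟧    = ⟦_⟧ℤ
      ; +-homo = +-homo
      ; *-homo = *-homo
      ; -‿homo = neg-homo
      ; 0-homo = refl
      ; 1-homo = refl
      }

    _≟?_ : ∀ i j → Maybe (⟦ i ⟧ℤ ≈ ⟦ j ⟧ℤ)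
    i ≟? j with i ℤₚ.≟ j
    ... | yes i≡j = just (reflexive (≡.cong ⟦_⟧ℤ i≡j))
    ... | no  _   = nothing

  open import Algebra.Solver.Ring ℤ.+-*-rawRing (fromCommutativeRing R) morphism _≟?_ public
    using (solve; _:=_; _:+_; _:*_; _:-_; :-_; _:^_; con)

module FiniteSums {c ℓ} (R : CommutativeRing c ℓ) where
  open CommutativeRing R
  open RingNotation rawRing using (sum)
  open import Relation.Binary.Reasoning.Setoid setoid
  open import Algebra.Properties.CommutativeSemigroup +-commutativeSemigroup
    using (interchange)

  -- Taking a function on ℕ rather than on `Fin n` allows the bound to change while the summand
  -- stays, and peeling the first term is definitional.
  ∑ : ℕ → (ℕ → Carrier) → Carrier
  ∑ n f = sum {n} (λ i → f (toℕ i))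

  ∑-cong : ∀ n (f g : ℕ → Carrier) → (∀ i → i < n → f i ≈ g i) → ∑ n f ≈ ∑ n g
  ∑-cong zero    f g h = refl
  ∑-cong (suc n) f g h =
    +-cong (h 0 (s≤s z≤n)) (∑-cong n (f ∘ suc) (g ∘ suc) (λ i i<n → h (suc i) (s≤s i<n)))

  ∑-zero : ∀ n (f : ℕ → Carrier) → (∀ i → i < n → f i ≈ 0#) → ∑ n f ≈ 0#
  ∑-zero zero    f h = refl
  ∑-zero (suc n) f h =
    trans (+-cong (h 0 (s≤s z≤n)) (∑-zero n (f ∘ suc) (λ i i<n → h (suc i) (s≤s i<n)))) (+-identityˡ 0#)

  ∑-+ : ∀ n (f g : ℕ → Carrier) → ∑ n (λ i → f i + g i) ≈ ∑ n f + ∑ n g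
  ∑-+ zero    f g = sym (+-identityˡ 0#)
  ∑-+ (suc n) f g =
    trans (+-congˡ (∑-+ n (f ∘ suc) (g ∘ suc))) (interchange _ _ _ _)

  ∑-*ˡ : ∀ n k (f : ℕ → Carrier) → k * ∑ n f ≈ ∑ n (λ i → k * f i)
  ∑-*ˡ zero    k f = zeroʳ k
  ∑-*ˡ (suc n) k f = trans (distribˡ _ _ _) (+-congˡ (∑-*ˡ n k (f ∘ suc)))

  ∑-last : ∀ n (f : ℕ → Carrier) → ∑ (suc n) f ≈ ∑ n f + f n
  ∑-last zero    f = +-comm _ _
  ∑-last (suc n) f = trans (+-congˡ (∑-last n (f ∘ suc))) (sym (+-assoc _ _ _))

-- Identities between series are proved by comparing constant coefficients and
-- shifts, the product satisfying the Leibniz-like rule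
--   shift (f * g) = f₀ shift g + shift f * g.
module PowerSeries {c ℓ} (R : CommutativeRing c ℓ) where
  private
    module K where
      open CommutativeRing R public
      open FiniteSums R public
      open IntegerSolver R public
    module S = RingNotation (Series.series K.rawRing)
  open S using (Carrier; _≈_; _+_; _*_; 0#; 1#)
  open Series K.rawRing using (const)
  open import Relation.Binary.Reasoning.Setoid K.setoid

  shift : ∀ {b} {B : Set b} → (ℕ → B) → ℕ → B
  shift f n = f (suc n)

  private
    term : Carrier → Carrier → ℕ → ℕ → K.Carrier
    term f g n i = f i K.* g (n ∸ i)

    -- The rule that splits off the term with `f 0` holds by definition; this mirror image splits
    -- off the term with `g 0`. Playing one against the other gives commutativity.
    *-shiftʳ : ∀ f g n → (f * g) (suc n) K.≈ (f * shift g) n K.+ f (suc n) K.* g 0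
    *-shiftʳ f g zero =
      K.solve 2 (λ s t → s :+ (t :+ con (+ 0)) := s :+ con (+ 0) :+ t) K.refl _ _
      where open K
    *-shiftʳ f g (suc n) = begin
      f 0 K.* g (2 ℕ.+ n) K.+ (shift f * g) (suc n)
        ≈⟨ K.+-congˡ (*-shiftʳ (shift f) g n) ⟩
      f 0 K.* g (2 ℕ.+ n) K.+ ((shift f * shift g) n K.+ f (2 ℕ.+ n) K.* g 0)
        ≈⟨ K.+-assoc _ _ _ ⟨
      (f * shift g) (suc n) K.+ f (2 ℕ.+ n) K.* g 0 ∎

    *-cong : ∀ {f f′ g g′} → f ≈ f′ → g ≈ g′ → f * g ≈ f′ * g′
    *-cong {f} {f′} {g} {g′} f≈ g≈ n =
      K.∑-cong (suc n) (term f g n) (term f′ g′ n) (λ i _ → K.*-cong (f≈ i) (g≈ (n ∸ i)))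

    *-comm : ∀ f g → f * g ≈ g * f
    *-comm f g zero    = K.+-congʳ (K.*-comm _ _)
    *-comm f g (suc n) = begin
      f 0 K.* g (suc n) K.+ (shift f * g) n  ≈⟨ K.+-cong (K.*-comm _ _) (*-comm (shift f) g n) ⟩
      g (suc n) K.* f 0 K.+ (g * shift f) n  ≈⟨ K.+-comm _ _ ⟩
      (g * shift f) n K.+ g (suc n) K.* f 0  ≈⟨ *-shiftʳ g f n ⟨
      (g * f) (suc n)                        ∎

    distribʳ : ∀ h f g → (f + g) * h ≈ f * h + g * h
    distribʳ h f g n = K.trans
      (K.∑-cong (suc n) (term (f + g) h n) (λ i → term f h n i K.+ term g h n i)
                (λ i _ → K.distribʳ _ _ _))
      (K.∑-+ (suc n) (term f h n) (term g h n))

    scale-* : ∀ k f g n → ((λ i → k K.* f i) * g) n K.≈ k K.* (f * g) n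
    scale-* k f g n = K.trans
      (K.∑-cong (suc n) (term (λ i → k K.* f i) g n) (λ i → k K.* term f g n i)
                (λ i _ → K.*-assoc _ _ _))
      (K.sym (K.∑-*ˡ (suc n) k (term f g n)))

    -- By the shift rule, the case `suc n` becomes distributivity, scaling by `f 0`, and the case
    -- `n` with `shift f` in place of `f`.
    *-assoc : ∀ f g h → (f * g) * h ≈ f * (g * h)
    *-assoc f g h zero =
      K.solve 3 (λ s t r → (s :* t :+ con (+ 0)) :* r :+ con (+ 0)
                        := s :* (t :* r :+ con (+ 0)) :+ con (+ 0)) K.refl _ _ _
      where open K
    *-assoc f g h (suc n) = begin
      (f 0 K.* g 0 K.+ K.0#) K.* h (suc n) K.+ (((λ i → f 0 K.* g (suc i)) + shift f * g) * h) n
        ≈⟨ K.+-cong (K.*-congʳ (K.+-identityʳ _)) (distribʳ h (λ i → f 0 K.* g (suc i)) (shift f * g) n) ⟩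
      f 0 K.* g 0 K.* h (suc n) K.+ (((λ i → f 0 K.* g (suc i)) * h) n K.+ ((shift f * g) * h) n)
        ≈⟨ K.+-congˡ (K.+-cong (scale-* (f 0) (shift g) h n) (*-assoc (shift f) g h n)) ⟩
      f 0 K.* g 0 K.* h (suc n) K.+ (f 0 K.* (shift g * h) n K.+ (shift f * (g * h)) n)
        ≈⟨ K.solve 5 (λ s t r w e → s :* t :* r :+ (s :* w :+ e) := s :* (t :* r :+ w) :+ e)
             K.refl _ _ _ _ _ ⟩
      f 0 K.* (g 0 K.* h (suc n) K.+ (shift g * h) n) K.+ (shift f * (g * h)) n ∎
      where open K using (_:=_; _:*_; _:+_)

  const-* : ∀ k f n → (const k * f) n K.≈ k K.* f n
  const-* k f zero    = K.+-identityʳ _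
  const-* k f (suc n) = K.trans
    (K.+-congˡ (K.∑-zero (suc n) (term 0# f n) (λ i _ → K.zeroˡ _))) (K.+-identityʳ _)

  seriesRing : CommutativeRing c ℓ
  seriesRing = record
    { isCommutativeRing = record
      { isRing = record
        { +-isAbelianGroup = record
          { isGroup = record
            { isMonoid = record
              { isSemigroup = record
                { isMagma = record
                  { isEquivalence = record
                    { refl  = λ n → K.refl
                    ; sym   = λ f≈g n → K.sym (f≈g n)
                    ; trans = λ f≈g g≈h n → K.trans (f≈g n) (g≈h n)
                    }
                  ; ∙-cong = λ f≈ g≈ n → K.+-cong (f≈ n) (g≈ n)
                  }
                ; assoc = λ f g h n → K.+-assoc _ _ _
                }
              ; identity = (λ f n → K.+-identityˡ _) , (λ f n → K.+-identityʳ _)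
              }
            ; inverse = (λ f n → K.-‿inverseˡ _) , (λ f n → K.-‿inverseʳ _)
            ; ⁻¹-cong = λ f≈ n → K.-‿cong (f≈ n)
            }
          ; comm = λ f g n → K.+-comm _ _
          }
        ; *-cong = *-cong
        ; *-assoc = *-assoc
        ; *-identity = 1-identityˡ
                     , λ f n → K.trans (*-comm f 1# n) (1-identityˡ f n)
        ; distrib = (λ h f g n → K.trans (*-comm h (f + g) n) (K.trans (distribʳ h f g n)
                       (K.+-cong (*-comm f h n) (*-comm g h n))))
                  , distribʳ
        }
      ; *-comm = *-comm
      }
    }
    where
    1-identityˡ : ∀ f → 1# * f ≈ f
    1-identityˡ f n = K.trans (const-* K.1# f n) (K.*-identityˡ _)

-- Linear fixpoint equations and substitution for the second variable

module CommutativeRingLemmas {c ℓ} (R : CommutativeRing c ℓ) where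
  open CommutativeRing R
  open IntegerSolver R
  open import Relation.Binary.Reasoning.Setoid setoid

  fixpoint⇒inverse : ∀ g i → i ≈ 1# + g * i → (1# - g) * i ≈ 1#
  fixpoint⇒inverse g i i≈ = begin
    (1# - g) * i          ≈⟨ solve 2 (λ g i → (con (+ 1) :- g) :* i := i :- g :* i) refl g i ⟩
    i - g * i             ≈⟨ +-congʳ i≈ ⟩
    1# + g * i - g * i    ≈⟨ solve 1 (λ t → con (+ 1) :+ t :- t := con (+ 1)) refl (g * i) ⟩
    1#                    ∎

  -- A series is recognised as a fraction through the linear equation that it satisfies, whose
  -- solution is unique as `1# - g` is invertible.
  fixpoint⇒quotient : ∀ g i h f → (1# - g) * i ≈ 1# → f ≈ h + g * f → f ≈ h * i
  fixpoint⇒quotient g i h f gi≈1 f≈ = begin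
    f                          ≈⟨ *-identityʳ f ⟨
    f * 1#                     ≈⟨ *-congˡ gi≈1 ⟨
    f * ((1# - g) * i)
      ≈⟨ solve 3 (λ g i f → f :* ((con (+ 1) :- g) :* i) := (f :- g :* f) :* i) refl g i f ⟩
    (f - g * f) * i            ≈⟨ *-congʳ (+-congʳ f≈) ⟩
    (h + g * f - g * f) * i
      ≈⟨ *-congʳ (solve 2 (λ h t → h :+ t :- t := h) refl h (g * f)) ⟩
    h * i                      ∎

  indicator-step : ∀ g p i f → f ≈ p * i → 0# + g * f ≈ g * p * i
  indicator-step g p i f f≈ =
    trans (+-identityˡ _) (trans (*-congˡ f≈) (sym (*-assoc g p i)))

module Substitution {c ℓ} (R : CommutativeRing c ℓ) where
  private
    module K where
      open CommutativeRing R public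
      open FiniteSums R public
  open PowerSeries R
  open CommutativeRing seriesRing
  open RingNotation rawRing using (_^_)
  open Series K.rawRing using (const; var; 1/[1-_])
  open import Algebra.Properties.CommutativeSemigroup *-commutativeSemigroup
    using (x∙yz≈y∙xz)
  open CommutativeRingLemmas seriesRing

  infix 4 _≈[_]_
  -- Congruence modulo x^N, which makes equality of series accessible to induction on N.
  _≈[_]_ : Carrier → ℕ → Carrier → Set ℓ
  f ≈[ N ] g = ∀ n → n < N → f n K.≈ g n

  ≈⇒≈[] : ∀ {N f g} → f ≈ g → f ≈[ N ] g
  ≈⇒≈[] f≈g n _ = f≈g n

  ≈[]⇒≈ : ∀ {f g} → (∀ N → f ≈[ N ] g) → f ≈ g
  ≈[]⇒≈ f≈g n = f≈g (suc n) n ℕₚ.≤-refl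

  ≈[]-trans : ∀ {N f g h} → f ≈[ N ] g → g ≈[ N ] h → f ≈[ N ] h
  ≈[]-trans f≈g g≈h n n<N = K.trans (f≈g n n<N) (g≈h n n<N)

  ≈[]-sym : ∀ {N f g} → f ≈[ N ] g → g ≈[ N ] f
  ≈[]-sym f≈g n n<N = K.sym (f≈g n n<N)

  truncatedSetoid : ℕ → Setoid c ℓ
  truncatedSetoid N = record
    { Carrier = Carrier
    ; _≈_     = λ f g → f ≈[ N ] g
    ; isEquivalence = record
      { refl = λ n _ → K.refl ; sym = λ {f} {g} → ≈[]-sym {N} {f} {g}
      ; trans = λ {f} {g} {h} → ≈[]-trans {N} {f} {g} {h} }
    }

  +-cong-[] : ∀ {N f f′ g g′} → f ≈[ N ] f′ → g ≈[ N ] g′ → f + g ≈[ N ] f′ + g′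
  +-cong-[] f≈ g≈ n n<N = K.+-cong (f≈ n n<N) (g≈ n n<N)

  *-congˡ-[] : ∀ {N} f {g g′} → g ≈[ N ] g′ → f * g ≈[ N ] f * g′
  *-congˡ-[] f {g} {g′} g≈ n n<N =
    K.∑-cong (suc n) (λ i → f i K.* g (n ∸ i)) (λ i → f i K.* g′ (n ∸ i))
      (λ i _ → K.*-congˡ (g≈ (n ∸ i) (ℕₚ.≤-<-trans (ℕₚ.m∸n≤m n i) n<N)))

  *-congʳ-[] : ∀ {N} f {g g′} → g ≈[ N ] g′ → g * f ≈[ N ] g′ * f
  *-congʳ-[] f {g} {g′} g≈ n n<N =
    K.trans (*-comm g f n) (K.trans (*-congˡ-[] f g≈ n n<N) (*-comm f g′ n))

  -- Without a constant term in `g`, coefficient n of the product only sees coefficients of the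
  -- other factor below n.
  *-raise-[] : ∀ {N} g {f f′} → g 0 K.≈ K.0# → f ≈[ N ] f′ → g * f ≈[ suc N ] g * f′
  *-raise-[] g {f} {f′} g₀≈0 f≈ zero    _ = K.+-congʳ
    (K.trans (K.*-congʳ g₀≈0) (K.trans (K.zeroˡ _)
      (K.sym (K.trans (K.*-congʳ g₀≈0) (K.zeroˡ _)))))
  *-raise-[] g {f} {f′} g₀≈0 f≈ (suc n) (s≤s n<N) = K.+-cong
    (K.trans (K.*-congʳ g₀≈0) (K.trans (K.zeroˡ _)
      (K.sym (K.trans (K.*-congʳ g₀≈0) (K.zeroˡ _)))))
    (*-congˡ-[] (shift g) f≈ n n<N)

  *-∑ : ∀ f (h : ℕ → Carrier) N n →
    (f * (λ m → K.∑ N (λ l → h l m))) n K.≈ K.∑ N (λ l → (f * h l) n)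
  *-∑ f h zero    n = zeroʳ f n
  *-∑ f h (suc N) n = K.trans
    (distribˡ f (h 0) (λ m → K.∑ N (λ l → h (suc l) m)) n)
    (K.+-congˡ (*-∑ f (h ∘ suc) N n))

  infixl 9 _⟨_⟩
  -- Definitionally the substitution of the statement, available before `q`, `v`, `a` and `m` are
  -- fixed.
  _⟨_⟩ : (ℕ → Carrier) → Carrier → Carrier
  (F ⟨ g ⟩) n = K.∑ (suc n) (λ l → (F l * g ^ l) n)

  ⟨⟩-cong : ∀ {F G} g → (∀ l → F l ≈ G l) → F ⟨ g ⟩ ≈ G ⟨ g ⟩
  ⟨⟩-cong {F} {G} g F≈G n =
    K.∑-cong (suc n) (λ l → (F l * g ^ l) n) (λ l → (G l * g ^ l) n)
      (λ l _ → *-congʳ {g ^ l} (F≈G l) n)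

  ⟨⟩-+ : ∀ F G g → (λ l → F l + G l) ⟨ g ⟩ ≈ F ⟨ g ⟩ + G ⟨ g ⟩
  ⟨⟩-+ F G g n = K.trans
    (K.∑-cong (suc n) (λ l → ((F l + G l) * g ^ l) n)
       (λ l → (F l * g ^ l) n K.+ (G l * g ^ l) n)
       (λ l _ → distribʳ (g ^ l) (F l) (G l) n))
    (K.∑-+ (suc n) (λ l → (F l * g ^ l) n) (λ l → (G l * g ^ l) n))

  -- For l > n the l-th term of the sum does not contribute to the n-th
  -- coefficient.
  *^-vanish : ∀ {g} → g 0 K.≈ K.0# → ∀ f l → f * g ^ l ≈[ l ] 0#
  *^-vanish g₀≈0 f zero n ()
  *^-vanish {g} g₀≈0 f (suc l) =
    ≈[]-trans (≈⇒≈[] (x∙yz≈y∙xz f g (g ^ l)))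
      (≈[]-trans (*-raise-[] g g₀≈0 (*^-vanish g₀≈0 f l)) (≈⇒≈[] (zeroʳ g)))

  -- Σ_{l≥m} uˡ
  indicator : ℕ → ℕ → Carrier
  indicator zero    _       = 1#
  indicator (suc m) zero    = 0#
  indicator (suc m) (suc l) = indicator m l

  module _ (g : Carrier) (g₀≈0 : g 0 K.≈ K.0#) where

    private
      -- The sum in `_⟨_⟩` is cut at a bound that moves with the coefficient. A common bound for all
      -- coefficients below `N` gives a finite sum of series, from which factors can be pulled out.
      upTo : ℕ → (ℕ → Carrier) → Carrier
      upTo N F m = K.∑ N (λ l → (F l * g ^ l) m)

      upTo-mono : ∀ d F m → upTo (d ℕ.+ suc m) F m K.≈ (F ⟨ g ⟩) m
      upTo-mono zero    F m = K.refl
      upTo-mono (suc d) F m = K.trans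
        (K.∑-last (d ℕ.+ suc m) (λ l → (F l * g ^ l) m))
        (K.trans (K.+-congˡ (*^-vanish g₀≈0 (F _) (d ℕ.+ suc m) m (ℕₚ.m≤n+m (suc m) d)))
          (K.trans (K.+-identityʳ _) (upTo-mono d F m)))

      ⟨⟩≈upTo : ∀ N F → F ⟨ g ⟩ ≈[ N ] upTo N F
      ⟨⟩≈upTo N F m m<N = K.sym (≡.subst (λ k → upTo k F m K.≈ (F ⟨ g ⟩) m)
        (ℕₚ.m∸n+n≡m m<N) (upTo-mono (N ∸ suc m) F m))

    ⟨⟩-shift : ∀ F → F ⟨ g ⟩ ≈ F 0 + g * shift F ⟨ g ⟩
    ⟨⟩-shift F n = K.+-cong (*-identityʳ (F 0) n) (K.trans
      (K.∑-cong n (λ l → (F (suc l) * (g * g ^ l)) n) (λ l → (g * (F (suc l) * g ^ l)) n)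
        (λ l _ → x∙yz≈y∙xz (F (suc l)) g (g ^ l) n))
      (K.trans (K.sym (*-∑ g (λ l → F (suc l) * g ^ l) n n))
        -- The bound here is n, one less than exactness at coefficient n would ask for;
        -- multiplication by `g` makes up for it.
        (*-raise-[] g g₀≈0 (≈[]-sym (⟨⟩≈upTo n (shift F))) n ℕₚ.≤-refl)))

    -- Unrolling N times leaves a remainder with the factor `g ^ N`, invisible modulo x^N. This
    -- turns every recurrence in l, or in the number of copies, into a substituted series.
    ⟨⟩-unique : ∀ (Φ h : ℕ → Carrier) → (∀ l → Φ l ≈ h l + g * Φ (suc l)) → Φ 0 ≈ h ⟨ g ⟩
    ⟨⟩-unique Φ h Φ≈ = ≈[]⇒≈ (λ N → approx N Φ h Φ≈)
      where
      approx : ∀ N Φ h → (∀ l → Φ l ≈ h l + g * Φ (suc l)) → Φ 0 ≈[ N ] h ⟨ g ⟩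
      approx zero    Φ h Φ≈ n ()
      approx (suc N) Φ h Φ≈ =
        ≈[]-trans (≈⇒≈[] (Φ≈ 0))
        (≈[]-trans (+-cong-[] (≈⇒≈[] refl)
          (*-raise-[] g g₀≈0 (approx N (shift Φ) (shift h) (λ l → Φ≈ (suc l)))))
        (≈⇒≈[] (sym (⟨⟩-shift h))))

    private
      1/[1-]≈⟨⟩ : 1/[1- g ] ≈ (λ _ → 1#) ⟨ g ⟩
      1/[1-]≈⟨⟩ n = K.∑-cong (suc n) (λ l → (g ^ l) n) (λ l → (1# * g ^ l) n)
        (λ l _ → sym (*-identityˡ (g ^ l)) n)

    1/[1-]-fixpoint : 1/[1- g ] ≈ 1# + g * 1/[1- g ]
    1/[1-]-fixpoint = trans {1/[1- g ]} {(λ _ → 1#) ⟨ g ⟩} {1# + g * 1/[1- g ]} 1/[1-]≈⟨⟩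
      (trans {(λ _ → 1#) ⟨ g ⟩} {1# + g * (λ _ → 1#) ⟨ g ⟩} {1# + g * 1/[1- g ]}
        (⟨⟩-shift (λ _ → 1#))
        (+-congˡ {1#} (*-congˡ {g} (sym {1/[1- g ]} 1/[1-]≈⟨⟩))))

    1/[1-]-inverse : (1# - g) * 1/[1- g ] ≈ 1#
    1/[1-]-inverse = fixpoint⇒inverse g 1/[1- g ] 1/[1-]-fixpoint

    ⟨⟩-constant : ∀ h → (λ _ → h) ⟨ g ⟩ ≈ h * 1/[1- g ]
    ⟨⟩-constant h = fixpoint⇒quotient g 1/[1- g ] h ((λ _ → h) ⟨ g ⟩)
      1/[1-]-inverse (⟨⟩-shift (λ _ → h))

    ⟨⟩-*ˡ : ∀ h F → (λ l → h * F l) ⟨ g ⟩ ≈ h * F ⟨ g ⟩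
    ⟨⟩-*ˡ h F n = K.trans
      (K.∑-cong (suc n) (λ l → ((h * F l) * g ^ l) n) (λ l → (h * (F l * g ^ l)) n)
        (λ l _ → *-assoc h (F l) (g ^ l) n))
      (K.trans (K.sym (*-∑ h (λ l → F l * g ^ l) (suc n) n))
        (*-congˡ-[] h (≈[]-sym (⟨⟩≈upTo (suc n) F)) n ℕₚ.≤-refl))

    ⟨⟩-indicator : ∀ m → indicator m ⟨ g ⟩ ≈ g ^ m * 1/[1- g ]
    ⟨⟩-indicator zero    = ⟨⟩-constant 1#
    ⟨⟩-indicator (suc m) =
      trans {indicator (suc m) ⟨ g ⟩} {0# + g * indicator m ⟨ g ⟩} {g ^ suc m * 1/[1- g ]}
        (⟨⟩-shift (indicator (suc m)))
        (indicator-step g (g ^ m) 1/[1- g ] (indicator m ⟨ g ⟩) (⟨⟩-indicator m))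

  var-*-zero : ∀ f → (var * f) 0 K.≈ K.0#
  var-*-zero f = K.trans (K.+-identityʳ _) (K.zeroˡ _)

  var-*-suc : ∀ f n → (var * f) (suc n) K.≈ f n
  var-*-suc f n = K.trans (K.+-cong (K.zeroˡ _) (*-congʳ {f} shift-var n))
    (K.trans (K.+-identityˡ _) (*-identityˡ f n))
    where
    shift-var : shift var ≈ 1#
    shift-var zero    = K.refl
    shift-var (suc n) = K.refl

  var-cancel : ∀ {f g} → var * f ≈ var * g → f ≈ g
  var-cancel {f} {g} e n =
    K.trans (K.sym (var-*-suc f n)) (K.trans (e (suc n)) (var-*-suc g n))

  const+var*shift : ∀ f → f ≈ const (f 0) + var * shift f
  const+var*shift f zero    = K.sym (K.trans (K.+-congˡ (var-*-zero (shift f))) (K.+-identityʳ _))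
  const+var*shift f (suc n) = K.sym (K.trans (K.+-congˡ (var-*-suc (shift f) n)) (K.+-identityˡ _))

  const-cong : ∀ {j k} → j K.≈ k → const j ≈ const k
  const-cong j≈k zero    = j≈k
  const-cong j≈k (suc n) = K.refl

  const-+ : ∀ j k → const (j K.+ k) ≈ const j + const k
  const-+ j k zero    = K.refl
  const-+ j k (suc n) = K.sym (K.+-identityˡ _)

  const-neg : ∀ k → const (K.- k) ≈ - const k
  const-neg k zero    = K.refl
  const-neg k (suc n) = K.sym -0#≈0#
    where open import Algebra.Properties.Ring (CommutativeRing.ring R) using (-0#≈0#)

  const-*-const : ∀ j k → const (j K.* k) ≈ const j * const k
  const-*-const j k n = K.sym (K.trans (const-* j (const k) n) (scale n))
    where
    scale : ∀ n → j K.* const k n K.≈ const (j K.* k) n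
    scale zero    = K.refl
    scale (suc n) = K.zeroʳ j

-- Counting the subword run by run

-- Occurrences of 12⋯(m-1)mᵃ for a = a′ + 2 and m = m′ + 2
module Subword (a′ m′ : ℕ) where
  private
    a = 2 ℕ.+ a′
    m = 2 ℕ.+ m′

  τ : Word
  τ = pattern-τ a m

  Copies : ℕ → ℕ → Word → Set
  Copies zero    t w       = ⊤
  Copies (suc k) t []      = ⊥
  Copies (suc k) t (x ∷ w) = x ≡ t × Copies k t w

  -- The index counts ascents, so an occurrence of `τ` at the front is the case `suc m′`. After the
  -- last ascent `suc a′` further copies make a equal letters.
  Match : ℕ → Word → Set
  Match _       []          = ⊥
  Match zero    (x ∷ w)     = Copies (suc a′) x w
  Match (suc j) (x ∷ [])    = ⊥
  Match (suc j) (x ∷ z ∷ w) = x < z × Match j (z ∷ w)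

  private
    -- `τ` with arbitrary increasing letters: its tail is again of this form, with `f ∘ suc` for
    -- `f`.
    shape : (ℕ → ℕ) → ℕ → Word
    shape f j = applyUpTo f j ++ replicate a (f j)

    prefix : Word → Word → Word
    prefix w σ = take (length σ) w

    OI-tail : ∀ {x t w σ} → OrderIsomorphic (x ∷ w) (t ∷ σ) → OrderIsomorphic w σ
    OI-tail (len , _ ∷ h) = ℕₚ.suc-injective len , All.map All.tail h

    OI⇒Copies : ∀ k t x w → OrderIsomorphic (x ∷ prefix w (replicate k t)) (t ∷ replicate k t) →
                Copies k x w
    OI⇒Copies zero    t x w       _ = tt
    OI⇒Copies (suc k) t x []      (() , _)
    OI⇒Copies (suc k) t x (z ∷ w) (len , h@((_ ∷ (_ , x≡z⇔) ∷ _) ∷ _ ∷ _))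
      with Equivalence.from x≡z⇔ ≡.refl
    ... | ≡.refl = ≡.refl , OI⇒Copies k t x w (OI-tail (len , h))

    OI⇒Match : ∀ f → (∀ i → f i < f (suc i)) → ∀ j w →
               OrderIsomorphic (prefix w (shape f j)) (shape f j) → Match j w
    OI⇒Match f f< zero    []          (() , _)
    OI⇒Match f f< (suc j) []          (() , _)
    OI⇒Match f f< zero    (x ∷ w)     oi = OI⇒Copies (suc a′) (f 0) x w oi
    -- The second letter of the pattern belongs to the repeated block if `j` is 1 and to the ascent
    -- otherwise; only after this split does the pattern reduce.
    OI⇒Match f f< (suc zero)    (x ∷ []) (() , _)
    OI⇒Match f f< (suc (suc j)) (x ∷ []) (() , _)
    OI⇒Match f f< (suc zero) (x ∷ z ∷ w) oi@(len , (_ ∷ (x<z⇔ , _) ∷ _) ∷ _) =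
      Equivalence.from x<z⇔ (f< 0) , OI⇒Match (f ∘ suc) (f< ∘ suc) zero (z ∷ w) (OI-tail oi)
    OI⇒Match f f< (suc (suc j)) (x ∷ z ∷ w) oi@(len , (_ ∷ (x<z⇔ , _) ∷ _) ∷ _) =
      Equivalence.from x<z⇔ (f< 0) , OI⇒Match (f ∘ suc) (f< ∘ suc) (suc j) (z ∷ w) (OI-tail oi)

    Above : ℕ → ℕ → Word → Word → Set
    Above x t w σ = All (λ p → x ≤ proj₁ p × t ≤ proj₂ p) (zip w σ)

    sameOrder-refl : ∀ p → SameOrder p p
    sameOrder-refl p =
      mk⇔ (λ x<x → ⊥-elim (ℕₚ.<-irrefl ≡.refl x<x)) (λ x<x → ⊥-elim (ℕₚ.<-irrefl ≡.refl x<x)) ,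
      mk⇔ (λ _ → ≡.refl) (λ _ → ≡.refl)

    sameOrder-< : ∀ {x t p} → x < proj₁ p × t < proj₂ p → SameOrder (x , t) p
    sameOrder-< (x< , t<) = mk⇔ (λ _ → t<) (λ _ → x<) ,
      mk⇔ (λ e → ⊥-elim (ℕₚ.<⇒≢ x< e)) (λ e → ⊥-elim (ℕₚ.<⇒≢ t< e))

    sameOrder-> : ∀ {x t p} → x < proj₁ p × t < proj₂ p → SameOrder p (x , t)
    sameOrder-> (x< , t<) =
      mk⇔ (λ e → ⊥-elim (ℕₚ.<-asym x< e)) (λ e → ⊥-elim (ℕₚ.<-asym t< e)) ,
      mk⇔ (λ e → ⊥-elim (ℕₚ.<⇒≢ x< (≡.sym e))) (λ e → ⊥-elim (ℕₚ.<⇒≢ t< (≡.sym e)))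

    OI-∷ : ∀ {x t w σ} → Above (suc x) (suc t) w σ → OrderIsomorphic w σ →
           OrderIsomorphic (x ∷ w) (t ∷ σ)
    OI-∷ above (len , h) = ≡.cong suc len ,
      (sameOrder-refl _ ∷ All.map sameOrder-< above) ∷
      All.zipWith (λ (p> , hp) → sameOrder-> p> ∷ hp) (above , h)

    Copies⇒constant : ∀ k t x w → Copies k x w →
      length (prefix w (replicate k t)) ≡ length (replicate k t) ×
      All (_≡ (x , t)) (zip (prefix w (replicate k t)) (replicate k t))
    Copies⇒constant zero    t x w       _         = ≡.refl , []
    Copies⇒constant (suc k) t x (_ ∷ w) (≡.refl , h) with Copies⇒constant k t x w h
    ... | len , all = ≡.cong suc len , ≡.refl ∷ all

    -- The second component strengthens the induction: a letter put in front must lie below all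
    -- letters of both words for its comparisons to agree.
    Match⇒OI : ∀ f → (∀ i → f i < f (suc i)) → ∀ j x w → Match j (x ∷ w) →
      OrderIsomorphic (prefix (x ∷ w) (shape f j)) (shape f j) ×
      Above x (f 0) (prefix (x ∷ w) (shape f j)) (shape f j)
    Match⇒OI f f< zero x w h with Copies⇒constant (suc a′) (f 0) x w h
    ... | len , const =
      (≡.cong suc len , All.map (λ { ≡.refl → All.map (λ { ≡.refl → sameOrder-refl _ }) const′ }) const′) ,
      All.map (λ { ≡.refl → ℕₚ.≤-refl , ℕₚ.≤-refl }) const′
      where const′ = ≡.refl ∷ const
    Match⇒OI f f< (suc j) x (z ∷ w) (x<z , h) with Match⇒OI (f ∘ suc) (f< ∘ suc) j z w h
    ... | oi , above = OI-∷ above′ oi ,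
      (ℕₚ.≤-refl , ℕₚ.≤-refl) ∷ All.map (λ (x< , t<) → ℕₚ.<⇒≤ x< , ℕₚ.<⇒≤ t<) above′
      where
      above′ = All.map (λ (z≤ , t≤) → ℕₚ.<-≤-trans x<z z≤ , ℕₚ.<-≤-trans (f< 0) t≤) above

  μ-hit : ∀ {w x} → Match (suc m′) (x ∷ w) → μ τ (x ∷ w) ≡ suc (μ τ w)
  μ-hit {w} {x} h = ≡.cong length (Listₚ.filter-accept
    (λ s → orderIsomorphic? (take (length τ) s) τ)
    (proj₁ (Match⇒OI suc (λ _ → ℕₚ.≤-refl) (suc m′) x w h)))

  μ-miss : ∀ {w x} → ¬ Match (suc m′) (x ∷ w) → μ τ (x ∷ w) ≡ μ τ w
  μ-miss {w} {x} h = ≡.cong length (Listₚ.filter-reject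
    (λ s → orderIsomorphic? (take (length τ) s) τ)
    (λ oi → h (OI⇒Match suc (λ _ → ℕₚ.≤-refl) (suc m′) (x ∷ w) oi)))

  firstOr : ℕ → Word → ℕ
  firstOr t []      = t
  firstOr t (x ∷ _) = x

  AscendsTo : ℕ → Word → Set
  AscendsTo t []      = ⊤
  AscendsTo t (x ∷ u) = x < firstOr t u × AscendsTo t u

  AscendsTo-∷ʳ : ∀ {t z} u → AscendsTo t u → t < z → AscendsTo z (u ++ t ∷ [])
  AscendsTo-∷ʳ []          _           t<z = t<z , tt
  AscendsTo-∷ʳ (x ∷ [])    (x<t , _)   t<z = x<t , t<z , tt
  AscendsTo-∷ʳ (x ∷ _ ∷ u) (x<y , asc) t<z = x<y , AscendsTo-∷ʳ (_ ∷ u) asc t<z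

  -- The word w cannot prolong an ascending run that ends in c + 1 copies of t.
  Breaks : ℕ → ℕ → Word → Set
  Breaks t c       []      = ⊤
  Breaks t zero    (z ∷ w) = z < t
  Breaks t (suc c) (z ∷ w) = z ≢ t

  run : Word → ℕ → ℕ → Word → Word
  run u t c w = u ++ t ∷ replicate c t ++ w

  -- A run of k ascending letters and c + 1 copies holds at most one occurrence: its repeated block
  -- must start at the first copy, being preceded by an ascent, and its ascent must use the last m -
  -- 1 of the k letters.
  completes? : ∀ k c → Dec (suc m′ ≤ k × suc a′ ≤ c)
  completes? k c = (suc m′ ≤? k) ×-dec (suc a′ ≤? c)

  ω : ℕ → ℕ → ℕ
  ω k c = if does (completes? k c) then 1 else 0

  ω-yes : ∀ {k c} → suc m′ ≤ k × suc a′ ≤ c → ω k c ≡ 1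
  ω-yes {k} {c} h = ≡.cong (λ b → if b then 1 else 0) (dec-true (completes? k c) h)

  ω-no : ∀ {k c} → ¬ (suc m′ ≤ k × suc a′ ≤ c) → ω k c ≡ 0
  ω-no {k} {c} ¬h = ≡.cong (λ b → if b then 1 else 0) (dec-false (completes? k c) ¬h)

  private
    Breaks⇒≢ : ∀ t c {z w} → Breaks t c (z ∷ w) → z ≢ t
    Breaks⇒≢ t zero    z<t = ℕₚ.<⇒≢ z<t
    Breaks⇒≢ t (suc c) z≢t = z≢t

    Copies⇒≤ : ∀ k t c w → (∀ {z v} → w ≡ z ∷ v → z ≢ t) → Copies k t (replicate c t ++ w) → k ≤ c
    Copies⇒≤ zero    t c       w       b h         = z≤n
    Copies⇒≤ (suc k) t zero    (z ∷ w) b (z≡t , _) = contradiction z≡t (b ≡.refl)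
    Copies⇒≤ (suc k) t (suc c) w       b (_ , h)   = s≤s (Copies⇒≤ k t c w b h)

    ≤⇒Copies : ∀ k t c w → k ≤ c → Copies k t (replicate c t ++ w)
    ≤⇒Copies zero    t c       w _         = tt
    ≤⇒Copies (suc k) t (suc c) w (s≤s k≤c) = ≡.refl , ≤⇒Copies k t c w k≤c

    -- The ascents of a match at the front use up all of `u`: stopping inside `u` would require two
    -- equal neighbours there, and going on past `t` an ascent that `Breaks` excludes.
    Match⇒ : ∀ j u t c w → AscendsTo t u → Breaks t c w → Match j (run u t c w) →
             j ≡ length u × suc a′ ≤ c
    Match⇒ zero [] t c w asc b h =
      ≡.refl , Copies⇒≤ (suc a′) t c w (λ { ≡.refl → Breaks⇒≢ t c b }) h
    Match⇒ (suc j) [] t zero    (z ∷ w) asc b (t<z , _) = contradiction b (ℕₚ.<-asym t<z)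
    Match⇒ (suc j) [] t (suc c) w       asc b (t<t , _) = contradiction t<t (ℕₚ.<-irrefl ≡.refl)
    Match⇒ zero (x ∷ [])    t c w (x<t , _) b (t≡x , _) = contradiction (≡.sym t≡x) (ℕₚ.<⇒≢ x<t)
    Match⇒ zero (x ∷ y ∷ u) t c w (x<y , _) b (y≡x , _) = contradiction (≡.sym y≡x) (ℕₚ.<⇒≢ x<y)
    Match⇒ (suc j) (x ∷ [])    t c w (_ , asc) b (_ , h) with Match⇒ j [] t c w asc b h
    ... | j≡ , a≤ = ≡.cong suc j≡ , a≤
    Match⇒ (suc j) (x ∷ y ∷ u) t c w (_ , asc) b (_ , h) with Match⇒ j (y ∷ u) t c w asc b h
    ... | j≡ , a≤ = ≡.cong suc j≡ , a≤

    ⇒Match : ∀ u t c w → AscendsTo t u → suc a′ ≤ c → Match (length u) (run u t c w)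
    ⇒Match []          t c w asc         a≤ = ≤⇒Copies (suc a′) t c w a≤
    ⇒Match (x ∷ [])    t c w (x<t , asc) a≤ = x<t , ⇒Match [] t c w asc a≤
    ⇒Match (x ∷ y ∷ u) t c w (x<y , asc) a≤ = x<y , ⇒Match (y ∷ u) t c w asc a≤

  -- Removing the letters of `u` one by one, a match can only start where `suc m′` of them remain,
  -- and this is the length at which `ω (length u) c` jumps from 0 to 1.
  μ-run : ∀ u t c w → AscendsTo t u → Breaks t c w →
          μ τ (run u t c w) ≡ ω (length u) c ℕ.+ μ τ (replicate c t ++ w)
  μ-run [] t c w asc b = ≡.trans
    (μ-miss (λ h → contradiction (proj₁ (Match⇒ (suc m′) [] t c w asc b h)) (λ ())))
    (≡.cong (ℕ._+ μ τ (replicate c t ++ w)) (≡.sym (ω-no {0} {c} (λ { (() , _) }))))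
  μ-run (x ∷ u) t c w (x< , asc) b with suc m′ ℕ.≟ suc (length u) | suc a′ ≤? c
  ... | yes m≡ | yes a≤ = ≡.trans
    (μ-hit {run u t c w} {x} (≡.subst (λ j → Match j (run (x ∷ u) t c w)) (≡.sym m≡)
      (⇒Match (x ∷ u) t c w (x< , asc) a≤)))
    (≡.trans (≡.cong suc (μ-run u t c w asc b)) (≡.trans
      (≡.cong (λ i → suc (i ℕ.+ μ τ (replicate c t ++ w)))
        (ω-no {length u} {c} (λ (m≤ , _) → ℕₚ.<⇒≱ (ℕₚ.≤-reflexive (≡.sym m≡)) m≤)))
      (≡.cong (ℕ._+ μ τ (replicate c t ++ w)) (≡.sym (ω-yes {suc (length u)} {c} (ℕₚ.≤-reflexive m≡ , a≤))))))
  ... | yes _  | no a≰ = ≡.trans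
    (μ-miss {run u t c w} {x} (λ h → a≰ (proj₂ (Match⇒ (suc m′) (x ∷ u) t c w (x< , asc) b h))))
    (≡.trans (μ-run u t c w asc b) (≡.cong (ℕ._+ μ τ (replicate c t ++ w))
      (≡.trans (ω-no {length u} {c} (a≰ ∘ proj₂)) (≡.sym (ω-no {suc (length u)} {c} (a≰ ∘ proj₂))))))
  ... | no m≢  | _ = ≡.trans
    (μ-miss {run u t c w} {x} (λ h → m≢ (proj₁ (Match⇒ (suc m′) (x ∷ u) t c w (x< , asc) b h))))
    (≡.trans (μ-run u t c w asc b) (≡.cong (ℕ._+ μ τ (replicate c t ++ w)) ω-suc))
    where
    ω-suc : ω (length u) c ≡ ω (suc (length u)) c
    ω-suc with suc m′ ≤? length u | suc a′ ≤? c
    ... | yes m≤ | yes a≤ = ≡.trans (ω-yes {length u} {c} (m≤ , a≤))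
      (≡.sym (ω-yes {suc (length u)} {c} (ℕₚ.m≤n⇒m≤1+n m≤ , a≤)))
    ... | no m≰ | _ = ≡.trans (ω-no {length u} {c} (m≰ ∘ proj₁))
      (≡.sym (ω-no {suc (length u)} {c} (λ (m≤ , _) → m≰ (ℕₚ.≤-pred (ℕₚ.≤∧≢⇒< m≤ m≢)))))
    ... | _ | no a≰ = ≡.trans (ω-no {length u} {c} (a≰ ∘ proj₂))
      (≡.sym (ω-no {suc (length u)} {c} (a≰ ∘ proj₂)))

  -- Since m ≥ 2, an occurrence begins with an ascent, so among equal neighbours only the last can
  -- start one.
  μ-copies : ∀ t c w → μ τ (replicate (suc c) t ++ w) ≡ μ τ (t ∷ w)
  μ-copies t zero    w = ≡.refl
  μ-copies t (suc c) w = ≡.trans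
    (μ-miss {t ∷ replicate c t ++ w} {t} (λ (t<t , _) → ℕₚ.<-irrefl ≡.refl t<t)) (μ-copies t c w)

  ω-zero : ∀ k → ω k 0 ≡ 0
  ω-zero k = ω-no {k} {0} (λ { (_ , ()) })

  μ-run-end : ∀ u t c → AscendsTo t u → μ τ (run u t c []) ≡ ω (length u) c
  μ-run-end u t c asc = ≡.trans (μ-run u t c [] asc tt)
    (≡.trans (≡.cong (ω (length u) c ℕ.+_) (copies c)) (ℕₚ.+-identityʳ _))
    where
    copies : ∀ c → μ τ (replicate c t ++ []) ≡ 0
    copies zero    = ≡.refl
    copies (suc c) = ≡.trans (μ-copies t c []) (μ-miss {[]} {t} (λ ()))

  μ-run-descent : ∀ u t c z w → AscendsTo t u → z < t →
                  μ τ (run u t c (z ∷ w)) ≡ ω (length u) c ℕ.+ μ τ (z ∷ w)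
  μ-run-descent u t c z w asc z<t = ≡.trans (μ-run u t c (z ∷ w) asc (breaks c))
    (≡.cong (ω (length u) c ℕ.+_) (copies c))
    where
    breaks : ∀ c → Breaks t c (z ∷ w)
    breaks zero    = z<t
    breaks (suc c) = ℕₚ.<⇒≢ z<t

    copies : ∀ c → μ τ (replicate c t ++ z ∷ w) ≡ μ τ (z ∷ w)
    copies zero    = ≡.refl
    copies (suc c) = ≡.trans (μ-copies t c (z ∷ w))
      (μ-miss {z ∷ w} {t} (λ (t<z , _) → ℕₚ.<-asym z<t t<z))

  -- After a repetition an ascent closes the run, but the last copy of `t` opens the next one and
  -- therefore stays in front of `z`. After a single copy the ascent would prolong the run instead.
  μ-run-ascent : ∀ u t c z w → AscendsTo t u → t < z →
                 μ τ (run u t (suc c) (z ∷ w)) ≡ ω (length u) (suc c) ℕ.+ μ τ (t ∷ z ∷ w)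
  μ-run-ascent u t c z w asc t<z = ≡.trans
    (μ-run u t (suc c) (z ∷ w) asc (λ z≡t → ℕₚ.<⇒≢ t<z (≡.sym z≡t)))
    (≡.cong (ω (length u) (suc c) ℕ.+_) (μ-copies t c (z ∷ w)))

-- Canonical forms as restricted growth words

RestrictedGrowth : ℕ → Word → Set
RestrictedGrowth M []      = ⊤
RestrictedGrowth M (z ∷ w) = 1 ≤ z × z ≤ suc M × RestrictedGrowth (M ⊔ z) w

private
  -- Canonicity relative to a prefix with largest letter `M`: the last two conditions only concern
  -- letters above `M`. Writing `Any (j ≤_) w` for a bound by the maximum lets them pass to the
  -- tail.
  record CanonicalAbove (M : ℕ) (w : Word) : Set where
    constructor canonicalAbove
    field
      positive : All (1 ≤_) w
      occurs   : ∀ {j} → M < j → Any (j ≤_) w → j ∈ w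
      ordered  : ∀ {i j} → M < i → i < j → Any (j ≤_) w → firstPos i w < firstPos j w

  firstPos-here : ∀ z w → firstPos z (z ∷ w) ≡ 0
  firstPos-here z w =
    ≡.cong (λ b → if b then 0 else suc (firstPos z w)) (dec-true (z ℕ.≟ z) ≡.refl)

  firstPos-there : ∀ {j z} w → j ≢ z → firstPos j (z ∷ w) ≡ suc (firstPos j w)
  firstPos-there {j} {z} w j≢z =
    ≡.cong (λ b → if b then 0 else suc (firstPos j w)) (dec-false (j ℕ.≟ z) j≢z)

  ∈-tail : ∀ {j z} {w : Word} → j ≢ z → j ∈ z ∷ w → j ∈ w
  ∈-tail j≢z (here j≡z)  = contradiction j≡z j≢z
  ∈-tail j≢z (there j∈w) = j∈w

  ≤-tail : ∀ {j z w} → z < j → Any (j ≤_) (z ∷ w) → Any (j ≤_) w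
  ≤-tail z<j (here j≤z) = contradiction j≤z (ℕₚ.<⇒≱ z<j)
  ≤-tail z<j (there j≤) = j≤

  CanonicalAbove⇒RestrictedGrowth : ∀ M w → CanonicalAbove M w → RestrictedGrowth M w
  CanonicalAbove⇒RestrictedGrowth M [] _ = tt
  CanonicalAbove⇒RestrictedGrowth M (z ∷ w) (canonicalAbove (1≤z ∷ pos) occ ord) =
    1≤z , z≤1+M ,
    CanonicalAbove⇒RestrictedGrowth (M ⊔ z) w (canonicalAbove pos
      (λ M⊔z<j j≤ → ∈-tail (z≢ M⊔z<j) (occ (ℕₚ.m⊔n<o⇒m<o M z M⊔z<j) (there j≤)))
      (λ {i} {j} M⊔z<i i<j j≤ → ℕₚ.≤-pred (≡.subst₂ _<_
        (firstPos-there w (z≢ M⊔z<i)) (firstPos-there w (z≢ (ℕₚ.<-trans M⊔z<i i<j)))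
        (ord (ℕₚ.m⊔n<o⇒m<o M z M⊔z<i) i<j (there j≤)))))
    where
    z≢ : ∀ {j} → M ⊔ z < j → j ≢ z
    z≢ M⊔z<j = ℕₚ.<⇒≢ (ℕₚ.m⊔n<o⇒n<o M z M⊔z<j) ∘ ≡.sym

    z≤1+M : z ≤ suc M
    z≤1+M with z ≤? suc M
    ... | yes z≤ = z≤
    -- Otherwise `suc M` would have to occur before `z`, which stands at position 0.
    ... | no z≰  = contradiction
      (≡.subst (firstPos (suc M) (z ∷ w) <_) (firstPos-here z w)
        (ord {suc M} ℕₚ.≤-refl (ℕₚ.≰⇒> z≰) (here ℕₚ.≤-refl))) λ ()

  RestrictedGrowth⇒CanonicalAbove : ∀ M w → RestrictedGrowth M w → CanonicalAbove M w
  RestrictedGrowth⇒CanonicalAbove M [] _ = canonicalAbove [] (λ _ ()) (λ _ _ ())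
  RestrictedGrowth⇒CanonicalAbove M (z ∷ w) (1≤z , z≤1+M , rg)
    with RestrictedGrowth⇒CanonicalAbove (M ⊔ z) w rg
  ... | canonicalAbove pos occ ord = canonicalAbove (1≤z ∷ pos) occ′ ord′
    where
    beyond : ∀ {j} → M < j → j ≢ z → z < j
    beyond M<j j≢z = ℕₚ.≤∧≢⇒< (ℕₚ.≤-trans z≤1+M M<j) (j≢z ∘ ≡.sym)

    occ′ : ∀ {j} → M < j → Any (j ≤_) (z ∷ w) → j ∈ z ∷ w
    occ′ {j} M<j j≤ with j ℕ.≟ z
    ... | yes j≡z = here j≡z
    ... | no j≢z  = there (occ (ℕₚ.⊔-lub M<j z<j) (≤-tail z<j j≤))
      where z<j = beyond M<j j≢z

    ord′ : ∀ {i j} → M < i → i < j → Any (j ≤_) (z ∷ w) → firstPos i (z ∷ w) < firstPos j (z ∷ w)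
    ord′ {i} {j} M<i i<j j≤ with i ℕ.≟ z
    ... | yes ≡.refl = ≡.subst₂ _<_ (≡.sym (firstPos-here i w))
      (≡.sym (firstPos-there w (ℕₚ.<⇒≢ i<j ∘ ≡.sym))) (s≤s z≤n)
    ... | no i≢z = ≡.subst₂ _<_ (≡.sym (firstPos-there w i≢z))
      (≡.sym (firstPos-there w (ℕₚ.<⇒≢ (ℕₚ.<-trans z<i i<j) ∘ ≡.sym)))
      (s≤s (ord (ℕₚ.⊔-lub M<i z<i) i<j (≤-tail (ℕₚ.<-trans z<i i<j) j≤)))
      where z<i = beyond M<i i≢z

  AllPairs-applyUpTo⁻ : ∀ {R : ℕ → ℕ → Set} f n → AllPairs R (applyUpTo f n) →
                        ∀ {i j} → i < j → j < n → R (f i) (f j)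
  AllPairs-applyUpTo⁻ f (suc n) (r ∷ _) {zero} {suc j} _ (s≤s j<n) =
    Allₚ.applyUpTo⁻ (f ∘ suc) n r j<n
  AllPairs-applyUpTo⁻ f (suc n) (_ ∷ rs) {suc i} {suc j} (s≤s i<j) (s≤s j<n) =
    AllPairs-applyUpTo⁻ (f ∘ suc) n rs i<j j<n

  ≤max⇒Any : ∀ {j} π → suc j ≤ max 0 π → Any (suc j ≤_) π
  ≤max⇒Any π j<max with argmax-sel id 0 π
  ... | inj₁ ≡0 = contradiction (≡.subst (_ <_) ≡0 j<max) λ ()
  ... | inj₂ ∈π = Any.map (λ { ≡.refl → j<max }) ∈π

  Any⇒≤max : ∀ {j} π → Any (j ≤_) π → j ≤ max 0 π
  Any⇒≤max π = v≤max⁺ 0 π ∘ inj₂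

Canonical⇔RestrictedGrowth : ∀ π → Canonical π ⇔ RestrictedGrowth 0 π
Canonical⇔RestrictedGrowth π = mk⇔
  (λ (pos , occ , ord) → CanonicalAbove⇒RestrictedGrowth 0 π (canonicalAbove pos
    (λ { {suc j} _ j≤ → Allₚ.applyUpTo⁻ suc (max 0 π) occ (Any⇒≤max π j≤) })
    (λ { {suc i} {suc j} _ (s≤s i<j) j≤ →
         AllPairs-applyUpTo⁻ suc (max 0 π) ord i<j (Any⇒≤max π j≤) })))
  (λ rg → let open CanonicalAbove (RestrictedGrowth⇒CanonicalAbove 0 π rg) in
    positive ,
    Allₚ.applyUpTo⁺₁ suc (max 0 π) (λ j<max → occurs (s≤s z≤n) (≤max⇒Any π j<max)) ,
    AllPairsₚ.applyUpTo⁺₁ suc (max 0 π)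
      (λ i<j j<max → ordered (s≤s z≤n) (s≤s i<j) (≤max⇒Any π j<max)))

-- Non-crossing continuations and the stack of live letters

-- Strictly decreasing lists of positive letters at most `b`. A top letter `suc x` is positive by
-- its form and leaves `x` as the bound for the rest.
data Stack : ℕ → List ℕ → Set where
  []  : ∀ {b} → Stack b []
  _∷_ : ∀ {b x s} → x < b → Stack x s → Stack b (suc x ∷ s)

data Suffix (s : List ℕ) : List ℕ → Set where
  whole : Suffix s s
  drop : ∀ {x t} → Suffix s (x ∷ t) → Suffix s t

Stack-weaken : ∀ {b b′ s} → b ≤ b′ → Stack b s → Stack b′ s
Stack-weaken b≤b′ []          = []
Stack-weaken b≤b′ (x<b ∷ stk) = ℕₚ.≤-trans x<b b≤b′ ∷ stk

Stack-∈ : ∀ {b s x} → Stack b s → x ∈ s → 1 ≤ x × x ≤ b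
Stack-∈ (x<b ∷ stk) (here ≡.refl) = s≤s z≤n , x<b
Stack-∈ (y<b ∷ stk) (there x∈s)   =
  proj₁ (Stack-∈ stk x∈s) , ℕₚ.≤-trans (proj₂ (Stack-∈ stk x∈s)) (ℕₚ.<⇒≤ y<b)

Suffix-∈ : ∀ {s t x} → Suffix s t → x ∈ t → x ∈ s
Suffix-∈ whole      x∈t = x∈t
Suffix-∈ (drop suf) x∈t = Suffix-∈ suf (there x∈t)

Stack-suffix : ∀ {b s t} → Stack b s → Suffix s t → Stack b t
Stack-suffix stk whole = stk
Stack-suffix stk (drop suf) with Stack-suffix stk suf
... | x<b ∷ stk′ = Stack-weaken (ℕₚ.<⇒≤ x<b) stk′

-- All that was popped to uncover `z` is larger than `z`, the stack being decreasing.
Suffix-∈-≤ : ∀ {b s z t x} → Stack b s → Suffix s (z ∷ t) → x ∈ s → x ≤ z → x ∈ z ∷ t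
Suffix-∈-≤ stk whole x∈s x≤z = x∈s
Suffix-∈-≤ {z = z} stk (drop suf) x∈s x≤z with Stack-suffix stk suf
... | y<b ∷ (z<y ∷ stk′) with Suffix-∈-≤ stk suf x∈s (ℕₚ.≤-trans x≤z (ℕₚ.≤-trans z<y (ℕₚ.n≤1+n _)))
... | here ≡.refl = contradiction (ℕₚ.≤-trans x≤z z<y) (ℕₚ.<-irrefl ≡.refl)
... | there x∈    = x∈

head-≤ : ∀ {b z t x} → Stack b (z ∷ t) → x ∈ z ∷ t → x ≤ z
head-≤ (_ ∷ stk) (here ≡.refl) = ℕₚ.≤-refl
head-≤ (_ ∷ stk) (there x∈t)   = ℕₚ.<⇒≤ (s≤s (proj₂ (Stack-∈ stk x∈t)))

-- w continues a non-crossing canonical form with largest letter M, the letters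
-- that may still be used without a crossing being those on the stack s.
record Continues (s : List ℕ) (M : ℕ) (w : Word) : Set where
  constructor continues
  field
    growth      : RestrictedGrowth M w
    live        : ∀ {x} → x ∈ w → x ≤ M → x ∈ s
    no-xy       : ∀ {x y} → x < y → x ∈ s → y ∈ s → ¬ (x ∷ y ∷ [] ⊆ w)
    no-yxy      : ∀ {x y} → x < y → x ∈ s → ¬ (y ∷ x ∷ y ∷ [] ⊆ w)
    nonCrossing : NonCrossing w

Canonical×NonCrossing⇔Continues : ∀ π → (Canonical π × NonCrossing π) ⇔ Continues [] 0 π
Canonical×NonCrossing⇔Continues π = mk⇔
  (λ (can , nc) → continues (Equivalence.to (Canonical⇔RestrictedGrowth π) can)
    (λ x∈π x≤0 → contradiction (All.lookup (proj₁ can) x∈π) (ℕₚ.≤⇒≯ x≤0))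
    (λ _ ()) (λ _ ()) nc)
  (λ (continues rg _ _ _ nc) → Equivalence.from (Canonical⇔RestrictedGrowth π) rg , nc)

Continues-options : ∀ {s M z w} → Continues s M (z ∷ w) → z ∈ suc M ∷ s
Continues-options {M = M} {z} (continues (_ , z≤1+M , _) live _ _ _) with z ≤? M
... | yes z≤M = there (live (here ≡.refl) z≤M)
... | no z≰M  = here (ℕₚ.≤-antisym z≤1+M (ℕₚ.≰⇒> z≰M))

-- The fields of `Continues` are the ways to cut a crossing x y x y, x < y, between prefix and
-- continuation: `nonCrossing` for an empty first part, `no-yxy` for x | yxy, `no-xy` for xy | xy
-- and `live` for xyx | y. Moving `suc M` into the prefix moves the cut by one letter, which turns
-- one field into another.
Continues-new : ∀ {s M} w → Stack M s → Continues s M (suc M ∷ w) ⇔ Continues (suc M ∷ s) (suc M) w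
Continues-new {s} {M} w stk = mk⇔ to from
  where
  ≤M : ∀ {x} → x ∈ s → x ≤ M
  ≤M = proj₂ ∘ Stack-∈ stk

  M⊔1+M : M ⊔ suc M ≡ suc M
  M⊔1+M = ℕₚ.m≤n⇒m⊔n≡n (ℕₚ.n≤1+n M)

  to : Continues s M (suc M ∷ w) → Continues (suc M ∷ s) (suc M) w
  to (continues (_ , _ , rg) live no-xy no-yxy nc) = continues
    (≡.subst (λ k → RestrictedGrowth k w) M⊔1+M rg) live′ no-xy′ no-yxy′
    (λ x y x<y → nc x y x<y ∘ (suc M ∷ʳ_))
    where
    live′ : ∀ {x} → x ∈ w → x ≤ suc M → x ∈ suc M ∷ s
    live′ {x} x∈w x≤ with x ℕ.≟ suc M
    ... | yes x≡ = here x≡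
    ... | no x≢  = there (live (there x∈w) (ℕₚ.≤-pred (ℕₚ.≤∧≢⇒< x≤ x≢)))

    no-xy′ : ∀ {x y} → x < y → x ∈ suc M ∷ s → y ∈ suc M ∷ s → ¬ (x ∷ y ∷ [] ⊆ w)
    no-xy′ x<y (here ≡.refl) (here ≡.refl) _ = ℕₚ.<-irrefl ≡.refl x<y
    no-xy′ x<y (here ≡.refl) (there y∈s)   _ = ℕₚ.<-asym x<y (s≤s (≤M y∈s))
    no-xy′ x<y (there x∈s)   (here ≡.refl) σ = no-yxy x<y x∈s (≡.refl ∷ σ)
    no-xy′ x<y (there x∈s)   (there y∈s)   σ = no-xy x<y x∈s y∈s (_ ∷ʳ σ)

    no-yxy′ : ∀ {x y} → x < y → x ∈ suc M ∷ s → ¬ (y ∷ x ∷ y ∷ [] ⊆ w)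
    no-yxy′ x<y (here ≡.refl) σ = nc _ _ x<y (≡.refl ∷ σ)
    no-yxy′ x<y (there x∈s)   σ = no-yxy x<y x∈s (_ ∷ʳ σ)

  from : Continues (suc M ∷ s) (suc M) w → Continues s M (suc M ∷ w)
  from (continues rg live no-xy no-yxy nc) = continues
    (s≤s z≤n , ℕₚ.≤-refl , ≡.subst (λ k → RestrictedGrowth k w) (≡.sym M⊔1+M) rg)
    live′ no-xy′ no-yxy′ nc′
    where
    live′ : ∀ {x} → x ∈ suc M ∷ w → x ≤ M → x ∈ s
    live′ (here ≡.refl) x≤M = contradiction x≤M ℕₚ.1+n≰n
    live′ (there x∈w)   x≤M with live x∈w (ℕₚ.m≤n⇒m≤1+n x≤M)
    ... | here ≡.refl = contradiction x≤M ℕₚ.1+n≰n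
    ... | there x∈s   = x∈s

    no-xy′ : ∀ {x y} → x < y → x ∈ s → y ∈ s → ¬ (x ∷ y ∷ [] ⊆ suc M ∷ w)
    no-xy′ x<y x∈s y∈s (_ ∷ʳ σ)     = no-xy x<y (there x∈s) (there y∈s) σ
    no-xy′ x<y x∈s y∈s (≡.refl ∷ σ) = ℕₚ.1+n≰n (≤M x∈s)

    no-yxy′ : ∀ {x y} → x < y → x ∈ s → ¬ (y ∷ x ∷ y ∷ [] ⊆ suc M ∷ w)
    no-yxy′ x<y x∈s (_ ∷ʳ σ)     = no-yxy x<y (there x∈s) σ
    no-yxy′ x<y x∈s (≡.refl ∷ σ) = no-xy x<y (there x∈s) (here ≡.refl) σ

    nc′ : NonCrossing (suc M ∷ w)
    nc′ x y x<y (_ ∷ʳ σ)     = nc x y x<y σ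
    nc′ x y x<y (≡.refl ∷ σ) = no-yxy x<y (here ≡.refl) σ

-- Reusing `z` kills exactly the letters above it on the stack. In the converse direction `live`
-- places the letters of `w` taken from `s` on the stack that remains, so that its conditions apply
-- to them.
Continues-old : ∀ {s M z t} w → Stack M s → Suffix s (z ∷ t) →
                Continues s M (z ∷ w) ⇔ Continues (z ∷ t) M w
Continues-old {s} {M} {z} {t} w stk suf = mk⇔ to from
  where
  z∈s : z ∈ s
  z∈s = Suffix-∈ suf (here ≡.refl)

  z≤M : z ≤ M
  z≤M = proj₂ (Stack-∈ stk z∈s)

  ≤M : ∀ {x} → x ∈ s → x ≤ M
  ≤M = proj₂ ∘ Stack-∈ stk

  ≤z : ∀ {x} → x ∈ z ∷ t → x ≤ z
  ≤z = head-≤ (Stack-suffix stk suf)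

  to : Continues s M (z ∷ w) → Continues (z ∷ t) M w
  to (continues (_ , _ , rg) live no-xy no-yxy nc) = continues
    (≡.subst (λ k → RestrictedGrowth k w) (ℕₚ.m≥n⇒m⊔n≡m z≤M) rg) live′
    (λ x<y x∈ y∈ σ → no-xy x<y (Suffix-∈ suf x∈) (Suffix-∈ suf y∈) (_ ∷ʳ σ))
    (λ x<y x∈ σ → no-yxy x<y (Suffix-∈ suf x∈) (_ ∷ʳ σ))
    (λ x y x<y σ → nc x y x<y (_ ∷ʳ σ))
    where
    live′ : ∀ {x} → x ∈ w → x ≤ M → x ∈ z ∷ t
    live′ {x} x∈w x≤M with x ≤? z
    ... | yes x≤z = Suffix-∈-≤ stk suf (live (there x∈w) x≤M) x≤z
    -- A live letter `x` above `z` would come after `z` and form the forbidden pair.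
    ... | no x≰z  = contradiction (≡.refl ∷ Sublist.from∈ x∈w)
                      (no-xy (ℕₚ.≰⇒> x≰z) z∈s (live (there x∈w) x≤M))

  from : Continues (z ∷ t) M w → Continues s M (z ∷ w)
  from (continues rg live no-xy no-yxy nc) = continues
    (proj₁ (Stack-∈ stk z∈s) , ℕₚ.m≤n⇒m≤1+n z≤M ,
      ≡.subst (λ k → RestrictedGrowth k w) (≡.sym (ℕₚ.m≥n⇒m⊔n≡m z≤M)) rg)
    live′ no-xy′ no-yxy′ nc′
    where
    live′ : ∀ {x} → x ∈ z ∷ w → x ≤ M → x ∈ s
    live′ (here ≡.refl) x≤M = z∈s
    live′ (there x∈w)   x≤M = Suffix-∈ suf (live x∈w x≤M)

    kept : ∀ {x v} → x ∈ v → v ⊆ w → x ∈ s → x ∈ z ∷ t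
    kept x∈v v⊆w x∈s = live (Sublist.lookup v⊆w x∈v) (≤M x∈s)

    no-xy′ : ∀ {x y} → x < y → x ∈ s → y ∈ s → ¬ (x ∷ y ∷ [] ⊆ z ∷ w)
    no-xy′ x<y x∈s y∈s (_ ∷ʳ σ) =
      no-xy x<y (kept (here ≡.refl) σ x∈s) (kept (there (here ≡.refl)) σ y∈s) σ
    no-xy′ x<y x∈s y∈s (≡.refl ∷ σ) = ℕₚ.<⇒≱ x<y (≤z (kept (here ≡.refl) σ y∈s))

    no-yxy′ : ∀ {x y} → x < y → x ∈ s → ¬ (y ∷ x ∷ y ∷ [] ⊆ z ∷ w)
    no-yxy′ x<y x∈s (_ ∷ʳ σ)     = no-yxy x<y (kept (there (here ≡.refl)) σ x∈s) σ
    no-yxy′ x<y x∈s (≡.refl ∷ σ) = no-xy x<y (kept (here ≡.refl) σ x∈s) (here ≡.refl) σ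

    nc′ : NonCrossing (z ∷ w)
    nc′ x y x<y (_ ∷ʳ σ)     = nc x y x<y σ
    nc′ x y x<y (≡.refl ∷ σ) = no-yxy x<y (here ≡.refl) σ

Continues-[] : ∀ s M → Continues s M []
Continues-[] s M = continues tt (λ ()) (λ _ _ _ ()) (λ _ _ ()) (λ _ _ _ ())

Stack-positive : ∀ {b s} → Stack b s → All (1 ≤_) s
Stack-positive []          = []
Stack-positive (_ ∷ stk) = s≤s z≤n ∷ Stack-positive stk

-- Sums over non-crossing partitions, letter by letter

module WordSums {c ℓ} (R : CommutativeRing c ℓ) where
  open CommutativeRing R
  open FiniteSums R
  open RingNotation rawRing using (sumOver)
  open import Algebra.Properties.CommutativeSemigroup +-commutativeSemigroup
    using (interchange)

  sumOver-cong : ∀ {b} {B : Set b} (xs : List B) {f g : B → Carrier} → (∀ x → f x ≈ g x) →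
                 sumOver xs f ≈ sumOver xs g
  sumOver-cong []       f≈g = refl
  sumOver-cong (x ∷ xs) f≈g = +-cong (f≈g x) (sumOver-cong xs f≈g)

  sumOver-+ : ∀ {b} {B : Set b} (xs : List B) (f g : B → Carrier) →
              sumOver xs (λ x → f x + g x) ≈ sumOver xs f + sumOver xs g
  sumOver-+ []       f g = sym (+-identityˡ 0#)
  sumOver-+ (x ∷ xs) f g = trans (+-congˡ (sumOver-+ xs f g)) (interchange _ _ _ _)

  sumOver-*ˡ : ∀ {b} {B : Set b} (xs : List B) k (f : B → Carrier) →
               sumOver xs (λ x → k * f x) ≈ k * sumOver xs f
  sumOver-*ˡ []       k f = sym (zeroʳ k)
  sumOver-*ˡ (x ∷ xs) k f = trans (+-congˡ (sumOver-*ˡ xs k f)) (sym (distribˡ _ _ _))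

  sumOver-filter : ∀ {b p} {B : Set b} {P : B → Set p} (P? : Decidable P) (xs : List B) f →
    sumOver (filter P? xs) f ≈ sumOver xs (λ x → if does (P? x) then f x else 0#)
  sumOver-filter P? []       f = refl
  sumOver-filter P? (x ∷ xs) f with does (P? x)
  ... | true  = +-congˡ (sumOver-filter P? xs f)
  ... | false = trans (sumOver-filter P? xs f) (sym (+-identityˡ _))

  private
    sumOver-++ : ∀ {b} {B : Set b} (xs ys : List B) f →
                 sumOver (xs ++ ys) f ≈ sumOver xs f + sumOver ys f
    sumOver-++ []       ys f = sym (+-identityˡ _)
    sumOver-++ (x ∷ xs) ys f = trans (+-congˡ (sumOver-++ xs ys f)) (sym (+-assoc _ _ _))

    sumOver-applyUpTo : ∀ (h : ℕ → ℕ) n f → sumOver (applyUpTo h n) f ≡ ∑ n (f ∘ h)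
    sumOver-applyUpTo h zero    f = ≡.refl
    sumOver-applyUpTo h (suc n) f = ≡.cong (λ s → _ + s) (sumOver-applyUpTo (h ∘ suc) n f)

    module _ {P : Word → Set} (P? : Decidable P) where

      prefixed : List Word → (Word → Carrier) → ℕ → Carrier
      prefixed ws f z = sumOver (filter (P? ∘ (z ∷_)) ws) (f ∘ (z ∷_))

      sumOver-map-∷ : ∀ z ws f → sumOver (filter P? (map (z ∷_) ws)) f ≡ prefixed ws f z
      sumOver-map-∷ z []       f = ≡.refl
      sumOver-map-∷ z (w ∷ ws) f with does (P? (z ∷ w))
      ... | true  = ≡.cong (λ s → _ + s) (sumOver-map-∷ z ws f)
      ... | false = sumOver-map-∷ z ws f

      sumOver-cartesian : ∀ zs ws f →
        sumOver (filter P? (cartesianProductWith _∷_ zs ws)) f ≈ sumOver zs (prefixed ws f)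
      sumOver-cartesian []       ws f = refl
      sumOver-cartesian (z ∷ zs) ws f = trans
        (reflexive (≡.cong (λ l → sumOver l f)
          (Listₚ.filter-++ P? (map (z ∷_) ws) (cartesianProductWith _∷_ zs ws))))
        (trans (sumOver-++ (filter P? (map (z ∷_) ws)) _ f)
          (+-cong (reflexive (sumOver-map-∷ z ws f)) (sumOver-cartesian zs ws f)))

    -- The alphabet increases and the stack decreases, so the largest letter of the alphabet is
    -- compared with the top of the stack: either they agree or that letter contributes 0.
    ∑-stack : ∀ k {s} (f : ℕ → Carrier) → Stack k s →
              (∀ z → z < k → suc z ∉ s → f (suc z) ≈ 0#) → ∑ k (f ∘ suc) ≈ sumOver s f
    ∑-stack zero    f []  off = refl
    ∑-stack (suc k) f []  off = ∑-zero (suc k) (f ∘ suc) (λ z z<k → off z z<k λ ())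
    ∑-stack (suc k) f (_∷_ {x = x} {s} x≤k stk) off with x ℕ.≟ k
    ... | yes ≡.refl = trans (∑-last k (f ∘ suc)) (trans (+-comm _ _) (+-congˡ
      (∑-stack k f stk (λ z z<k z∉s → off z (ℕₚ.m≤n⇒m≤1+n z<k) λ
        { (here ≡.refl) → ℕₚ.<-irrefl ≡.refl z<k ; (there z∈s) → z∉s z∈s }))))
    ... | no x≢k = trans (∑-last k (f ∘ suc)) (trans (+-congˡ (off k ℕₚ.≤-refl k∉))
      (trans (+-identityʳ _) (∑-stack k f stk′ (λ z z<k → off z (ℕₚ.m≤n⇒m≤1+n z<k)))))
      where
      stk′ : Stack k (suc x ∷ s)
      stk′ = ℕₚ.≤∧≢⇒< (ℕₚ.≤-pred x≤k) x≢k ∷ stk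
      k∉ : suc k ∉ suc x ∷ s
      k∉ k∈ = ℕₚ.1+n≰n (proj₂ (Stack-∈ stk′ k∈))

  -- The sum over all w of length n with Continues s M w.
  sumContinuations : List ℕ → ℕ → ℕ → (Word → Carrier) → Carrier
  sumPops          : List ℕ → ℕ → ℕ → (Word → Carrier) → Carrier

  sumContinuations s M zero    f = f []
  sumContinuations s M (suc n) f =
    sumContinuations (suc M ∷ s) (suc M) n (f ∘ (suc M ∷_)) + sumPops s M n f

  sumPops []      M n f = 0#
  sumPops (z ∷ s) M n f = sumContinuations (z ∷ s) M n (f ∘ (z ∷_)) + sumPops s M n f

  private
    module _ {b p} {B : Set b} {P : B → Set p} (P? : Decidable P) where
      sumOver-none : ∀ xs f → (∀ x → ¬ P x) → sumOver (filter P? xs) f ≡ 0#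
      sumOver-none xs f ¬P =
        ≡.cong (λ l → sumOver l f) (Listₚ.filter-none P? (All.universal ¬P xs))

    -- `P` is left open because fixing the first letter z replaces it by P ∘ (z ∷_). The alphabet
    -- size `k` is fixed once for the whole word, hence the slack `M + n ≤ k`: each of the n letters
    -- to come may open a block.
    sum-words : ∀ n {s M k} {P : Word → Set} (P? : Decidable P) f → Stack M s →
                (∀ w → P w ⇔ Continues s M w) → M ℕ.+ n ≤ k →
                sumOver (filter P? (words k n)) f ≈ sumContinuations s M n f
    sum-words zero {s} {M} P? f stk P⇔ M≤k = trans
      (reflexive (≡.cong (λ l → sumOver l f)
        (Listₚ.filter-accept P? {xs = []} (Equivalence.from (P⇔ []) (Continues-[] s M)))))
      (+-identityʳ _)
    sum-words (suc n) {s} {M} {k} {P} P? f stk P⇔ M+1+n≤k =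
      trans (sumOver-cartesian P? (ascending k) (words k n) f)
      (trans (reflexive (sumOver-applyUpTo suc k first))
      (trans (∑-stack k first (M<k ∷ stk) off)
      (+-cong
        (sum-words n (P? ∘ (suc M ∷_)) (f ∘ (suc M ∷_)) (ℕₚ.≤-refl ∷ stk)
          (λ w → ⇔.trans (P⇔ (suc M ∷ w)) (Continues-new w stk)) 1+M+n≤k)
        (pops s whole))))
      where
      first : ℕ → Carrier
      first = prefixed P? (words k n) f

      1+M+n≤k : suc (M ℕ.+ n) ≤ k
      1+M+n≤k = ≡.subst (_≤ k) (ℕₚ.+-suc M n) M+1+n≤k

      M<k : M < k
      M<k = ℕₚ.≤-trans (s≤s (ℕₚ.m≤m+n M n)) 1+M+n≤k

      off : ∀ z → z < k → suc z ∉ suc M ∷ s → first (suc z) ≈ 0#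
      off z _ z∉ = reflexive (sumOver-none (P? ∘ (suc z ∷_)) (words k n) (f ∘ (suc z ∷_))
        (λ w Pzw → z∉ (Continues-options (Equivalence.to (P⇔ (suc z ∷ w)) Pzw))))

      pops : ∀ t → Suffix s t → sumOver t first ≈ sumPops t M n f
      pops []      suf = refl
      pops (z ∷ t) suf = +-cong
        (sum-words n (P? ∘ (z ∷_)) (f ∘ (z ∷_)) (Stack-suffix stk suf)
          (λ w → ⇔.trans (P⇔ (z ∷ w)) (Continues-old w stk suf))
          (ℕₚ.≤-trans (ℕₚ.n≤1+n _) 1+M+n≤k))
        (pops t (drop suf))

  sum-NC : ∀ n f → sumOver (NC n) f ≈ sumContinuations [] 0 n f
  sum-NC n f = sum-words n (λ π → canonical? π ×-dec nonCrossing? π) f []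
    Canonical×NonCrossing⇔Continues ℕₚ.≤-refl

  -- Continuations only use positive letters.
  sumContinuations-cong : ∀ n {s M} {f g : Word → Carrier} → All (1 ≤_) s →
    (∀ w → All (1 ≤_) w → f w ≈ g w) → sumContinuations s M n f ≈ sumContinuations s M n g
  sumPops-cong : ∀ n {s M} {f g : Word → Carrier} → All (1 ≤_) s →
    (∀ w → All (1 ≤_) w → f w ≈ g w) → sumPops s M n f ≈ sumPops s M n g

  sumContinuations-cong zero    1≤s f≈g = f≈g [] []
  sumContinuations-cong (suc n) 1≤s f≈g = +-cong
    (sumContinuations-cong n (s≤s z≤n ∷ 1≤s) (λ w 1≤w → f≈g _ (s≤s z≤n ∷ 1≤w)))
    (sumPops-cong n 1≤s f≈g)

  sumPops-cong n []          f≈g = refl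
  sumPops-cong n (1≤z ∷ 1≤s) f≈g = +-cong
    (sumContinuations-cong n (1≤z ∷ 1≤s) (λ w 1≤w → f≈g _ (1≤z ∷ 1≤w)))
    (sumPops-cong n 1≤s f≈g)

  sumContinuations-+ : ∀ n s M (f g : Word → Carrier) →
    sumContinuations s M n (λ w → f w + g w) ≈ sumContinuations s M n f + sumContinuations s M n g
  sumPops-+ : ∀ n s M (f g : Word → Carrier) →
    sumPops s M n (λ w → f w + g w) ≈ sumPops s M n f + sumPops s M n g

  sumContinuations-+ zero    s M f g = refl
  sumContinuations-+ (suc n) s M f g = trans
    (+-cong (sumContinuations-+ n (suc M ∷ s) (suc M) _ _) (sumPops-+ n s M f g))
    (interchange _ _ _ _)

  sumPops-+ n []      M f g = sym (+-identityˡ _)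
  sumPops-+ n (z ∷ s) M f g = trans
    (+-cong (sumContinuations-+ n (z ∷ s) M _ _) (sumPops-+ n s M f g)) (interchange _ _ _ _)

  sumContinuations-*ˡ : ∀ n s M k (f : Word → Carrier) →
    sumContinuations s M n (λ w → k * f w) ≈ k * sumContinuations s M n f
  sumPops-*ˡ : ∀ n s M k (f : Word → Carrier) →
    sumPops s M n (λ w → k * f w) ≈ k * sumPops s M n f

  sumContinuations-*ˡ zero    s M k f = refl
  sumContinuations-*ˡ (suc n) s M k f = trans
    (+-cong (sumContinuations-*ˡ n (suc M ∷ s) (suc M) k _) (sumPops-*ˡ n s M k f))
    (sym (distribˡ _ _ _))

  sumPops-*ˡ n []      M k f = sym (zeroʳ k)
  sumPops-*ˡ n (z ∷ s) M k f = trans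
    (+-cong (sumContinuations-*ˡ n (z ∷ s) M k _) (sumPops-*ˡ n s M k f)) (sym (distribˡ _ _ _))

  sumContinuations-zero : ∀ n s M {f : Word → Carrier} → (∀ w → f w ≈ 0#) →
    sumContinuations s M n f ≈ 0#
  sumPops-zero : ∀ n s M {f : Word → Carrier} → (∀ w → f w ≈ 0#) → sumPops s M n f ≈ 0#

  sumContinuations-zero zero    s M f≈0 = f≈0 []
  sumContinuations-zero (suc n) s M f≈0 = trans
    (+-cong (sumContinuations-zero n (suc M ∷ s) (suc M) (λ w → f≈0 _)) (sumPops-zero n s M f≈0))
    (+-identityˡ 0#)

  sumPops-zero n []      M f≈0 = refl
  sumPops-zero n (z ∷ s) M f≈0 = trans
    (+-cong (sumContinuations-zero n (z ∷ s) M (λ w → f≈0 _)) (sumPops-zero n s M f≈0))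
    (+-identityˡ 0#)

  -- When words containing 1 contribute nothing, the 1 at the bottom of the stack is inert, and
  -- above it the recursion is that of the letters lowered by one.
  sumContinuations-avoiding-1 : ∀ n s M {f : Word → Carrier} → (∀ w → 1 ∈ w → f w ≈ 0#) →
    sumContinuations (map suc s ++ 1 ∷ []) (suc M) n f ≈ sumContinuations s M n (f ∘ map suc)
  sumPops-avoiding-1 : ∀ n s M {f : Word → Carrier} → (∀ w → 1 ∈ w → f w ≈ 0#) →
    sumPops (map suc s ++ 1 ∷ []) (suc M) n f ≈ sumPops s M n (f ∘ map suc)

  sumContinuations-avoiding-1 zero    s M f≈0 = refl
  sumContinuations-avoiding-1 (suc n) s M f≈0 = +-cong
    (sumContinuations-avoiding-1 n (suc M ∷ s) (suc M) (λ w 1∈w → f≈0 _ (there 1∈w)))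
    (sumPops-avoiding-1 n s M f≈0)

  sumPops-avoiding-1 n []      M f≈0 = trans (+-identityʳ _)
    (sumContinuations-zero n (1 ∷ []) (suc M) (λ w → f≈0 _ (here ≡.refl)))
  sumPops-avoiding-1 n (z ∷ s) M f≈0 = +-cong
    (sumContinuations-avoiding-1 n (z ∷ s) M (λ w 1∈w → f≈0 _ (there 1∈w)))
    (sumPops-avoiding-1 n s M f≈0)

-- Weights of runs and the recurrence in l

module RunWeights {c ℓ} (R : CommutativeRing c ℓ) (q : CommutativeRing.Carrier R) (a′ m′ : ℕ) where
  open CommutativeRing R
  open RingNotation rawRing using (sumOver; _^_)
  open import Algebra.Properties.Semiring.Exp semiring using (^-homo-*)
  open import Relation.Binary.Reasoning.Setoid setoid
  open WordSums R
  open Subword a′ m′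

  -- Length of the run that an ascent turns a run of u and c + 1 copies into,
  -- where k is the length of u.
  next : ℕ → ℕ → ℕ
  next k zero    = suc k
  next k (suc c) = 1

  -- The weight of the continuations of length n when there are d letters on
  -- the stack below the top letter t, and the word so far ends in a run of
  -- k ascending letters and then c + 1 copies of t.
  weight  : (d k c n : ℕ) → Carrier
  weights : (d n : ℕ) → Carrier

  weight d k c zero    = q ^ ω k c
  weight d k c (suc n) =
    q ^ ω k c * (weight (suc d) (next k c) 0 n + weights d n) + weight d k (suc c) n

  weights zero    n = 0#
  weights (suc d) n = weight d 0 0 n + weights d n

  private
    copies-∷ : ∀ c (t : ℕ) (w : Word) → replicate c t ++ t ∷ w ≡ t ∷ replicate c t ++ w
    copies-∷ zero    t w = ≡.refl
    copies-∷ (suc c) t w = ≡.cong (t ∷_) (copies-∷ c t w)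

    run-∷ʳ : ∀ u t z (w : Word) → run u t 0 (z ∷ w) ≡ run (u ++ t ∷ []) z 0 w
    run-∷ʳ u t z w = ≡.sym (Listₚ.++-assoc u (t ∷ []) (z ∷ w))

  module _ (l : ℕ) where

    private
      runWeight : Word → ℕ → ℕ → Word → Carrier
      runWeight u t c w = q ^ μ τ (run u (t ℕ.+ l) c (map (ℕ._+ l) w))

      split : ∀ {i} j k → i ≡ j ℕ.+ k → q ^ i ≈ q ^ j * q ^ k
      split j k ≡.refl = ^-homo-* q j k

    -- The actual letters drop out: whether a letter is opened, repeated or popped decides every
    -- comparison that the count of `τ` makes, so only the height of the stack and the shape of the
    -- current run survive. The three cases are the three summands of `weight`.
    sum-runWeight : ∀ n {s t M} u c → Stack M (t ∷ s) → AscendsTo (t ℕ.+ l) u →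
      sumContinuations (t ∷ s) M n (runWeight u t c) ≈ weight (length s) (length u) c n

    private
      sum-pops : ∀ n {s t M} u c → Stack M (t ∷ s) → AscendsTo (t ℕ.+ l) u →
        sumPops s M n (runWeight u t c) ≈ q ^ ω (length u) c * weights (length s) n
      sum-pops n u c (_ ∷ []) asc = sym (zeroʳ _)
      sum-pops n {z ∷ s} {t} {M} u c (t<M ∷ (z<t ∷ stk)) asc = begin
        sumContinuations (z ∷ s) M n (runWeight u t c ∘ (z ∷_)) + sumPops s M n (runWeight u t c)
          ≈⟨ +-cong
               (trans (sumContinuations-cong n (Stack-positive (z<M ∷ stk))
                        (λ w _ → split (ω (length u) c) (μ τ (z ℕ.+ l ∷ map (ℕ._+ l) w))
                                   (μ-run-descent u (t ℕ.+ l) c (z ℕ.+ l) (map (ℕ._+ l) w) asc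
                                   (ℕₚ.+-monoˡ-< l (s≤s z<t)))))
               (trans (sumContinuations-*ˡ n (z ∷ s) M _ (runWeight [] z 0))
                      (*-congˡ (sum-runWeight n [] 0 (z<M ∷ stk) tt))))
               (sum-pops n u c (t<M ∷ Stack-weaken (ℕₚ.<⇒≤ z<t) stk) asc) ⟩
        q ^ ω (length u) c * weight (length s) 0 0 n + q ^ ω (length u) c * weights (length s) n
          ≈⟨ distribˡ _ _ _ ⟨
        q ^ ω (length u) c * (weight (length s) 0 0 n + weights (length s) n) ∎
        where
        z<M : _ < M
        z<M = ℕₚ.<-trans z<t t<M

      sum-new : ∀ n {s t M} u c → Stack M (t ∷ s) → AscendsTo (t ℕ.+ l) u →
        sumContinuations (suc M ∷ t ∷ s) (suc M) n (runWeight u t c ∘ (suc M ∷_)) ≈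
        q ^ ω (length u) c * weight (suc (length s)) (next (length u) c) 0 n
      sum-new n {s} {t} {M} u zero stk asc = begin
        sumContinuations (suc M ∷ t ∷ s) (suc M) n (runWeight u t 0 ∘ (suc M ∷_))
          ≈⟨ sumContinuations-cong n (Stack-positive (ℕₚ.≤-refl ∷ stk))
               (λ w _ → reflexive (≡.cong (λ v → q ^ μ τ v)
                 (run-∷ʳ u (t ℕ.+ l) (suc M ℕ.+ l) (map (ℕ._+ l) w)))) ⟩
        sumContinuations (suc M ∷ t ∷ s) (suc M) n (runWeight (u ++ t ℕ.+ l ∷ []) (suc M) 0)
          ≈⟨ sum-runWeight n (u ++ t ℕ.+ l ∷ []) 0 (ℕₚ.≤-refl ∷ stk)
               (AscendsTo-∷ʳ u asc (ℕₚ.+-monoˡ-< l (s≤s (proj₂ (Stack-∈ stk (here ≡.refl)))))) ⟩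
        weight (suc (length s)) (length (u ++ t ℕ.+ l ∷ [])) 0 n
          ≡⟨ ≡.cong (λ k → weight (suc (length s)) k 0 n)
               (≡.trans (Listₚ.length-++ u) (ℕₚ.+-comm (length u) 1)) ⟩
        weight (suc (length s)) (suc (length u)) 0 n
          ≈⟨ *-identityˡ _ ⟨
        1# * weight (suc (length s)) (suc (length u)) 0 n
          -- A run with a single copy completes nothing, so the factor demanded by the uniform
          -- recursion is `1#`.
          ≡⟨ ≡.cong (λ i → q ^ i * weight (suc (length s)) (suc (length u)) 0 n) (ω-zero (length u)) ⟨
        q ^ ω (length u) 0 * weight (suc (length s)) (suc (length u)) 0 n ∎
      sum-new n {s} {t} {M} u (suc c) stk asc = begin
        sumContinuations (suc M ∷ t ∷ s) (suc M) n (runWeight u t (suc c) ∘ (suc M ∷_))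
          ≈⟨ sumContinuations-cong n (Stack-positive (ℕₚ.≤-refl ∷ stk))
               (λ w _ → split (ω (length u) (suc c)) (μ τ (t ℕ.+ l ∷ suc M ℕ.+ l ∷ map (ℕ._+ l) w))
                          (μ-run-ascent u (t ℕ.+ l) c (suc M ℕ.+ l) (map (ℕ._+ l) w) asc
                          (ℕₚ.+-monoˡ-< l (s≤s (proj₂ (Stack-∈ stk (here ≡.refl))))))) ⟩
        sumContinuations (suc M ∷ t ∷ s) (suc M) n
          (λ w → q ^ ω (length u) (suc c) * runWeight (t ℕ.+ l ∷ []) (suc M) 0 w)
          ≈⟨ sumContinuations-*ˡ n (suc M ∷ t ∷ s) (suc M) _ _ ⟩
        q ^ ω (length u) (suc c) *
          sumContinuations (suc M ∷ t ∷ s) (suc M) n (runWeight (t ℕ.+ l ∷ []) (suc M) 0)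
          ≈⟨ *-congˡ (sum-runWeight n (t ℕ.+ l ∷ []) 0 (ℕₚ.≤-refl ∷ stk)
               (ℕₚ.+-monoˡ-< l (s≤s (proj₂ (Stack-∈ stk (here ≡.refl)))) , tt)) ⟩
        q ^ ω (length u) (suc c) * weight (suc (length s)) 1 0 n ∎

      sum-runWeight zero {s} {t} u c stk asc =
        reflexive (≡.cong (q ^_) (μ-run-end u (t ℕ.+ l) c asc))
      sum-runWeight (suc n) {s} {t} {M} u c stk asc = begin
        sumContinuations (suc M ∷ t ∷ s) (suc M) n (runWeight u t c ∘ (suc M ∷_)) +
        (sumContinuations (t ∷ s) M n (runWeight u t c ∘ (t ∷_)) + sumPops s M n (runWeight u t c))
          ≈⟨ +-cong (sum-new n u c stk asc) (+-cong
               (trans (sumContinuations-cong n (Stack-positive stk)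
                        (λ w _ → reflexive (≡.cong (λ v → q ^ μ τ (u ++ t ℕ.+ l ∷ v))
                                   (copies-∷ c (t ℕ.+ l) (map (ℕ._+ l) w)))))
                      (sum-runWeight n u (suc c) stk asc))
               (sum-pops n u c stk asc)) ⟩
        Ω * new + (same + Ω * old)   ≈⟨ +-congˡ (+-comm _ _) ⟩
        Ω * new + (Ω * old + same)   ≈⟨ +-assoc _ _ _ ⟨
        Ω * new + Ω * old + same     ≈⟨ +-congʳ (distribˡ _ _ _) ⟨
        Ω * (new + old) + same       ∎
        where
        Ω    = q ^ ω (length u) c
        new  = weight (suc (length s)) (next (length u) c) 0 n
        old  = weights (length s) n
        same = weight (length s) (length u) (suc c) n

  ascending-∷ʳ : ∀ l → ascending (suc l) ≡ ascending l ++ suc l ∷ []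
  ascending-∷ʳ l = ≡.sym (Listₚ.applyUpTo-∷ʳ suc l)

  AscendsTo-ascending : ∀ l → AscendsTo (suc l) (ascending l)
  AscendsTo-ascending zero    = tt
  AscendsTo-ascending (suc l) = ≡.subst (AscendsTo (2 ℕ.+ l)) (≡.sym (ascending-∷ʳ l))
    (AscendsTo-∷ʳ (ascending l) (AscendsTo-ascending l) ℕₚ.≤-refl)

  -- The first letter of a partition is 1. Shifted to l + 1 it ends the run begun by 12⋯l, hence run
  -- length l, with nothing below it on the stack.
  sum-NC-weight : ∀ l n → sumOver (NC (suc n)) (λ π → q ^ μ⁽ l ⁾ τ π) ≈ weight 0 l 0 n
  sum-NC-weight l n = begin
    sumOver (NC (suc n)) (λ π → q ^ μ⁽ l ⁾ τ π)
      ≈⟨ sum-NC (suc n) _ ⟩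
    sumContinuations (1 ∷ []) 1 n (λ w → q ^ μ⁽ l ⁾ τ (1 ∷ w)) + 0#
      ≈⟨ +-identityʳ _ ⟩
    sumContinuations (1 ∷ []) 1 n (λ w → q ^ μ⁽ l ⁾ τ (1 ∷ w))
      ≈⟨ sum-runWeight l n (ascending l) 0 (s≤s z≤n ∷ []) (AscendsTo-ascending l) ⟩
    weight 0 (length (ascending l)) 0 n
      ≡⟨ ≡.cong (λ k → weight 0 k 0 n) (Listₚ.length-applyUpTo suc l) ⟩
    weight 0 l 0 n ∎

module RunAlgebra {c ℓ} (R : CommutativeRing c ℓ) where
  open CommutativeRing R
  open IntegerSolver R
  open SetoidReasoning setoid

  split-options : ∀ x w n p s → w * (1# + x * (n + p)) + x * s ≈ w * (x * n + (1# + x * p)) + x * s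
  split-options = solve 5 (λ x w n p s →
    w :* (con (+ 1) :+ x :* (n :+ p)) :+ x :* s :=
    w :* (x :* n :+ (con (+ 1) :+ x :* p)) :+ x :* s) refl

  factor-power : ∀ x w n s y p →
    w * (x * (n * (y * p)) + p) + x * (s * p) ≈ (w * (1# + x * (n * (y * 1#) + 0#)) + x * s) * p
  factor-power = solve 6 (λ x w n s y p →
    w :* (x :* (n :* (y :* p)) :+ p) :+ x :* (s :* p) :=
    (w :* (con (+ 1) :+ x :* (n :* (y :* con (+ 1)) :+ con (+ 0))) :+ x :* s) :* p) refl

  pop-zero : ∀ x → 1# + x * 0# ≈ 1#
  pop-zero = solve 1 (λ x → con (+ 1) :+ x :* con (+ 0) := con (+ 1)) refl

  pop-suc : ∀ x a b → 1# + x * (a + b) ≈ (1# + x * b) + x * a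
  pop-suc = solve 3 (λ x a b →
    con (+ 1) :+ x :* (a :+ b) := (con (+ 1) :+ x :* b) :+ x :* a) refl

  pop-power : ∀ x a p → p + x * (a * p) ≈ (1# + x * a) * p
  pop-power = solve 3 (λ x a p → p :+ x :* (a :* p) := (con (+ 1) :+ x :* a) :* p) refl

  inverse⇒fixpoint : ∀ x i → (1# - x) * i ≈ 1# → i ≈ 1# + x * i
  inverse⇒fixpoint x i xi≈1 = trans
    (solve 2 (λ x i → i := (con (+ 1) :- x) :* i :+ x :* i) refl x i) (+-congʳ xi≈1)

  module _ (x i y q p g e₀ s₀ : Carrier) (xi≈1 : (1# - x) * i ≈ 1#)
    (y≈ : y ≈ 1# + x * e₀) (e₀≈ : e₀ ≈ 1# * g + x * s₀)
    (s₀≈ : s₀ ≈ g * (1# * i + (q - 1#) * 0# * (p * i))) where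

    -- At run length 0 no repetition completes `τ` (the factor `0#` in `s₀≈`), so the sum over the
    -- copies is purely geometric. This allows `g` to be eliminated from the recurrence for every
    -- run length.
    y-1≈ : y - 1# ≈ x * (g * i)
    y-1≈ = begin
      y - 1#                        ≈⟨ +-congʳ (trans y≈ (+-congˡ (*-congˡ (trans e₀≈ (+-congˡ (*-congˡ s₀≈)))))) ⟩
      1# + x * (1# * g + x * (g * (1# * i + (q - 1#) * 0# * (p * i)))) - 1#
        ≈⟨ solve 5 (λ x i q p g →
             con (+ 1) :+ x :* (con (+ 1) :* g :+ x :* (g :* (con (+ 1) :* i :+
               (q :- con (+ 1)) :* con (+ 0) :* (p :* i)))) :- con (+ 1) :=
             x :* (g :* (con (+ 1) :+ x :* i))) refl x i q p g ⟩
      x * (g * (1# + x * i))        ≈⟨ *-congˡ (*-congˡ (inverse⇒fixpoint x i xi≈1)) ⟨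
      x * (g * i)                   ∎

    -- The run length enters the sum over copies only through the indicator `k`; everything else
    -- there is the `x * (g * i)` already identified with y - 1.
    ascent-recurrence : ∀ k e e′ s → e ≈ 1# * (1# + x * (e′ * y)) + x * s →
      s ≈ g * (1# * i + (q - 1#) * k * (p * i)) →
      1# + x * e ≈ 1# + x * y * (1# + x * e′) + (q - 1#) * (x * p) * (y - 1#) * k
    ascent-recurrence k e e′ s e≈ s≈ = begin
      1# + x * e
        ≈⟨ +-congˡ (*-congˡ (trans e≈ (+-congˡ (*-congˡ s≈)))) ⟩
      1# + x * (1# * (1# + x * (e′ * y)) + x * (g * (1# * i + (q - 1#) * k * (p * i))))
        ≈⟨ solve 8 (λ x i y q p g k e′ →
             con (+ 1) :+ x :* (con (+ 1) :* (con (+ 1) :+ x :* (e′ :* y)) :+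
               x :* (g :* (con (+ 1) :* i :+ (q :- con (+ 1)) :* k :* (p :* i)))) :=
             con (+ 1) :+ x :* (con (+ 1) :+ x :* (e′ :* y)) :+
               (x :+ (q :- con (+ 1)) :* (x :* p) :* k) :* (x :* (g :* i)))
             refl x i y q p g k e′ ⟩
      1# + x * (1# + x * (e′ * y)) + (x + (q - 1#) * (x * p) * k) * (x * (g * i))
        ≈⟨ +-congˡ (*-congˡ y-1≈) ⟨
      1# + x * (1# + x * (e′ * y)) + (x + (q - 1#) * (x * p) * k) * (y - 1#)
        ≈⟨ solve 6 (λ x y q p k e′ →
             con (+ 1) :+ x :* (con (+ 1) :+ x :* (e′ :* y)) :+
               (x :+ (q :- con (+ 1)) :* (x :* p) :* k) :* (y :- con (+ 1)) :=
             con (+ 1) :+ x :* y :* (con (+ 1) :+ x :* e′) :+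
               (q :- con (+ 1)) :* (x :* p) :* (y :- con (+ 1)) :* k) refl x y q p k e′ ⟩
      1# + x * y * (1# + x * e′) + (q - 1#) * (x * p) * (y - 1#) * k ∎

  completion-yes : ∀ q → q ≈ 1# + (q - 1#) * 1# * 1#
  completion-yes = solve 1 (λ q → q := con (+ 1) :+ (q :- con (+ 1)) :* con (+ 1) :* con (+ 1)) refl

  completion-no₁ : ∀ q k → 1# ≈ 1# + (q - 1#) * 0# * k
  completion-no₁ = solve 2 (λ q k →
    con (+ 1) := con (+ 1) :+ (q :- con (+ 1)) :* con (+ 0) :* k) refl

  completion-no₂ : ∀ q k → 1# ≈ 1# + (q - 1#) * k * 0#
  completion-no₂ = solve 2 (λ q k →
    con (+ 1) := con (+ 1) :+ (q :- con (+ 1)) :* k :* con (+ 0)) refl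

module RunSeries {c ℓ} (R : CommutativeRing c ℓ) (q : CommutativeRing.Carrier R) (a′ m′ : ℕ) where
  private
    module K where
      open CommutativeRing R public
      open RingNotation rawRing public using (_^_)
  open PowerSeries R
  open Substitution R
  open CommutativeRing seriesRing
  open RingNotation rawRing using (_^_)
  open Series K.rawRing using (const; var; 1/[1-_])
  open Subword a′ m′
  open RunWeights R q a′ m′
  open RunAlgebra seriesRing

  Y : Carrier
  Y = 1# + var * weight 0 0 0

  private
    Ω : ℕ → ℕ → Carrier
    Ω k c = const (q K.^ ω k c)

    weight-unfold : ∀ d k c → weight d k c ≈
      Ω k c * (1# + var * (weight (suc d) (next k c) 0 + weights d)) + var * weight d k (suc c)
    weight-unfold d k c n = K.sym (K.trans
      (K.+-congʳ {(var * weight d k (suc c)) n} (const-* (q K.^ ω k c) (1# + var * options) n))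
      (coefficient n))
      where
      options : Carrier
      options = weight (suc d) (next k c) 0 + weights d

      coefficient : ∀ n → q K.^ ω k c K.* (1# + var * options) n K.+ (var * weight d k (suc c)) n
                          K.≈ weight d k c n
      coefficient zero = K.trans (K.+-cong
        (K.trans (K.*-congˡ (K.trans (K.+-congˡ (var-*-zero options)) (K.+-identityʳ K.1#)))
                 (K.*-identityʳ (q K.^ ω k c)))
        (var-*-zero (weight d k (suc c)))) (K.+-identityʳ (q K.^ ω k c))
      coefficient (suc n) = K.+-cong
        (K.*-congˡ (K.trans (K.+-congˡ (var-*-suc options n)) (K.+-identityˡ (options n))))
        (var-*-suc (weight d k (suc c)) n)

    var-raise : ∀ {N f g} → f ≈[ N ] g → var * f ≈[ suc N ] var * g
    var-raise = *-raise-[] var K.refl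

    Factors : ℕ → Set _
    Factors N = ∀ d k c → weight d k c ≈[ N ] weight 0 k c * Y ^ d

    -- If each `weight j 0 0` is W Yʲ with W = `weight 0 0 0`, the left side is 1 + x W (1 + Y + ⋯ +
    -- Yᵈ⁻¹), which is geometric since x W = Y - 1.
    pops-power : ∀ {N} → Factors N → ∀ d → 1# + var * weights d ≈[ suc N ] Y ^ d
    pops-power     h zero    = ≈⇒≈[] {f = 1# + var * 0#} {1#} (pop-zero var)
    pops-power {N} h (suc d) = begin
      1# + var * (weight d 0 0 + weights d)      ≈⟨ ≈⇒≈[] (pop-suc var (weight d 0 0) (weights d)) ⟩
      (1# + var * weights d) + var * weight d 0 0
        ≈⟨ +-cong-[] (pops-power h d) (var-raise (h d 0 0)) ⟩
      Y ^ d + var * (weight 0 0 0 * Y ^ d)       ≈⟨ ≈⇒≈[] (pop-power var (weight 0 0 0) (Y ^ d)) ⟩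
      Y ^ suc d                                  ∎
      where open SetoidReasoning (truncatedSetoid (suc N))

    -- All parameters are kept general because the recursion raises both `d` and `c`. What decreases
    -- is the precision: each recursive occurrence of `weight` carries a factor `var`.
    factors : ∀ N → Factors N
    factors zero d k c n ()
    factors (suc N) d k c = begin
      weight d k c
        ≈⟨ ≈⇒≈[] (weight-unfold d k c) ⟩
      Ω k c * (1# + var * (new (suc d) + weights d)) + var * weight d k (suc c)
        ≈⟨ ≈⇒≈[] (split-options var (Ω k c) (new (suc d)) (weights d) (weight d k (suc c))) ⟩
      Ω k c * (var * new (suc d) + (1# + var * weights d)) + var * weight d k (suc c)
        ≈⟨ +-cong-[]
             (*-congˡ-[] (Ω k c) (+-cong-[] (var-raise (ih (suc d) (next k c) 0)) (pops-power ih d)))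
             (var-raise (ih d k (suc c))) ⟩
      Ω k c * (var * (new 0 * (Y * Y ^ d)) + Y ^ d) + var * (weight 0 k (suc c) * Y ^ d)
        ≈⟨ ≈⇒≈[] (factor-power var (Ω k c) (new 0) (weight 0 k (suc c)) Y (Y ^ d)) ⟩
      (Ω k c * (1# + var * (new 0 * Y ^ 1 + 0#)) + var * weight 0 k (suc c)) * Y ^ d
        ≈⟨ *-congʳ-[] (Y ^ d) (+-cong-[] {g = var * weight 0 k (suc c)}
             (*-congˡ-[] (Ω k c) (+-cong-[] {f = 1#} (λ _ _ → K.refl)
               (var-raise (+-cong-[] {g = 0#} (≈[]-sym (ih 1 (next k c) 0)) (λ _ _ → K.refl)))))
             (λ _ _ → K.refl)) ⟩
      (Ω k c * (1# + var * (new 1 + 0#)) + var * weight 0 k (suc c)) * Y ^ d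
        ≈⟨ ≈⇒≈[] (*-congʳ {Y ^ d} (sym {weight 0 k c} (weight-unfold 0 k c))) ⟩
      weight 0 k c * Y ^ d ∎
      where
      open SetoidReasoning (truncatedSetoid (suc N))
      ih : Factors N
      ih = factors N
      new : ℕ → Carrier
      new d = weight d (next k c) 0

    weight-factor : ∀ d k c → weight d k c ≈ weight 0 k c * Y ^ d
    weight-factor d k c = ≈[]⇒≈ (λ N → factors N d k c)

    -- What may follow a repeated letter at depth 0: the end of the word, or an ascent. The new run
    -- has length 1 whatever came before, so `G` depends on neither `k` nor `c`.
    G : Carrier
    G = 1# + var * (weight 0 1 0 * Y)

    I : Carrier
    I = 1/[1- var ]

    Q : Carrier
    Q = const q

    weight-step : ∀ k c → weight 0 k c ≈
      Ω k c * (1# + var * (weight 0 (next k c) 0 * Y)) + var * weight 0 k (suc c)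
    weight-step k c = trans {weight 0 k c} (weight-unfold 0 k c)
      (+-congʳ {var * weight 0 k (suc c)} (*-congˡ {Ω k c} (+-congˡ {1#} (*-congˡ {var}
        (λ n → K.trans (K.+-identityʳ _) (K.trans (weight-factor 1 (next k c) 0 n)
          (*-congˡ {weight 0 (next k c) 0} (*-identityʳ Y) n)))))))

    indicator-yes : ∀ {m l} → m ≤ l → indicator m l ≡ 1#
    indicator-yes z≤n       = ≡.refl
    indicator-yes (s≤s m≤l) = indicator-yes m≤l

    indicator-no : ∀ {m l} → ¬ m ≤ l → indicator m l ≡ 0#
    indicator-no {zero}  {l}     m≰l = contradiction z≤n m≰l
    indicator-no {suc m} {zero}  m≰l = ≡.refl
    indicator-no {suc m} {suc l} m≰l = indicator-no (m≰l ∘ s≤s)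

    -- Linearising the power of `q` in indicators separates `k` from `c`, so that the sum over `c`
    -- consists of geometric series.
    Ω-suc : ∀ k c → Ω k (suc c) ≈ 1# + (Q - 1#) * indicator (suc m′) k * indicator a′ c
    Ω-suc k c with suc m′ ≤? k | suc a′ ≤? suc c
    ... | yes m≤ | yes (s≤s a≤) rewrite ω-yes (m≤ , s≤s a≤) | indicator-yes m≤ | indicator-yes a≤ =
      trans {const (q K.* K.1#)} (const-cong (K.*-identityʳ q)) (completion-yes Q)
    ... | no m≰ | _ rewrite ω-no {k} {suc c} (m≰ ∘ proj₁) | indicator-no m≰ =
      completion-no₁ Q (indicator a′ c)
    ... | _ | no a≰ rewrite ω-no {k} {suc c} (a≰ ∘ proj₂) | indicator-no (a≰ ∘ s≤s) =
      completion-no₂ Q (indicator (suc m′) k)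

    -- Each further copy of the top letter costs a factor x. Unrolling `weight-step` along `c` thus
    -- amounts to substituting x for a variable that marks `c`.
    weight-copies : ∀ k → weight 0 k 1 ≈
      G * (1# * I + (Q - 1#) * indicator (suc m′) k * (var ^ a′ * I))
    weight-copies k = begin
      weight 0 k 1
        ≈⟨ ⟨⟩-unique var K.refl (λ c → weight 0 k (suc c)) (λ c → Ω k (suc c) * G)
             (λ c → weight-step k (suc c)) ⟩
      (λ c → Ω k (suc c) * G) ⟨ var ⟩
        ≈⟨ ⟨⟩-cong var (λ c → trans {Ω k (suc c) * G} (*-comm (Ω k (suc c)) G)
             (*-congˡ {G} (Ω-suc k c))) ⟩
      (λ c → G * (1# + B * indicator a′ c)) ⟨ var ⟩
        ≈⟨ ⟨⟩-*ˡ var K.refl G (λ c → 1# + B * indicator a′ c) ⟩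
      G * (λ c → 1# + B * indicator a′ c) ⟨ var ⟩
        ≈⟨ *-congˡ {G} (⟨⟩-+ (λ _ → 1#) (λ c → B * indicator a′ c) var) ⟩
      G * ((λ _ → 1#) ⟨ var ⟩ + (λ c → B * indicator a′ c) ⟨ var ⟩)
        ≈⟨ *-congˡ {G} (+-cong (⟨⟩-constant var K.refl 1#)
             (trans {(λ c → B * indicator a′ c) ⟨ var ⟩} (⟨⟩-*ˡ var K.refl B (indicator a′))
               (*-congˡ {B} (⟨⟩-indicator var K.refl a′)))) ⟩
      G * (1# * I + B * (var ^ a′ * I)) ∎
      where
      open SetoidReasoning setoid
      B : Carrier
      B = (Q - 1#) * indicator (suc m′) k

    weight-first : ∀ k → weight 0 k 0 ≈ 1# * (1# + var * (weight 0 (suc k) 0 * Y)) + var * weight 0 k 1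
    weight-first k = trans {weight 0 k 0} (weight-step k 0)
      (+-congʳ {var * weight 0 k 1} (*-congʳ {1# + var * (weight 0 (suc k) 0 * Y)} Ω-zero))
      where
      Ω-zero : Ω k 0 ≈ 1#
      Ω-zero n = K.reflexive (≡.cong (λ i → const (q K.^ i) n) (ω-zero k))

  weight-recurrence : ∀ k →
    1# + var * weight 0 k 0 ≈ 1# + var * Y * (1# + var * weight 0 (suc k) 0)
      + (Q - 1#) * (var * var ^ a′) * (Y - 1#) * indicator (suc m′) k
  weight-recurrence k = ascent-recurrence var I Y Q (var ^ a′) G (weight 0 0 0) (weight 0 0 1)
    (1/[1-]-inverse var K.refl) (λ _ → K.refl) (weight-first 0) (weight-copies 0)
    (indicator (suc m′) k) (weight 0 k 0) (weight 0 (suc k) 0) (weight 0 k 1)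
    (weight-first k) (weight-copies k)

-- The functional equation and the polynomial equation for y

module FunctionalEquationAlgebra {c ℓ} (R : CommutativeRing c ℓ) where
  open CommutativeRing R
  open IntegerSolver R
  open RingNotation rawRing using (_^_)
  open SetoidReasoning setoid

  -- Multiplication of `y≈` by 1 - xy. Here `t` is q - 1, and `p₁`, `p₂`, `p₃` stand for x^(a-1),
  -- x^(m-1), y^(m-1).
  polynomial-equation : ∀ x y t i p₁ p₂ p₃ → (1# - x * y) * i ≈ 1# →
    y ≈ 1# * i + t * p₁ * (y - 1#) * (p₂ * p₃ * i) →
    x * y ^ 2 - y + 1# + t * (p₁ * p₂) * p₃ * (y - 1#) ≈ 0#
  polynomial-equation x y t i p₁ p₂ p₃ inv y≈ = begin
    x * y ^ 2 - y + 1# + t * (p₁ * p₂) * p₃ * (y - 1#)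
      ≈⟨ solve 6 (λ x y t p₁ p₂ p₃ →
           x :* y :^ 2 :- y :+ con (+ 1) :+ t :* (p₁ :* p₂) :* p₃ :* (y :- con (+ 1)) :=
           con (+ 1) :+ t :* p₁ :* (y :- con (+ 1)) :* (p₂ :* p₃) :- (con (+ 1) :- x :* y) :* y)
           refl x y t p₁ p₂ p₃ ⟩
    1# + t * p₁ * (y - 1#) * (p₂ * p₃) - (1# - x * y) * y
      ≈⟨ +-congˡ (-‿cong (*-congˡ y≈)) ⟩
    1# + t * p₁ * (y - 1#) * (p₂ * p₃) -
      (1# - x * y) * (1# * i + t * p₁ * (y - 1#) * (p₂ * p₃ * i))
      ≈⟨ solve 7 (λ x y t p₁ p₂ p₃ i →
           con (+ 1) :+ t :* p₁ :* (y :- con (+ 1)) :* (p₂ :* p₃) :-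
             (con (+ 1) :- x :* y) :* (con (+ 1) :* i :+ t :* p₁ :* (y :- con (+ 1)) :* (p₂ :* p₃ :* i)) :=
           (con (+ 1) :- (con (+ 1) :- x :* y) :* i) :*
             (con (+ 1) :+ t :* p₁ :* (y :- con (+ 1)) :* (p₂ :* p₃)))
           refl x y t p₁ p₂ p₃ i ⟩
    (1# - (1# - x * y) * i) * (1# + t * p₁ * (y - 1#) * (p₂ * p₃))
      ≈⟨ *-congʳ (trans (+-congˡ (-‿cong inv)) (-‿inverseʳ 1#)) ⟩
    0# * (1# + t * p₁ * (y - 1#) * (p₂ * p₃))
      ≈⟨ zeroˡ _ ⟩
    0# ∎

  quadratic-equation : ∀ x y p₁ p₂ → x * y ^ 2 - y + 1# + (1# - 1#) * p₁ * p₂ * (y - 1#) ≈ 0# →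
    y ≈ 1# + x * (y * y)
  quadratic-equation x y p₁ p₂ e = begin
    y       ≈⟨ +-identityʳ y ⟨
    y + 0#  ≈⟨ +-congˡ e ⟨
    y + (x * y ^ 2 - y + 1# + (1# - 1#) * p₁ * p₂ * (y - 1#))
      ≈⟨ solve 4 (λ x y p₁ p₂ →
           y :+ (x :* y :^ 2 :- y :+ con (+ 1) :+ (con (+ 1) :- con (+ 1)) :* p₁ :* p₂ :* (y :- con (+ 1)))
           := con (+ 1) :+ x :* (y :* y)) refl x y p₁ p₂ ⟩
    1# + x * (y * y) ∎

  -- (1 - 2xy)² = 1 - 4x and (1 - 2xy) t = y - 1.
  derivative-equation : ∀ x y t → y ≈ 1# + x * (y * y) → t ≈ 0# + (x * (y * y) + x * (t * y + y * t)) →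
    t + y ≈ 1# + x * (t + t + t + t + (y + y))
  derivative-equation x y t y≈ t≈ = begin
    t + y
      ≈⟨ solve 3 (λ x y t → t :+ y :=
           y :+ (con (+ 1) :- con (+ 2) :* x :* y) :*
             (t :- (con (+ 0) :+ (x :* (y :* y) :+ x :* (t :* y :+ y :* t)))) :+
           (con (+ 4) :* x :* t) :* (y :- x :* (y :* y)) :+ (con (+ 1) :- con (+ 2) :* x :* y) :* (x :* (y :* y)))
           refl x y t ⟩
    y + (1# - (1# + 1#) * x * y) * (t - (0# + (x * (y * y) + x * (t * y + y * t)))) +
      ((1# + 1# + 1# + 1#) * x * t) * (y - x * (y * y)) + (1# - (1# + 1#) * x * y) * (x * (y * y))
      ≈⟨ +-cong (+-cong (+-congˡ (*-congˡ (trans (+-congʳ t≈) (-‿inverseʳ _))))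
                        (*-congˡ y-xyy)) (*-congˡ xyy) ⟩
    y + (1# - (1# + 1#) * x * y) * 0# +
      ((1# + 1# + 1# + 1#) * x * t) * 1# + (1# - (1# + 1#) * x * y) * (y - 1#)
      ≈⟨ solve 3 (λ x y t →
           y :+ (con (+ 1) :- con (+ 2) :* x :* y) :* con (+ 0) :+
             (con (+ 4) :* x :* t) :* con (+ 1) :+ (con (+ 1) :- con (+ 2) :* x :* y) :* (y :- con (+ 1)) :=
           y :+ (con (+ 4) :* x :* t) :+ y :- con (+ 1) :+ con (+ 2) :* x :* y :- con (+ 2) :* (x :* (y :* y)))
           refl x y t ⟩
    y + (1# + 1# + 1# + 1#) * x * t + y - 1# + (1# + 1#) * x * y - (1# + 1#) * (x * (y * y))
      ≈⟨ +-congˡ (-‿cong (*-congˡ xyy)) ⟩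
    y + (1# + 1# + 1# + 1#) * x * t + y - 1# + (1# + 1#) * x * y - (1# + 1#) * (y - 1#)
      ≈⟨ solve 3 (λ x y t →
           y :+ (con (+ 4) :* x :* t) :+ y :- con (+ 1) :+ con (+ 2) :* x :* y :- con (+ 2) :* (y :- con (+ 1)) :=
           con (+ 1) :+ x :* (t :+ t :+ t :+ t :+ (y :+ y))) refl x y t ⟩
    1# + x * (t + t + t + t + (y + y)) ∎
    where
    y-xyy : y - x * (y * y) ≈ 1#
    y-xyy = trans (+-congʳ y≈) (solve 1 (λ s → con (+ 1) :+ s :- s := con (+ 1)) refl (x * (y * y)))

    xyy : x * (y * y) ≈ y - 1#
    xyy = sym (trans (+-congʳ y≈) (solve 1 (λ s → con (+ 1) :+ s :- con (+ 1) := s) refl (x * (y * y))))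

module FunctionalEquation {c ℓ} (R : CommutativeRing c ℓ) (q v : CommutativeRing.Carrier R) (a′ m′ : ℕ) where
  private
    module K where
      open CommutativeRing R public
      open WordSums R public
      open RingNotation rawRing public using (_^_)
  open GeneratingFunctions K.rawRing q v (suc (suc a′)) (suc (suc m′))
    using (X; Q; A; y; _^_; 1/[1-_])
  open PowerSeries R
  open Substitution R
  open CommutativeRing seriesRing
  open Subword a′ m′
  open RunWeights R q a′ m′
  open RunSeries R q a′ m′
  open FunctionalEquationAlgebra seriesRing
  open import Algebra.Properties.Semiring.Exp semiring using (^-homo-*)
  open import Algebra.Properties.CommutativeSemiring.Exp commutativeSemiring using (^-distrib-*)

  A≈weight : ∀ l → A l ≈ 1# + X * weight 0 l 0
  A≈weight l zero    = K.sym (K.trans (K.+-congˡ (var-*-zero (weight 0 l 0))) (K.+-identityʳ _))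
  A≈weight l (suc n) = K.trans (sum-NC-weight l n)
    (K.sym (K.trans (K.+-identityˡ _) (var-*-suc (weight 0 l 0) n)))

  y≈A₀ : y ≈ A 0
  y≈A₀ zero    = K.+-identityʳ _
  y≈A₀ (suc n) = K.sumOver-cong (NC (suc n)) (λ π → K.reflexive (≡.cong (λ w → q K.^ μ τ w)
    (≡.sym (≡.trans (Listₚ.map-cong ℕₚ.+-identityʳ π) (Listₚ.map-id π)))))

  y≈Y : y ≈ Y
  y≈Y n = K.trans (y≈A₀ n) (A≈weight 0 n)

  T : Carrier
  T = (Q - 1#) * X ^ suc a′ * (y - 1#)

  A-recurrence : ∀ l → A l ≈ 1# + X * y * A (suc l) + T * indicator (suc m′) l
  A-recurrence l = begin
    A l
      ≈⟨ A≈weight l ⟩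
    1# + X * weight 0 l 0
      ≈⟨ weight-recurrence l ⟩
    1# + X * Y * (1# + X * weight 0 (suc l) 0) + (Q - 1#) * X ^ suc a′ * (Y - 1#) * indicator (suc m′) l
      ≈⟨ +-cong (+-congˡ {1#} (*-cong (*-congˡ {X} (sym {y} y≈Y)) (sym {A (suc l)} (A≈weight (suc l)))))
           (*-congʳ {indicator (suc m′) l} (*-congˡ {(Q - 1#) * X ^ suc a′} (+-congʳ { - 1#} (sym {y} y≈Y)))) ⟩
    1# + X * y * A (suc l) + T * indicator (suc m′) l ∎
    where open SetoidReasoning setoid

  Xy₀≈0 : (X * y) 0 K.≈ K.0#
  Xy₀≈0 = var-*-zero y

  -- Iteration from l = 0 collects the inhomogeneous terms with weights (xy)ˡ; the indicator
  -- contributes the tail from l = m - 1 on.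
  y-closed : y ≈ 1# * 1/[1- X * y ] + T * ((X * y) ^ suc m′ * 1/[1- X * y ])
  y-closed = begin
    y
      ≈⟨ y≈A₀ ⟩
    A 0
      ≈⟨ ⟨⟩-unique (X * y) Xy₀≈0 A h (λ l → trans {A l} (A-recurrence l)
           (trans (+-assoc 1# (X * y * A (suc l)) (T * indicator (suc m′) l))
             (trans (+-congˡ {1#} (+-comm (X * y * A (suc l)) (T * indicator (suc m′) l)))
               (sym {h l + X * y * A (suc l)} (+-assoc 1# (T * indicator (suc m′) l) (X * y * A (suc l))))))) ⟩
    h ⟨ X * y ⟩
      ≈⟨ ⟨⟩-+ (λ _ → 1#) (λ l → T * indicator (suc m′) l) (X * y) ⟩
    (λ _ → 1#) ⟨ X * y ⟩ + (λ l → T * indicator (suc m′) l) ⟨ X * y ⟩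
      ≈⟨ +-cong (⟨⟩-constant (X * y) Xy₀≈0 1#)
           (trans {(λ l → T * indicator (suc m′) l) ⟨ X * y ⟩} (⟨⟩-*ˡ (X * y) Xy₀≈0 T (indicator (suc m′)))
             (*-congˡ {T} (⟨⟩-indicator (X * y) Xy₀≈0 (suc m′)))) ⟩
    1# * 1/[1- X * y ] + T * ((X * y) ^ suc m′ * 1/[1- X * y ]) ∎
    where
    open SetoidReasoning setoid
    h : ℕ → Carrier
    h l = 1# + T * indicator (suc m′) l

  y-polynomial :
    X * y ^ 2 - y + 1# + (Q - 1#) * X ^ (suc (suc a′) ℕ.+ suc (suc m′) ∸ 2) * y ^ (suc (suc m′) ∸ 1) * (y - 1#) ≈ 0#
  y-polynomial = begin
    X * y ^ 2 - y + 1# + (Q - 1#) * X ^ (a′ ℕ.+ (2 ℕ.+ m′)) * y ^ suc m′ * (y - 1#)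
      ≡⟨ ≡.cong (λ k → X * y ^ 2 - y + 1# + (Q - 1#) * X ^ k * y ^ suc m′ * (y - 1#))
           (ℕₚ.+-suc a′ (suc m′)) ⟩
    X * y ^ 2 - y + 1# + (Q - 1#) * X ^ (suc a′ ℕ.+ suc m′) * y ^ suc m′ * (y - 1#)
      ≈⟨ +-congˡ {X * y ^ 2 - y + 1#} (*-congʳ {y - 1#} (*-congʳ {y ^ suc m′} (*-congˡ {Q - 1#}
           (^-homo-* X (suc a′) (suc m′))))) ⟩
    X * y ^ 2 - y + 1# + (Q - 1#) * (X ^ suc a′ * X ^ suc m′) * y ^ suc m′ * (y - 1#)
      ≈⟨ polynomial-equation X y (Q - 1#) 1/[1- X * y ] (X ^ suc a′) (X ^ suc m′) (y ^ suc m′)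
           (1/[1-]-inverse (X * y) Xy₀≈0)
           (trans {y} y-closed (+-congˡ {1# * 1/[1- X * y ]} (*-congˡ {T} (*-congʳ {1/[1- X * y ]}
             (^-distrib-* X y (suc m′)))))) ⟩
    0# ∎
    where open SetoidReasoning setoid

-- Catalan numbers: closed formula and convolution

module CatalanNumbers where
  private
    module Z where
      open CommutativeRing ℤₚ.+-*-commutativeRing public
      open FiniteSums ℤₚ.+-*-commutativeRing public
      open IntegerSolver ℤₚ.+-*-commutativeRing public
    open Z using (solve; _:=_; _:+_; _:*_; con)

    open PowerSeries ℤₚ.+-*-commutativeRing
    open Substitution ℤₚ.+-*-commutativeRing
    open CommutativeRing seriesRing
    open Series Z.rawRing using (var)
    open RingNotation rawRing using (_^_)
    -- At q = 1 the series y counts all non-crossing partitions.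
    open GeneratingFunctions Z.rawRing (+ 1) (+ 1) 2 2 using () renaming (y to c)

    c-quadratic : c ≈ 1# + var * (c * c)
    c-quadratic = FunctionalEquationAlgebra.quadratic-equation seriesRing var c (var ^ 2) (c ^ 1)
      (FunctionalEquation.y-polynomial ℤₚ.+-*-commutativeRing (+ 1) (+ 1) 0 0)

    -- The Euler operator x d/dx, a derivation of the ring of series.
    θ : Carrier → Carrier
    θ f n = + n ℤ.* f n

    θ-1 : θ 1# ≈ 0#
    θ-1 zero    = ≡.refl
    θ-1 (suc n) = ℤₚ.*-zeroʳ (+ suc n)

    θ-var-* : ∀ f → θ (var * f) ≈ var * f + var * θ f
    θ-var-* f zero = ≡.sym (≡.cong₂ ℤ._+_ (var-*-zero f) (var-*-zero (θ f)))
    θ-var-* f (suc n) = ≡.trans (≡.cong (+ suc n ℤ.*_) (var-*-suc f n))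
      (≡.trans (solve 2 (λ N s → (con (+ 1) :+ N) :* s := s :+ N :* s) ≡.refl (+ n) (f n))
        (≡.sym (≡.cong₂ ℤ._+_ (var-*-suc f n) (var-*-suc (θ f) n))))

    θ-* : ∀ f g → θ (f * g) ≈ θ f * g + f * θ g
    θ-* f g n = ≡.trans (Z.∑-*ˡ (suc n) (+ n) (λ i → f i ℤ.* g (n ∸ i)))
      (≡.trans (Z.∑-cong (suc n) (λ i → + n ℤ.* (f i ℤ.* g (n ∸ i)))
                  (λ i → θ f i ℤ.* g (n ∸ i) ℤ.+ f i ℤ.* θ g (n ∸ i)) leibniz)
        (Z.∑-+ (suc n) (λ i → θ f i ℤ.* g (n ∸ i)) (λ i → f i ℤ.* θ g (n ∸ i))))
      where
      leibniz : ∀ i → i < suc n → + n ℤ.* (f i ℤ.* g (n ∸ i)) ≡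
                θ f i ℤ.* g (n ∸ i) ℤ.+ f i ℤ.* θ g (n ∸ i)
      leibniz i (s≤s i≤n) = ≡.trans
        (≡.cong (λ k → + k ℤ.* (f i ℤ.* g (n ∸ i))) (≡.sym (ℕₚ.m+[n∸m]≡n i≤n)))
        (solve 4 (λ I J s t → (I :+ J) :* (s :* t) := I :* s :* t :+ s :* (J :* t)) ≡.refl
          (+ i) (+ (n ∸ i)) (f i) (g (n ∸ i)))

    θc : θ c ≈ 0# + (var * (c * c) + var * (θ c * c + c * θ c))
    θc n = ≡.trans (≡.cong (+ n ℤ.*_) (c-quadratic n))
      (≡.trans (ℤₚ.*-distribˡ-+ (+ n) (1# n) ((var * (c * c)) n))
        (≡.cong₂ ℤ._+_ (θ-1 n) (≡.trans (θ-var-* (c * c) n)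
          (≡.cong (λ k → (var * (c * c)) n ℤ.+ k) (*-congˡ {var} (θ-* c c) n)))))

    c-recurrence : ∀ n → + (2 ℕ.+ n) ℤ.* c (suc n) ≡ + (2 ℕ.* (1 ℕ.+ 2 ℕ.* n)) ℤ.* c n
    c-recurrence n = begin
      + (2 ℕ.+ n) ℤ.* c (suc n)
        ≡⟨ solve 2 (λ N s → (con (+ 2) :+ N) :* s := (con (+ 1) :+ N) :* s :+ s) ≡.refl (+ n) (c (suc n)) ⟩
      θ c (suc n) ℤ.+ c (suc n)
        ≡⟨ FunctionalEquationAlgebra.derivative-equation seriesRing var c (θ c) c-quadratic θc (suc n) ⟩
      + 0 ℤ.+ (var * (θ c + θ c + θ c + θ c + (c + c))) (suc n)
        ≡⟨ ≡.trans (ℤₚ.+-identityˡ _) (var-*-suc (θ c + θ c + θ c + θ c + (c + c)) n) ⟩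
      θ c n ℤ.+ θ c n ℤ.+ θ c n ℤ.+ θ c n ℤ.+ (c n ℤ.+ c n)
        ≡⟨ solve 2 (λ N s → N :* s :+ N :* s :+ N :* s :+ N :* s :+ (s :+ s) :=
             con (+ 2) :* (con (+ 1) :+ con (+ 2) :* N) :* s) ≡.refl (+ n) (c n) ⟩
      + 2 ℤ.* (+ 1 ℤ.+ + 2 ℤ.* + n) ℤ.* c n
        ≡⟨ ≡.cong (ℤ._* c n) (≡.trans
             (≡.cong (λ k → + 2 ℤ.* (+ 1 ℤ.+ k)) (≡.sym (ℤₚ.pos-* 2 n)))
             (≡.sym (ℤₚ.pos-* 2 (1 ℕ.+ 2 ℕ.* n)))) ⟩
      + (2 ℕ.* (1 ℕ.+ 2 ℕ.* n)) ℤ.* c n ∎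
      where open ≡.≡-Reasoning

    centralBinomial : ℕ → ℕ
    centralBinomial n = (2 ℕ.* n) C n

    centralBinomial-! : ∀ n → centralBinomial n ℕ.* (n ! ℕ.* n !) ≡ (2 ℕ.* n) !
    centralBinomial-! n = ≡.subst
      (λ k → centralBinomial n ℕ.* (n ! ℕ.* k !) ≡ (2 ℕ.* n) !) 2n∸n≡n
      (≡.trans (≡.cong (ℕ._* (n ! ℕ.* (2 ℕ.* n ∸ n) !)) (nCk≡n!/k![n-k]! n≤2n))
        (m/n*n≡m {{n ℕₚ.!* (2 ℕ.* n ∸ n) !≢0}} (k![n∸k]!∣n! n≤2n)))
      where
      n≤2n : n ≤ 2 ℕ.* n
      n≤2n = ℕₚ.m≤m+n n (n ℕ.+ 0)
      2n∸n≡n : 2 ℕ.* n ∸ n ≡ n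
      2n∸n≡n = ≡.trans (ℕₚ.m+n∸m≡n n (n ℕ.+ 0)) (ℕₚ.+-identityʳ n)

    centralBinomial-suc : ∀ n → suc n ℕ.* centralBinomial (suc n) ≡
                          2 ℕ.* (1 ℕ.+ 2 ℕ.* n) ℕ.* centralBinomial n
    centralBinomial-suc n =
      ℕₚ.*-cancelʳ-≡ _ _ (suc n ℕ.* (n ! ℕ.* n !))
      {{ℕₚ.m*n≢0 (suc n) (n ! ℕ.* n !) {{_}} {{n ℕₚ.!* n !≢0}}}} (begin
        suc n ℕ.* b′ ℕ.* (suc n ℕ.* (f ℕ.* f))      ≡⟨ rearrange n b′ f ⟩
        b′ ℕ.* (suc n ! ℕ.* suc n !)                ≡⟨ centralBinomial-! (suc n) ⟩
        (2 ℕ.* suc n) !                             ≡⟨ ≡.cong _! (ℕₚ.*-suc 2 n) ⟩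
        (2 ℕ.+ 2 ℕ.* n) !
          ≡⟨ ≡.cong (λ k → (2 ℕ.+ 2 ℕ.* n) ℕ.* ((1 ℕ.+ 2 ℕ.* n) ℕ.* k)) (centralBinomial-! n) ⟨
        (2 ℕ.+ 2 ℕ.* n) ℕ.* ((1 ℕ.+ 2 ℕ.* n) ℕ.* (b ℕ.* (f ℕ.* f)))
          ≡⟨ rearrange′ n b f ⟩
        2 ℕ.* (1 ℕ.+ 2 ℕ.* n) ℕ.* b ℕ.* (suc n ℕ.* (f ℕ.* f)) ∎)
      where
      open ≡.≡-Reasoning
      b  = centralBinomial n
      b′ = centralBinomial (suc n)
      f  = n !
      rearrange : ∀ n b f → suc n ℕ.* b ℕ.* (suc n ℕ.* (f ℕ.* f)) ≡ b ℕ.* (suc n ℕ.* f ℕ.* (suc n ℕ.* f))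
      rearrange = ℕ-Solver.solve-∀
      rearrange′ : ∀ n b f → (2 ℕ.+ 2 ℕ.* n) ℕ.* ((1 ℕ.+ 2 ℕ.* n) ℕ.* (b ℕ.* (f ℕ.* f))) ≡
                             2 ℕ.* (1 ℕ.+ 2 ℕ.* n) ℕ.* b ℕ.* (suc n ℕ.* (f ℕ.* f))
      rearrange′ = ℕ-Solver.solve-∀

    -- The two sides obey matching first-order recurrences, one from the differential equation and
    -- one from factorials. Comparing them cancels n + 1, which is legitimate in ℤ.
    c-closed : ∀ n → + suc n ℤ.* c n ≡ + centralBinomial n
    c-closed zero    = ≡.refl
    c-closed (suc n) = ℤₚ.*-cancelˡ-≡ (+ suc n) _ _ (begin
      + suc n ℤ.* (+ (2 ℕ.+ n) ℤ.* c (suc n))                   ≡⟨ ≡.cong (+ suc n ℤ.*_) (c-recurrence n) ⟩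
      + suc n ℤ.* (+ (2 ℕ.* (1 ℕ.+ 2 ℕ.* n)) ℤ.* c n)
        ≡⟨ solve 3 (λ s t r → s :* (t :* r) := t :* (s :* r)) ≡.refl
             (+ suc n) (+ (2 ℕ.* (1 ℕ.+ 2 ℕ.* n))) (c n) ⟩
      + (2 ℕ.* (1 ℕ.+ 2 ℕ.* n)) ℤ.* (+ suc n ℤ.* c n)
        ≡⟨ ≡.cong (+ (2 ℕ.* (1 ℕ.+ 2 ℕ.* n)) ℤ.*_) (c-closed n) ⟩
      + (2 ℕ.* (1 ℕ.+ 2 ℕ.* n)) ℤ.* + centralBinomial n
        ≡⟨ ℤₚ.pos-* (2 ℕ.* (1 ℕ.+ 2 ℕ.* n)) (centralBinomial n) ⟨
      + (2 ℕ.* (1 ℕ.+ 2 ℕ.* n) ℕ.* centralBinomial n)           ≡⟨ ≡.cong (λ k → + k) (centralBinomial-suc n) ⟨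
      + (suc n ℕ.* centralBinomial (suc n))                     ≡⟨ ℤₚ.pos-* (suc n) (centralBinomial (suc n)) ⟩
      + suc n ℤ.* + centralBinomial (suc n)                     ∎)
      where open ≡.≡-Reasoning

    centralBinomial≡ : ∀ n → centralBinomial n ≡ ℤ.∣ c n ∣ ℕ.* suc n
    centralBinomial≡ n = ≡.trans (≡.cong ℤ.∣_∣ (≡.sym (c-closed n)))
      (≡.trans (ℤₚ.abs-* (+ suc n) (c n)) (ℕₚ.*-comm (suc n) ℤ.∣ c n ∣))

    -- `c-closed` makes the rounding division in `catalan` exact. The absolute value leads back to ℕ
    -- before `c n` is known to be non-negative; `c≡catalan` settles the sign by one more
    -- cancellation.
    catalan≡ : ∀ n → catalan n ≡ ℤ.∣ c n ∣
    catalan≡ n = ≡.trans (≡.cong (ℕ._/ suc n) (centralBinomial≡ n)) (m*n/n≡m ℤ.∣ c n ∣ (suc n))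

    c≡catalan : ∀ n → c n ≡ + catalan n
    c≡catalan n = ≡.trans
      (ℤₚ.*-cancelˡ-≡ (+ suc n) (c n) (+ ℤ.∣ c n ∣) (≡.trans (c-closed n)
        (≡.trans (≡.cong (λ k → + k) (≡.trans (centralBinomial≡ n) (ℕₚ.*-comm ℤ.∣ c n ∣ (suc n))))
          (ℤₚ.pos-* (suc n) ℤ.∣ c n ∣))))
      (≡.cong (λ k → + k) (≡.sym (catalan≡ n)))

  -- For `c` this is the coefficient of x^(n+1) in `c-quadratic`.
  catalan-convolution : ∀ n →
    + catalan (suc n) ≡ Z.∑ (suc n) (λ i → + catalan i ℤ.* + catalan (n ∸ i))
  catalan-convolution n = begin
    + catalan (suc n)                   ≡⟨ c≡catalan (suc n) ⟨
    c (suc n)                           ≡⟨ c-quadratic (suc n) ⟩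
    + 0 ℤ.+ (var * (c * c)) (suc n)     ≡⟨ ℤₚ.+-identityˡ _ ⟩
    (var * (c * c)) (suc n)             ≡⟨ var-*-suc (c * c) n ⟩
    (c * c) n                           ≡⟨ *-cong {c} {λ n → + catalan n} c≡catalan c≡catalan n ⟩
    Z.∑ (suc n) (λ i → + catalan i ℤ.* + catalan (n ∸ i)) ∎
    where open ≡.≡-Reasoning

module CatalanSeries {c ℓ} (R : CommutativeRing c ℓ) where
  private
    module K where
      open CommutativeRing R public
      open FiniteSums R public
      open IntegerSolver R public
      open RingNotation rawRing public using (ι)
  open PowerSeries R
  open CommutativeRing seriesRing
  open import Algebra.Properties.Semiring.Mult.TCOptimised K.semiring using (×ᵤ≈×)
  open Substitution R using (var-*-zero; var-*-suc)
  open Series K.rawRing using (var)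

  ι≈⟦⟧ : ∀ n → K.ι n K.≈ K.⟦ + n ⟧ℤ
  ι≈⟦⟧ n = ×ᵤ≈× n K.1#

  private
    ∑-homo : ∀ n (f : ℕ → ℤ) → K.⟦ FiniteSums.∑ ℤₚ.+-*-commutativeRing n f ⟧ℤ K.≈ K.∑ n (λ i → K.⟦ f i ⟧ℤ)
    ∑-homo zero    f = K.refl
    ∑-homo (suc n) f = K.trans (K.+-homo (f 0) _) (K.+-congˡ (∑-homo n (f ∘ suc)))

  ι-* : ∀ m n → K.ι (m ℕ.* n) K.≈ K.ι m K.* K.ι n
  ι-* m n = K.trans (ι≈⟦⟧ (m ℕ.* n)) (K.trans (K.reflexive (≡.cong K.⟦_⟧ℤ (ℤₚ.pos-* m n)))
    (K.trans (K.*-homo (+ m) (+ n)) (K.sym (K.*-cong (ι≈⟦⟧ m) (ι≈⟦⟧ n)))))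

  catalans : Carrier
  catalans n = K.ι (catalan n)

  -- The ring may have torsion, so the binomial formula is of no use inside it. The convolution is
  -- free of denominators and is transported along the homomorphism from ℤ.
  ι-catalan-suc : ∀ n → K.ι (catalan (suc n)) K.≈ K.∑ (suc n) (λ i → catalans i K.* catalans (n ∸ i))
  ι-catalan-suc n = begin
    K.ι (catalan (suc n))
      ≈⟨ ι≈⟦⟧ (catalan (suc n)) ⟩
    K.⟦ + catalan (suc n) ⟧ℤ
      ≡⟨ ≡.cong K.⟦_⟧ℤ (CatalanNumbers.catalan-convolution n) ⟩
    K.⟦ FiniteSums.∑ ℤₚ.+-*-commutativeRing (suc n) (λ i → + catalan i ℤ.* + catalan (n ∸ i)) ⟧ℤ
      ≈⟨ ∑-homo (suc n) (λ i → + catalan i ℤ.* + catalan (n ∸ i)) ⟩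
    K.∑ (suc n) (λ i → K.⟦ + catalan i ℤ.* + catalan (n ∸ i) ⟧ℤ)
      ≈⟨ K.∑-cong (suc n) (λ i → K.⟦ + catalan i ℤ.* + catalan (n ∸ i) ⟧ℤ)
           (λ i → catalans i K.* catalans (n ∸ i))
           (λ i _ → K.trans (K.*-homo (+ catalan i) (+ catalan (n ∸ i)))
             (K.sym (K.*-cong (ι≈⟦⟧ (catalan i)) (ι≈⟦⟧ (catalan (n ∸ i)))))) ⟩
    K.∑ (suc n) (λ i → catalans i K.* catalans (n ∸ i)) ∎
    where open SetoidReasoning K.setoid

  catalans-quadratic : catalans ≈ 1# + var * (catalans * catalans)
  catalans-quadratic zero = K.trans (K.+-identityʳ _) (K.sym
    (K.trans (K.+-congˡ (var-*-zero (catalans * catalans))) (K.+-identityʳ _)))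
  catalans-quadratic (suc n) = K.trans (ι-catalan-suc n) (K.sym
    (K.trans (K.+-identityˡ _) (var-*-suc (catalans * catalans) n)))

-- Removing an unrepeated initial 1

-- The smallest repeated letter 0 stands for the absence of a repetition.
bump : ℕ → ℕ
bump zero    = zero
bump (suc i) = suc (suc i)

private
  first-map-suc : ∀ {P P′ : ℕ → Set} (P? : Decidable P) (P′? : Decidable P′) js → All (1 ≤_) js →
    (∀ j → 1 ≤ j → does (P? (suc j)) ≡ does (P′? j)) →
    fromMaybe 0 (head (filter P? (map suc js))) ≡ bump (fromMaybe 0 (head (filter P′? js)))
  first-map-suc P? P′? []           _           P≡P′ = ≡.refl
  first-map-suc P? P′? (suc j ∷ js) (1≤j ∷ 1≤js) P≡P′
    with does (P? (suc (suc j))) | does (P′? (suc j)) | P≡P′ (suc j) 1≤j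
  ... | true  | true  | _ = ≡.refl
  ... | false | false | _ = first-map-suc P? P′? js 1≤js P≡P′

  occurrences-map-suc : ∀ j w → occurrences (suc j) (map suc w) ≡ occurrences j w
  occurrences-map-suc j []      = ≡.refl
  occurrences-map-suc j (x ∷ w) with does (j ≟ x)
  ... | true  = ≡.cong suc (occurrences-map-suc j w)
  ... | false = occurrences-map-suc j w

rep-1∷ : ∀ w → 1 ∈ w → rep (1 ∷ w) ≡ 1
rep-1∷ w 1∈w = ≡.cong (λ js → fromMaybe 0 (head js))
  (Listₚ.filter-accept (λ j → 2 ≤? occurrences j (1 ∷ w)) {xs = applyUpTo (suc ∘ suc) (length w)}
    (s≤s (Listₚ.filter-some (1 ≟_) 1∈w)))

-- `rep` tests 1, 2, ... in turn. The test fails at 1, which occurs once, and the remaining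
-- candidates and their counts are those of `w` moved up by one.
rep-1∷map-suc : ∀ w → All (1 ≤_) w → rep (1 ∷ map suc w) ≡ bump (rep w)
rep-1∷map-suc w 1≤w = ≡.trans
  (≡.cong (λ js → fromMaybe 0 (head js))
    (Listₚ.filter-reject P? {x = 1} {xs = applyUpTo (suc ∘ suc) (length (map suc w))} once))
  (≡.trans (≡.cong (λ js → fromMaybe 0 (head (filter P? js))) shifted)
    (first-map-suc P? (λ j → 2 ≤? occurrences j w) (ascending (length w))
      (Allₚ.applyUpTo⁺₂ suc (length w) (λ _ → s≤s z≤n))
      (λ { (suc j) _ → ≡.cong (λ k → does (2 ≤? k)) (occurrences-map-suc (suc j) w) })))
  where
  P? : ∀ j → Dec (2 ≤ occurrences j (1 ∷ map suc w))
  P? j = 2 ≤? occurrences j (1 ∷ map suc w)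

  once : ¬ 2 ≤ occurrences 1 (1 ∷ map suc w)
  once 2≤ = contradiction
    (≡.subst (λ l → 1 ≤ length l)
      (Listₚ.filter-none (1 ≟_) (Allₚ.map⁺ (All.map (λ { (s≤s _) () }) 1≤w))) (ℕₚ.≤-pred 2≤))
    λ ()

  shifted : applyUpTo (suc ∘ suc) (length (map suc w)) ≡ map suc (ascending (length w))
  shifted = ≡.trans (≡.cong (applyUpTo (suc ∘ suc)) (Listₚ.length-map suc w))
    (≡.sym (Listₚ.map-applyUpTo suc suc (length w)))

module SmallestRepeatedLetter {c ℓ} (R : CommutativeRing c ℓ) (q v : CommutativeRing.Carrier R)
  (a′ m′ : ℕ) where
  open CommutativeRing R
  open RingNotation rawRing using (sumOver; _^_)
  open GeneratingFunctions rawRing q v (suc (suc a′)) (suc (suc m′)) using (A; aᵢ⁽_⁾)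
  open WordSums R
  open Subword a′ m′
  open RunWeights R q a′ m′
  open IntegerSolver R

  private
    φ : ℕ → Word → Carrier
    φ l π = q ^ μ⁽ l ⁾ τ π

    -- The initial 1, shifted by `l`, joins the prefix as its letter l + 1.
    φ-∷ : ∀ l w → φ l (1 ∷ map suc w) ≡ φ (suc l) w
    φ-∷ l w = ≡.cong (λ σ → q ^ μ τ σ) (≡.sym (≡.trans
      (≡.cong (_++ map (ℕ._+ suc l) w) (ascending-∷ʳ l))
      (≡.trans (Listₚ.++-assoc (ascending l) (suc l ∷ []) (map (ℕ._+ suc l) w))
        (≡.cong (λ t → ascending l ++ suc l ∷ t) (≡.trans
          (Listₚ.map-cong (λ x → ℕₚ.+-suc x l) w) (Listₚ.map-∘ w))))))

    φ-[] : ∀ l → φ l [] ≈ 1#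
    φ-[] zero    = refl
    φ-[] (suc l) = reflexive (≡.trans
      (≡.cong (λ σ → q ^ μ τ σ) (≡.trans (Listₚ.++-identityʳ (ascending (suc l))) (ascending-∷ʳ l)))
      (≡.cong (q ^_) (≡.trans (μ-run-end (ascending l) (suc l) 0 (AscendsTo-ascending l))
        (ω-zero (length (ascending l))))))

    sum-NC-∷ : ∀ n (f g : Word → Carrier) → (∀ w → 1 ∈ w → f (1 ∷ w) ≈ 0#) →
      (∀ w → All (1 ≤_) w → f (1 ∷ map suc w) ≈ g w) →
      sumOver (NC (suc n)) f ≈ sumOver (NC n) g
    sum-NC-∷ n f g f≈0 f≈g = begin
      sumOver (NC (suc n)) f                             ≈⟨ sum-NC (suc n) f ⟩
      sumContinuations (1 ∷ []) 1 n (f ∘ (1 ∷_)) + 0#    ≈⟨ +-identityʳ _ ⟩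
      sumContinuations (1 ∷ []) 1 n (f ∘ (1 ∷_))         ≈⟨ sumContinuations-avoiding-1 n [] 0 f≈0 ⟩
      sumContinuations [] 0 n (f ∘ (1 ∷_) ∘ map suc)     ≈⟨ sumContinuations-cong n [] f≈g ⟩
      sumContinuations [] 0 n g                          ≈⟨ sum-NC n g ⟨
      sumOver (NC n) g                                   ∎
      where open SetoidReasoning setoid

    [_]·_ : Bool → Carrier → Carrier
    [ b ]· x = if b then x else 0#

    [false] : ∀ {b} x → b ≡ false → [ b ]· x ≈ 0#
    [false] x ≡.refl = refl

    [true] : ∀ {b} x → b ≡ true → [ b ]· x ≈ x
    [true] x ≡.refl = refl

    [not] : ∀ b x → x ≈ [ b ]· x + [ not b ]· x
    [not] true  x = sym (+-identityʳ x)
    [not] false x = sym (+-identityˡ x)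

    aᵢ≈ : ∀ l n i → aᵢ⁽ l ⁾ n i ≈ sumOver (NC n) (λ π → [ does (rep π ≟ i) ]· φ l π)
    aᵢ≈ l n i = sumOver-filter (λ π → rep π ≟ i) (NC n) (φ l)

    bump≢1 : ∀ r → does (bump r ≟ 1) ≡ false
    bump≢1 zero    = ≡.refl
    bump≢1 (suc r) = ≡.refl

    sum-NC-A : ∀ l n → sumOver (NC n) (φ l) ≈ A l n
    sum-NC-A l zero    = trans (+-identityʳ _) (φ-[] l)
    sum-NC-A l (suc n) = refl

    once : ∀ f n → sumOver (NC (suc n)) f ≈
      sumOver (NC (suc n)) (λ π → [ does (rep π ≟ 1) ]· f π) +
      sumOver (NC (suc n)) (λ π → [ not (does (rep π ≟ 1)) ]· f π)
    once f n = trans (sumOver-cong (NC (suc n)) (λ π → [not] (does (rep π ≟ 1)) (f π)))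
      (sumOver-+ (NC (suc n)) _ _)

    drop-singleton-1 : ∀ n (f g : Word → Carrier) →
      (∀ w → All (1 ≤_) w → f (1 ∷ map suc w) ≈ g w) →
      sumOver (NC (suc n)) (λ π → [ not (does (rep π ≟ 1)) ]· f π) ≈ sumOver (NC n) g
    drop-singleton-1 n f g f≈g = sum-NC-∷ n _ g
      (λ w 1∈w → [false] (f (1 ∷ w)) (≡.cong (λ r → not (does (r ≟ 1))) (rep-1∷ w 1∈w)))
      (λ w 1≤w → trans
        ([true] (f (1 ∷ map suc w)) (≡.trans (≡.cong (λ r → not (does (r ≟ 1))) (rep-1∷map-suc w 1≤w))
          (≡.cong not (bump≢1 (rep w)))))
        (f≈g w 1≤w))

  aᵢ-1 : ∀ l n → A l (suc n) ≈ aᵢ⁽ l ⁾ (suc n) 1 + A (suc l) n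
  aᵢ-1 l n = trans (once (φ l) n) (+-cong (sym (aᵢ≈ l (suc n) 1))
    (trans (drop-singleton-1 n (φ l) (φ (suc l)) (λ w _ → reflexive (φ-∷ l w)))
      (sum-NC-A (suc l) n)))

  private
    -- Here `j` plays the part of `bump i`; the Boolean hypotheses cover the genuine letters as well
    -- as the marker 0.
    aᵢ-bump : ∀ l n i j → (∀ r → does (bump r ≟ j) ≡ does (r ≟ i)) → does (1 ≟ j) ≡ false →
              aᵢ⁽ l ⁾ (suc n) j ≈ aᵢ⁽ suc l ⁾ n i
    aᵢ-bump l n i j bump≡ 1≢j = begin
      aᵢ⁽ l ⁾ (suc n) j
        ≈⟨ aᵢ≈ l (suc n) j ⟩
      sumOver (NC (suc n)) (λ π → [ does (rep π ≟ j) ]· φ l π)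
        ≈⟨ sum-NC-∷ n _ _
             (λ w 1∈w → [false] (φ l (1 ∷ w)) (≡.trans (≡.cong (λ r → does (r ≟ j)) (rep-1∷ w 1∈w)) 1≢j))
             (λ w 1≤w → reflexive (≡.cong₂ [_]·_
               (≡.trans (≡.cong (λ r → does (r ≟ j)) (rep-1∷map-suc w 1≤w)) (bump≡ (rep w)))
               (φ-∷ l w))) ⟩
      sumOver (NC n) (λ π → [ does (rep π ≟ i) ]· φ (suc l) π)
        ≈⟨ aᵢ≈ (suc l) n i ⟨
      aᵢ⁽ suc l ⁾ n i ∎
      where open SetoidReasoning setoid

  aᵢ-suc : ∀ l n i → aᵢ⁽ l ⁾ (suc n) (2 ℕ.+ i) ≈ aᵢ⁽ suc l ⁾ n (suc i)
  aᵢ-suc l n i = aᵢ-bump l n (suc i) (2 ℕ.+ i) (λ { zero → ≡.refl ; (suc r) → ≡.refl }) ≡.refl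

  aᵢ-0 : ∀ l n → aᵢ⁽ l ⁾ n 0 ≈ 1#
  aᵢ-0 l zero    = trans (+-identityʳ _) (φ-[] l)
  aᵢ-0 l (suc n) = trans
    (aᵢ-bump l n 0 0 (λ { zero → ≡.refl ; (suc r) → ≡.refl }) ≡.refl) (aᵢ-0 (suc l) n)

  joint : ℕ → ℕ → Carrier
  joint l n = sumOver (NC n) (λ π → v ^ rep π * φ l π)

  joint-zero : ∀ l → joint l 0 ≈ 1#
  joint-zero l = trans (+-identityʳ _) (trans (*-identityˡ _) (φ-[] l))

  -- Passing from π to 1(π+1) multiplies v^rep by v, except that the exponent 0 stays 0. The term
  -- with `1# - v` corrects this for the one word of length n without a repetition.
  joint-suc : ∀ l n → joint l (suc n) ≈ v * aᵢ⁽ l ⁾ (suc n) 1 + (v * joint (suc l) n + (1# - v) * 1#)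
  joint-suc l n = trans (once (λ π → v ^ rep π * φ l π) n) (+-cong
    (trans (sumOver-cong (NC (suc n)) (λ π → first (rep π) (φ l π)))
      (trans (sumOver-*ˡ (NC (suc n)) v _) (*-congˡ (sym (aᵢ≈ l (suc n) 1)))))
    (trans (drop-singleton-1 n (λ π → v ^ rep π * φ l π)
             (λ w → v * (v ^ rep w * φ (suc l) w) + (1# - v) * [ does (rep w ≟ 0) ]· φ (suc l) w)
             later)
      (trans (sumOver-+ (NC n) _ _) (+-cong (sumOver-*ˡ (NC n) v _)
        (trans (sumOver-*ˡ (NC n) (1# - v) _)
          (*-congˡ (trans (sym (aᵢ≈ (suc l) n 0)) (aᵢ-0 (suc l) n))))))))
    where
    first : ∀ r x → [ does (r ≟ 1) ]· (v ^ r * x) ≈ v * [ does (r ≟ 1) ]· x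
    first zero          x = sym (zeroʳ v)
    first (suc zero)    x = *-congʳ (*-identityʳ v)
    first (suc (suc r)) x = sym (zeroʳ v)

    v^bump : ∀ r x → v ^ bump r * x ≈ v * (v ^ r * x) + (1# - v) * [ does (r ≟ 0) ]· x
    v^bump zero    x = solve 2 (λ v x → con (+ 1) :* x :=
      v :* (con (+ 1) :* x) :+ (con (+ 1) :- v) :* x) refl v x
    v^bump (suc r) x = trans (*-assoc v (v ^ suc r) x)
      (sym (trans (+-congˡ (zeroʳ (1# - v))) (+-identityʳ _)))

    later : ∀ w → All (1 ≤_) w → v ^ rep (1 ∷ map suc w) * φ l (1 ∷ map suc w) ≈
      v * (v ^ rep w * φ (suc l) w) + (1# - v) * [ does (rep w ≟ 0) ]· φ (suc l) w
    later w 1≤w = trans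
      (reflexive (≡.cong₂ (λ r x → v ^ r * x) (rep-1∷map-suc w 1≤w) (φ-∷ l w)))
      (v^bump (rep w) (φ (suc l) w))

-- Ring identities behind the closed forms, used for series in x and in x, u

module ClosedFormAlgebra {c ℓ} (R : CommutativeRing c ℓ) where
  open CommutativeRing R
  open IntegerSolver R
  open RingNotation rawRing using (_^_)
  open SetoidReasoning setoid

  private
    -- The identities below hold modulo e - 1 for suitable e ≈ 1, and k is the
    -- explicit multiplier.
    absorb : ∀ r k e → e ≈ 1# → r + k * (e - 1#) ≈ r
    absorb r k e e≈1 = trans (+-congˡ (trans (*-congˡ (trans (+-congʳ e≈1) (-‿inverseʳ 1#))) (zeroʳ k)))
      (+-identityʳ r)

  inverse-unique : ∀ g i j → (1# - g) * i ≈ 1# → (1# - g) * j ≈ 1# → i ≈ j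
  inverse-unique g i j gi≈1 gj≈1 = begin
    i                    ≈⟨ absorb i i ((1# - g) * j) gj≈1 ⟨
    i + i * ((1# - g) * j - 1#)
      ≈⟨ solve 3 (λ g i j → i :+ i :* ((con (+ 1) :- g) :* j :- con (+ 1)) :=
           j :+ j :* ((con (+ 1) :- g) :* i :- con (+ 1))) refl g i j ⟩
    j + j * ((1# - g) * i - 1#)  ≈⟨ absorb j j ((1# - g) * i) gi≈1 ⟩
    j                    ∎

  -- The letters `p` and `pₐ` are the Catalan polynomials of degrees a - 2 and a - 1, `k` is
  -- C_{a-1}, `s` is x^(a-1) and `d` the double sum in M. The relation between `d` and the
  -- polynomials makes all Catalan numbers cancel.
  bracket : ∀ x i i′ d p k s pₐ → (1# - x) * i ≈ 1# → i′ ≈ i → pₐ ≈ p + k * s →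
    x * d ≈ pₐ - 1# - x * p → x * s * k * i - x * i′ * d + pₐ ≈ i
  bracket x i i′ d p k s pₐ inv i′≈i pₐ≈ d≈ = begin
    x * s * k * i - x * i′ * d + pₐ
      ≈⟨ solve 7 (λ x i i′ d k s pₐ → x :* s :* k :* i :- x :* i′ :* d :+ pₐ :=
           x :* s :* k :* i :- i′ :* (x :* d) :+ pₐ) refl x i i′ d k s pₐ ⟩
    x * s * k * i - i′ * (x * d) + pₐ
      ≈⟨ +-cong (+-congˡ (-‿cong (*-cong i′≈i (trans d≈ (+-congʳ (+-congʳ pₐ≈)))))) pₐ≈ ⟩
    x * s * k * i - i * (p + k * s - 1# - x * p) + (p + k * s)
      ≈⟨ solve 5 (λ x i p k s →
           x :* s :* k :* i :- i :* (p :+ k :* s :- con (+ 1) :- x :* p) :+ (p :+ k :* s) :=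
           i :+ (:- (p :+ k :* s)) :* ((con (+ 1) :- x) :* i :- con (+ 1))) refl x i p k s ⟩
    i + (- (p + k * s)) * ((1# - x) * i - 1#)
      ≈⟨ absorb i (- (p + k * s)) ((1# - x) * i) inv ⟩
    i ∎

  -- The sum `r` starts at C₂x², so it equals pₐ - 1 - x, and `D` is the double sum over n and j in
  -- closed form. Together the three extra terms of the statement are the omitted words v h / (1 -
  -- vx), with h = x d.
  joint-remainder : ∀ w x i d p k s r D → (1# - w * x) * i ≈ 1# →
    x * d ≈ (p + k * s) - 1# - x * p →
    p + k * s ≈ (1# + 0#) * 1# + ((1# + 0#) * (x * 1#) + r) → D ≈ w * x * (p - 1#) * i →
    w * (x * d * i) ≈ (w ^ 2 * (x * s) * k - w ^ 2 * x ^ 2) * i + w * r + (w - 1#) * D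
  joint-remainder w x i d p k s r D inv d≈ pₐ≈ D≈ = sym (begin
    (w ^ 2 * (x * s) * k - w ^ 2 * x ^ 2) * i + w * r + (w - 1#) * D
      ≈⟨ +-congˡ (*-congˡ D≈) ⟩
    (w ^ 2 * (x * s) * k - w ^ 2 * x ^ 2) * i + w * r + (w - 1#) * (w * x * (p - 1#) * i)
      ≈⟨ +-congʳ (+-congˡ (*-congˡ r≈)) ⟩
    (w ^ 2 * (x * s) * k - w ^ 2 * x ^ 2) * i + w * (p + k * s - 1# - x) +
      (w - 1#) * (w * x * (p - 1#) * i)
      ≈⟨ solve 6 (λ w x i p k s →
           (w :^ 2 :* (x :* s) :* k :- w :^ 2 :* x :^ 2) :* i :+ w :* (p :+ k :* s :- con (+ 1) :- x) :+
             (w :- con (+ 1)) :* (w :* x :* (p :- con (+ 1)) :* i) :=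
           w :* ((p :+ k :* s :- con (+ 1) :- x :* p) :* i) :+
             (:- (w :* (p :+ k :* s :- con (+ 1) :- x))) :* ((con (+ 1) :- w :* x) :* i :- con (+ 1)))
           refl w x i p k s ⟩
    w * ((p + k * s - 1# - x * p) * i) +
      (- (w * (p + k * s - 1# - x))) * ((1# - w * x) * i - 1#)
      ≈⟨ absorb _ _ ((1# - w * x) * i) inv ⟩
    w * ((p + k * s - 1# - x * p) * i)
      ≈⟨ *-congˡ (*-congʳ d≈) ⟨
    w * (x * d * i) ∎)
    where
    r≈ : r ≈ p + k * s - 1# - x
    r≈ = sym (trans (+-congʳ (+-congʳ pₐ≈)) (solve 2 (λ x r →
      (con (+ 1) :+ con (+ 0)) :* con (+ 1) :+ ((con (+ 1) :+ con (+ 0)) :* (x :* con (+ 1)) :+ r)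
        :- con (+ 1) :- x := r) refl x r))

  -- `B` is the sum of H_l (vx)ˡ, evaluated once as A(x,0,v) plus the omitted words and once by the
  -- functional equation. The shifted series `S` is known only through w x S = α - y, hence the
  -- factor `w`.
  smallest-letter : ∀ w x i y t s p₁ p₂ d B S α A₃ → B ≈ A₃ + x * d * i →
    B ≈ x * (y - 1#) * S + t * s * (y - 1#) * (p₁ * p₂ * i) → α ≈ y + w * x * S →
    w * A₃ ≈ (y - 1#) * (α - y) - w * (x * i * d) + w * (t * p₁ * (s * p₂) * (y - 1#) * i)
  smallest-letter w x i y t s p₁ p₂ d B S α A₃ B≈₁ B≈₂ α≈ = begin
    w * A₃
      ≈⟨ solve 3 (λ w A₃ h → w :* A₃ := w :* (A₃ :+ h) :- w :* h) refl w A₃ (x * d * i) ⟩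
    w * (A₃ + x * d * i) - w * (x * d * i)
      ≈⟨ +-congʳ (*-congˡ (trans (sym B≈₁) B≈₂)) ⟩
    w * (x * (y - 1#) * S + t * s * (y - 1#) * (p₁ * p₂ * i)) - w * (x * d * i)
      ≈⟨ solve 10 (λ w x i y t s p₁ p₂ d S →
           w :* (x :* (y :- con (+ 1)) :* S :+ t :* s :* (y :- con (+ 1)) :* (p₁ :* p₂ :* i)) :-
             w :* (x :* d :* i) :=
           (y :- con (+ 1)) :* (y :+ w :* x :* S :- y) :- w :* (x :* i :* d) :+
             w :* (t :* p₁ :* (s :* p₂) :* (y :- con (+ 1)) :* i)) refl w x i y t s p₁ p₂ d S ⟩
    (y - 1#) * (y + w * x * S - y) - w * (x * i * d) + w * (t * p₁ * (s * p₂) * (y - 1#) * i)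
      ≈⟨ +-congʳ (+-congʳ (*-congˡ (+-congʳ α≈))) ⟨
    (y - 1#) * (α - y) - w * (x * i * d) + w * (t * p₁ * (s * p₂) * (y - 1#) * i) ∎

  -- At u = x both equations contain `S` only as x S; eliminating it leaves the factor y - 1.
  diagonal : ∀ x i y T p S α → α ≈ 1# * i + x * y * S + T * (p * i) → α ≈ y + x * S →
    (y - 1#) * α ≈ y * y - i - T * p * i
  diagonal x i y T p S α α≈₁ α≈₂ = begin
    (y - 1#) * α
      ≈⟨ solve 2 (λ y α → (y :- con (+ 1)) :* α := y :* α :- α) refl y α ⟩
    y * α - α
      ≈⟨ +-cong (*-congˡ α≈₂) (-‿cong α≈₁) ⟩
    y * (y + x * S) - (1# * i + x * y * S + T * (p * i))
      ≈⟨ solve 6 (λ x i y T p S →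
           y :* (y :+ x :* S) :- (con (+ 1) :* i :+ x :* y :* S :+ T :* (p :* i)) :=
           y :* y :- i :- T :* p :* i) refl x i y T p S ⟩
    y * y - i - T * p * i ∎

  -- Inserting the closed form for one factor of y * y brings out y - 1: the part without `t` is y j
  -- - i = (y - 1) i j.
  diagonal-closed : ∀ x y t s i j p₁ p₂ → (1# - x) * i ≈ 1# → (1# - x * y) * j ≈ 1# →
    y ≈ 1# * j + t * (x * s) * (y - 1#) * (p₂ * j) →
    (y - 1#) * (t * s * (x * y * p₂ * (1# - x) - x * p₁ * (1# - x * y)) * i * j + i * j) ≈
    y * y - i - t * (x * s) * (y - 1#) * p₁ * i
  diagonal-closed x y t s i j p₁ p₂ inv₁ inv₂ y≈ = sym (begin
    y * y - i - t * (x * s) * (y - 1#) * p₁ * i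
      ≈⟨ +-congʳ (+-congʳ (*-congˡ y≈)) ⟩
    y * (1# * j + t * (x * s) * (y - 1#) * (p₂ * j)) - i - t * (x * s) * (y - 1#) * p₁ * i
      ≈⟨ absorb _ _ _ inv₂ ⟨
    y * (1# * j + t * (x * s) * (y - 1#) * (p₂ * j)) - i - t * (x * s) * (y - 1#) * p₁ * i
      + (- (i + t * (x * s) * (y - 1#) * p₁ * i)) * ((1# - x * y) * j - 1#)
      ≈⟨ absorb _ _ _ inv₁ ⟨
    y * (1# * j + t * (x * s) * (y - 1#) * (p₂ * j)) - i - t * (x * s) * (y - 1#) * p₁ * i
      + (- (i + t * (x * s) * (y - 1#) * p₁ * i)) * ((1# - x * y) * j - 1#)
      + (y * j + y * t * (x * s) * (y - 1#) * p₂ * j) * ((1# - x) * i - 1#)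
      ≈⟨ solve 8 (λ x y t s i j p₁ p₂ →
           y :* (con (+ 1) :* j :+ t :* (x :* s) :* (y :- con (+ 1)) :* (p₂ :* j)) :- i :-
             t :* (x :* s) :* (y :- con (+ 1)) :* p₁ :* i :+
             (:- (i :+ t :* (x :* s) :* (y :- con (+ 1)) :* p₁ :* i)) :*
               ((con (+ 1) :- x :* y) :* j :- con (+ 1)) :+
             (y :* j :+ y :* t :* (x :* s) :* (y :- con (+ 1)) :* p₂ :* j) :*
               ((con (+ 1) :- x) :* i :- con (+ 1)) :=
           (y :- con (+ 1)) :* (t :* s :*
             (x :* y :* p₂ :* (con (+ 1) :- x) :- x :* p₁ :* (con (+ 1) :- x :* y)) :* i :* j :+ i :* j))
           refl x y t s i j p₁ p₂ ⟩
    (y - 1#) * (t * s * (x * y * p₂ * (1# - x) - x * p₁ * (1# - x * y)) * i * j + i * j) ∎)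

  -- u is the second variable, and Z stands for x(y-1)A(x,x).
  bivariate : ∀ x u y t i j p₁ p₂ α B Z → (1# - x) * i ≈ 1# → (1# - u) * j ≈ 1# →
    α ≈ j + x * y * B + (- t) * (y - 1#) * (p₂ * j) → α ≈ y + u * B →
    Z ≈ x * (y * y - i) + x * (t * (y - 1#) * p₁ * i) →
    (x * y - u) * α ≈ (x - u) * (i * j) +
      t * (u * p₂ * (1# - x) - x * p₁ * (1# - u)) * (y - 1#) * j * i + Z
  bivariate x u y t i j p₁ p₂ α B Z inv₁ inv₂ α≈₁ α≈₂ Z≈ = begin
    (x * y - u) * α
      ≈⟨ solve 4 (λ x u y α → (x :* y :- u) :* α := x :* y :* α :- u :* α) refl x u y α ⟩
    x * y * α - u * α
      ≈⟨ +-cong (*-congˡ α≈₂) (-‿cong (*-congˡ α≈₁)) ⟩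
    x * y * (y + u * B) - u * (j + x * y * B + (- t) * (y - 1#) * (p₂ * j))
      ≈⟨ absorb _ _ _ inv₁ ⟨
    x * y * (y + u * B) - u * (j + x * y * B + (- t) * (y - 1#) * (p₂ * j))
      + (1# - j + t * (y - 1#) * (u * p₂) * j) * ((1# - x) * i - 1#)
      ≈⟨ absorb _ _ _ inv₂ ⟨
    x * y * (y + u * B) - u * (j + x * y * B + (- t) * (y - 1#) * (p₂ * j))
      + (1# - j + t * (y - 1#) * (u * p₂) * j) * ((1# - x) * i - 1#)
      + (i - 1# - t * (y - 1#) * (x * p₁) * i) * ((1# - u) * j - 1#)
      ≈⟨ solve 9 (λ x u y t i j p₁ p₂ B →
           x :* y :* (y :+ u :* B) :- u :* (j :+ x :* y :* B :+ (:- t) :* (y :- con (+ 1)) :* (p₂ :* j)) :+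
             (con (+ 1) :- j :+ t :* (y :- con (+ 1)) :* (u :* p₂) :* j) :* ((con (+ 1) :- x) :* i :- con (+ 1)) :+
             (i :- con (+ 1) :- t :* (y :- con (+ 1)) :* (x :* p₁) :* i) :* ((con (+ 1) :- u) :* j :- con (+ 1)) :=
           (x :- u) :* (i :* j) :+
             t :* (u :* p₂ :* (con (+ 1) :- x) :- x :* p₁ :* (con (+ 1) :- u)) :* (y :- con (+ 1)) :* j :* i :+
             (x :* (y :* y :- i) :+ x :* (t :* (y :- con (+ 1)) :* p₁ :* i)))
           refl x u y t i j p₁ p₂ B ⟩
    (x - u) * (i * j) + t * (u * p₂ * (1# - x) - x * p₁ * (1# - u)) * (y - 1#) * j * i +
      (x * (y * y - i) + x * (t * (y - 1#) * p₁ * i))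
      ≈⟨ +-congˡ Z≈ ⟨
    (x - u) * (i * j) + t * (u * p₂ * (1# - x) - x * p₁ * (1# - u)) * (y - 1#) * j * i + Z ∎

  last-term : ∀ s t → s + t * (1# + 0#) - t ≈ s
  last-term = solve 2 (λ s t → s :+ t :* (con (+ 1) :+ con (+ 0)) :- t := s) refl

  convolution-base : ∀ x → x * 0# ≈
    (1# + 0#) * 1# + ((1# + 0#) * (x * 1#) + 0#) - 1# - x * ((1# + 0#) * 1# + 0#)
  convolution-base = solve 1 (λ x → x :* con (+ 0) :=
    (con (+ 1) :+ con (+ 0)) :* con (+ 1) :+ ((con (+ 1) :+ con (+ 0)) :* (x :* con (+ 1)) :+ con (+ 0))
      :- con (+ 1) :- x :* ((con (+ 1) :+ con (+ 0)) :* con (+ 1) :+ con (+ 0))) refl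

  convolution-step : ∀ x p p′ s k k′ →
    (p - 1# - x * p′) + x * ((k - k′) * s) ≈ (p + k * (x * s)) - 1# - x * (p′ + k′ * s)
  convolution-step = solve 6 (λ x p p′ s k k′ →
    (p :- con (+ 1) :- x :* p′) :+ x :* ((k :- k′) :* s) :=
    (p :+ k :* (x :* s)) :- con (+ 1) :- x :* (p′ :+ k′ :* s)) refl

  -- A series w with constant coefficient 1 is inverted by the geometric series of 1 - w, whence the
  -- shape of the hypothesis.
  unit-cancel : ∀ w j f g → (1# - (1# - w)) * j ≈ 1# → w * f ≈ w * g → f ≈ g
  unit-cancel w j f g inv e = begin
    f                              ≈⟨ absorb f f _ inv ⟨
    f + f * ((1# - (1# - w)) * j - 1#)
      ≈⟨ solve 3 (λ w j f → f :+ f :* ((con (+ 1) :- (con (+ 1) :- w)) :* j :- con (+ 1)) :=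
           j :* (w :* f)) refl w j f ⟩
    j * (w * f)                    ≈⟨ *-congˡ e ⟩
    j * (w * g)
      ≈⟨ solve 3 (λ w j f → f :+ f :* ((con (+ 1) :- (con (+ 1) :- w)) :* j :- con (+ 1)) :=
           j :* (w :* f)) refl w j g ⟨
    g + g * ((1# - (1# - w)) * j - 1#)  ≈⟨ absorb g g _ inv ⟩
    g                              ∎

  excess⇒product : ∀ x y w → y ≈ 1# + x * w → y - 1# ≈ x * w
  excess⇒product x y w y≈ = trans (+-congʳ y≈)
    (solve 1 (λ t → con (+ 1) :+ t :- con (+ 1) := t) refl (x * w))

  first-letter : ∀ x y α α′ H T → α ≈ 1# + x * y * α′ + T → α ≈ 1# + H + x * α′ →
    H ≈ x * (y - 1#) * α′ + T
  first-letter x y α α′ H T α≈₁ α≈₂ = begin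
    H
      ≈⟨ solve 3 (λ x α′ H → H := con (+ 1) :+ H :+ x :* α′ :- con (+ 1) :- x :* α′) refl x α′ H ⟩
    1# + H + x * α′ - 1# - x * α′
      ≈⟨ +-congʳ (+-congʳ (trans (sym α≈₂) α≈₁)) ⟩
    1# + x * y * α′ + T - 1# - x * α′
      ≈⟨ solve 4 (λ x y α′ T → con (+ 1) :+ x :* y :* α′ :+ T :- con (+ 1) :- x :* α′ :=
           x :* (y :- con (+ 1)) :* α′ :+ T) refl x y α′ T ⟩
    x * (y - 1#) * α′ + T ∎

  solve-first-letter : ∀ x α α′ H → α ≈ 1# + H + x * α′ → H ≈ α - 1# - x * α′
  solve-first-letter x α α′ H α≈ = sym (trans (+-congʳ (+-congʳ α≈))
    (solve 2 (λ H t → con (+ 1) :+ H :+ t :- con (+ 1) :- t := H) refl H (x * α′)))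

  split-excess : ∀ H h → H ≈ (H - h) + h
  split-excess = solve 2 (λ H h → H := (H :- h) :+ h) refl

  joint-step : ∀ w x H J i → i ≈ 1# + x * i →
    (1# + w * H + x * (w * J + (1# - w) * i)) - i ≈ w * H + w * x * (J - i)
  joint-step w x H J i i≈ = begin
    (1# + w * H + x * (w * J + (1# - w) * i)) - i
      ≈⟨ +-congˡ (-‿cong i≈) ⟩
    (1# + w * H + x * (w * J + (1# - w) * i)) - (1# + x * i)
      ≈⟨ solve 5 (λ w x H J i → (con (+ 1) :+ w :* H :+ x :* (w :* J :+ (con (+ 1) :- w) :* i)) :-
           (con (+ 1) :+ x :* i) := w :* H :+ w :* x :* (J :- i)) refl w x H J i ⟩
    w * H + w * x * (J - i) ∎

  correction-vanishes : ∀ t s w k x → t * s * (x * w) * k ≈ t * w * k * (x * s)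
  correction-vanishes = solve 5 (λ t s w k x → t :* s :* (x :* w) :* k := t :* w :* k :* (x :* s)) refl

  joint-rearrange : ∀ w A h i → w * (A + h) + i ≈ w * A + i + w * h
  joint-rearrange = solve 4 (λ w A h i → w :* (A :+ h) :+ i := w :* A :+ i :+ w :* h) refl

  annihilate : ∀ b w x i → b + w * (x * 0# * i) ≈ b
  annihilate = solve 4 (λ b w x i → b :+ w :* (x :* con (+ 0) :* i) := b) refl

  regroup : ∀ b k l n → b + (k + l + n) ≈ b + k + l + n
  regroup = solve 4 (λ b k l n → b :+ (k :+ l :+ n) := b :+ k :+ l :+ n) refl

  distribute : ∀ f k d p j → f + (k - d + p) * j ≈ f - d * j + k * j + p * j
  distribute = solve 5 (λ f k d p j →
    f :+ (k :- d :+ p) :* j := f :- d :* j :+ k :* j :+ p :* j) refl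

  negate-correction : ∀ q s e → (q - 1#) * s * e ≈ (- ((1# - q) * s)) * e
  negate-correction = solve 3 (λ q s e →
    (q :- con (+ 1)) :* s :* e := (:- ((con (+ 1) :- q) :* s)) :* e) refl

  factor-geometric : ∀ j k d p → k * j - j * d + j * p ≈ (k - d + p) * j
  factor-geometric = solve 4 (λ j k d p → k :* j :- j :* d :+ j :* p := (k :- d :+ p) :* j) refl

  scale-diagonal : ∀ x y q s i p α → (y - 1#) * α ≈ y * y - i - (q - 1#) * s * (y - 1#) * p * i →
    x * (y - 1#) * α ≈ x * (y * y - i) + x * ((1# - q) * s * (y - 1#) * p * i)
  scale-diagonal x y q s i p α e = begin
    x * (y - 1#) * α      ≈⟨ *-assoc x (y - 1#) α ⟩
    x * ((y - 1#) * α)    ≈⟨ *-congˡ e ⟩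
    x * (y * y - i - (q - 1#) * s * (y - 1#) * p * i)
      ≈⟨ solve 6 (λ x y q s i p →
           x :* (y :* y :- i :- (q :- con (+ 1)) :* s :* (y :- con (+ 1)) :* p :* i) :=
           x :* (y :* y :- i) :+ x :* ((con (+ 1) :- q) :* s :* (y :- con (+ 1)) :* p :* i)) refl x y q s i p ⟩
    x * (y * y - i) + x * ((1# - q) * s * (y - 1#) * p * i) ∎

-- Catalan polynomials and the double sum in M

module CatalanPolynomials {c ℓ} (R : CommutativeRing c ℓ) where
  private
    module K where
      open CommutativeRing R public
      open RingNotation rawRing public using (ι)
  open PowerSeries R
  open CommutativeRing seriesRing
  open RingNotation rawRing using (ι; _^_)
  open Series K.rawRing using (const) renaming (var to X)
  open Substitution R
  open FiniteSums seriesRing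
  open ClosedFormAlgebra seriesRing
  open import Algebra.Properties.CommutativeSemigroup *-commutativeSemigroup using (x∙yz≈y∙xz)

  ι≈const : ∀ k → ι k ≈ const (K.ι k)
  ι≈const zero    zero    = K.refl
  ι≈const zero    (suc n) = K.refl
  ι≈const (suc k) = trans {ι (suc k)} (+-congˡ {1#} (ι≈const k))
    (sym {const (K.ι (suc k))} (const-+ K.1# (K.ι k)))

  -- General coefficients let the induction on the degree pass to `f ∘ suc`.
  polynomial : (ℕ → ℕ) → ℕ → Carrier
  polynomial f b = ∑ b (λ j → ι (f j) * X ^ j)

  private
    polynomial-suc : ∀ f b → polynomial f (suc b) ≈ const (K.ι (f 0)) + X * polynomial (f ∘ suc) b
    polynomial-suc f b = +-cong
      (trans {ι (f 0) * 1#} (*-identityʳ (ι (f 0))) (ι≈const (f 0)))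
      (trans {∑ b (λ j → ι (f (suc j)) * X ^ suc j)}
        (∑-cong b (λ j → ι (f (suc j)) * X ^ suc j) (λ j → X * (ι (f (suc j)) * X ^ j))
          (λ j _ → x∙yz≈y∙xz (ι (f (suc j))) X (X ^ j)))
        (sym {X * polynomial (f ∘ suc) b} (∑-*ˡ b X (λ j → ι (f (suc j)) * X ^ j))))

  polynomial-< : ∀ f b n → n < b → polynomial f b n K.≈ K.ι (f n)
  polynomial-< f (suc b) zero    _         = K.trans (polynomial-suc f b 0)
    (K.trans (K.+-congˡ (var-*-zero (polynomial (f ∘ suc) b))) (K.+-identityʳ _))
  polynomial-< f (suc b) (suc n) (s≤s n<b) = K.trans (polynomial-suc f b (suc n))
    (K.trans (K.+-identityˡ _) (K.trans (var-*-suc (polynomial (f ∘ suc) b) n)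
      (polynomial-< (f ∘ suc) b n n<b)))

  polynomial-≥ : ∀ f b n → b ≤ n → polynomial f b n K.≈ K.0#
  polynomial-≥ f zero    n       _         = K.refl
  polynomial-≥ f (suc b) (suc n) (s≤s b≤n) = K.trans (polynomial-suc f b (suc n))
    (K.trans (K.+-identityˡ _) (K.trans (var-*-suc (polynomial (f ∘ suc) b) n)
      (polynomial-≥ (f ∘ suc) b n b≤n)))

  P : ℕ → Carrier
  P = polynomial catalan

  P-suc : ∀ b → P (suc b) ≈ P b + ι (catalan b) * X ^ b
  P-suc b = ∑-last b (λ j → ι (catalan j) * X ^ j)

  convolutionTerm : ℕ → ℕ → Carrier
  convolutionTerm j i = ι (catalan (suc i) ℕ.* catalan j) * X ^ (suc i ℕ.+ j)

  -- Σ_{i≥1, i+j≤b} C_i C_j x^{i+j}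
  convolution : ℕ → Carrier
  convolution b = ∑ b (λ j → ∑ (b ∸ j) (convolutionTerm j))

  private
    module Cat = CatalanSeries seriesRing

    -- The new terms form the antidiagonal i + j = b + 1 of the Catalan convolution for C_{b+2},
    -- without i = 0; the missing term is C₀ C_{b+1}.
    convolution-suc : ∀ b → convolution (suc b) ≈
      convolution b + (ι (catalan (2 ℕ.+ b)) - ι (catalan (suc b))) * X ^ suc b
    convolution-suc b = begin
      convolution (suc b)
        ≈⟨ ∑-cong (suc b) (λ j → ∑ (suc b ∸ j) (convolutionTerm j))
             (λ j → ∑ (b ∸ j) (convolutionTerm j) + convolutionTerm j (b ∸ j))
             (λ { j (s≤s j≤b) → trans {∑ (suc b ∸ j) (convolutionTerm j)}
               (reflexive (≡.cong (λ k → ∑ k (convolutionTerm j)) (ℕₚ.+-∸-assoc 1 j≤b)))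
               (∑-last (b ∸ j) (convolutionTerm j)) }) ⟩
      ∑ (suc b) (λ j → ∑ (b ∸ j) (convolutionTerm j) + convolutionTerm j (b ∸ j))
        ≈⟨ ∑-+ (suc b) (λ j → ∑ (b ∸ j) (convolutionTerm j)) (λ j → convolutionTerm j (b ∸ j)) ⟩
      ∑ (suc b) (λ j → ∑ (b ∸ j) (convolutionTerm j)) + ∑ (suc b) (λ j → convolutionTerm j (b ∸ j))
        ≈⟨ +-cong
             (trans {∑ (suc b) (λ j → ∑ (b ∸ j) (convolutionTerm j))}
               (∑-last b (λ j → ∑ (b ∸ j) (convolutionTerm j)))
               (trans {convolution b + ∑ (b ∸ b) (convolutionTerm b)}
                 (+-congˡ {convolution b} (reflexive (≡.cong (λ k → ∑ k (convolutionTerm b)) (ℕₚ.n∸n≡0 b))))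
                 (+-identityʳ (convolution b))))
             (trans {∑ (suc b) (λ j → convolutionTerm j (b ∸ j))}
               (∑-cong (suc b) (λ j → convolutionTerm j (b ∸ j))
                 (λ j → X ^ suc b * (ι (catalan j) * ι (catalan (suc b ∸ j)))) top)
               (sym {X ^ suc b * diagonalSum}
                 (∑-*ˡ (suc b) (X ^ suc b) (λ j → ι (catalan j) * ι (catalan (suc b ∸ j)))))) ⟩
      convolution b + X ^ suc b * diagonalSum
        ≈⟨ +-congˡ {convolution b} (trans {X ^ suc b * diagonalSum} (*-comm (X ^ suc b) diagonalSum)
             (*-congʳ {X ^ suc b} diagonalSum≈)) ⟩
      convolution b + (ι (catalan (2 ℕ.+ b)) - ι (catalan (suc b))) * X ^ suc b ∎
      where
      open SetoidReasoning setoid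

      diagonalSum : Carrier
      diagonalSum = ∑ (suc b) (λ j → ι (catalan j) * ι (catalan (suc b ∸ j)))

      top : ∀ j → j < suc b → convolutionTerm j (b ∸ j) ≈ X ^ suc b * (ι (catalan j) * ι (catalan (suc b ∸ j)))
      top j (s≤s j≤b) = begin
        ι (catalan (suc (b ∸ j)) ℕ.* catalan j) * X ^ (suc (b ∸ j) ℕ.+ j)
          ≡⟨ ≡.cong₂ (λ k e → ι (catalan k ℕ.* catalan j) * X ^ e)
               (≡.sym (ℕₚ.+-∸-assoc 1 j≤b)) (≡.cong suc (ℕₚ.m∸n+n≡m j≤b)) ⟩
        ι (catalan (suc b ∸ j) ℕ.* catalan j) * X ^ suc b
          ≈⟨ *-congʳ {X ^ suc b} (trans {ι (catalan (suc b ∸ j) ℕ.* catalan j)}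
               (Cat.ι-* (catalan (suc b ∸ j)) (catalan j))
               (*-comm (ι (catalan (suc b ∸ j))) (ι (catalan j)))) ⟩
        ι (catalan j) * ι (catalan (suc b ∸ j)) * X ^ suc b
          ≈⟨ *-comm (ι (catalan j) * ι (catalan (suc b ∸ j))) (X ^ suc b) ⟩
        X ^ suc b * (ι (catalan j) * ι (catalan (suc b ∸ j))) ∎

      diagonalSum≈ : diagonalSum ≈ ι (catalan (2 ℕ.+ b)) - ι (catalan (suc b))
      diagonalSum≈ = sym {ι (catalan (2 ℕ.+ b)) - ι (catalan (suc b))} (begin
        ι (catalan (2 ℕ.+ b)) - ι (catalan (suc b))
          ≈⟨ +-congʳ { - ι (catalan (suc b))} (trans {ι (catalan (2 ℕ.+ b))} (Cat.ι-catalan-suc (suc b))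
               (∑-last (suc b) (λ j → ι (catalan j) * ι (catalan (suc b ∸ j))))) ⟩
        diagonalSum + ι (catalan (suc b)) * ι (catalan (suc b ∸ suc b)) - ι (catalan (suc b))
          ≡⟨ ≡.cong (λ k → diagonalSum + ι (catalan (suc b)) * ι (catalan k) - ι (catalan (suc b)))
               (ℕₚ.n∸n≡0 b) ⟩
        diagonalSum + ι (catalan (suc b)) * (1# + 0#) - ι (catalan (suc b))
          ≈⟨ last-term diagonalSum (ι (catalan (suc b))) ⟩
        diagonalSum ∎)

  -- Adding up the increments C_{j+2} - C_{j+1} leaves a difference of two Catalan polynomials, so
  -- the double sum is really a single one.
  X*convolution : ∀ b → X * convolution b ≈ P (2 ℕ.+ b) - 1# - X * P (1 ℕ.+ b)
  X*convolution zero    = convolution-base X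
  X*convolution (suc b) = begin
    X * convolution (suc b)
      ≈⟨ *-congˡ {X} (convolution-suc b) ⟩
    X * (convolution b + (C₂ - C₁) * X ^ suc b)
      ≈⟨ distribˡ X (convolution b) ((C₂ - C₁) * X ^ suc b) ⟩
    X * convolution b + X * ((C₂ - C₁) * X ^ suc b)
      ≈⟨ +-congʳ {X * ((C₂ - C₁) * X ^ suc b)} (X*convolution b) ⟩
    (P (2 ℕ.+ b) - 1# - X * P (1 ℕ.+ b)) + X * ((C₂ - C₁) * X ^ suc b)
      ≈⟨ convolution-step X (P (2 ℕ.+ b)) (P (1 ℕ.+ b)) (X ^ suc b) C₂ C₁ ⟩
    (P (2 ℕ.+ b) + C₂ * X ^ (2 ℕ.+ b)) - 1# - X * (P (1 ℕ.+ b) + C₁ * X ^ suc b)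
      ≈⟨ +-cong (+-congʳ { - 1#} (sym {P (3 ℕ.+ b)} (P-suc (2 ℕ.+ b))))
           (-‿cong (*-congˡ {X} (sym {P (2 ℕ.+ b)} (P-suc (1 ℕ.+ b))))) ⟩
    P (3 ℕ.+ b) - 1# - X * P (2 ℕ.+ b) ∎
    where
    open SetoidReasoning setoid
    C₂ C₁ : Carrier
    C₂ = ι (catalan (2 ℕ.+ b))
    C₁ = ι (catalan (1 ℕ.+ b))

-- The joint generating function, A(x,0,v) and A(x,x)

module ClosedForms {c ℓ} (R : CommutativeRing c ℓ) (q v : CommutativeRing.Carrier R) (a′ m′ : ℕ) where
  private
    module K where
      open CommutativeRing R public
      open FiniteSums R public
      open WordSums R public
      open RingNotation rawRing public using (ι; _^_)
      open import Algebra.Properties.Ring (CommutativeRing.ring R) public using (-0#≈0#)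
    v^ : ℕ → K.Carrier
    v^ n = v K.^ n
    a = 2 ℕ.+ a′
    m = 2 ℕ.+ m′
  open GeneratingFunctions K.rawRing q v (suc (suc a′)) (suc (suc m′))
    hiding (_≈_; _+_; _*_; -_; 0#; 1#; _-_; Carrier; sum)
  open PowerSeries R
  open Substitution R hiding (_⟨_⟩)
  open CommutativeRing seriesRing
  open RunWeights R q a′ m′ using (weight)
  open Subword a′ m′ using (ω-zero)
  open FunctionalEquation R q v a′ m′
  open SmallestRepeatedLetter R q v a′ m′
  open CatalanPolynomials R
  open CatalanSeries R using (catalans; catalans-quadratic)
  open ClosedFormAlgebra seriesRing
  open import Algebra.Properties.CommutativeSemiring.Exp commutativeSemiring using (^-distrib-*)
  open import Algebra.Properties.Semiring.Exp semiring using (^-homo-*)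

  ⟨0⟩ : ∀ F → F ⟨ 0# ⟩ ≈ F 0
  ⟨0⟩ F = begin
    F ⟨ 0# ⟩                    ≈⟨ ⟨⟩-shift 0# K.refl F ⟩
    F 0 + 0# * shift F ⟨ 0# ⟩   ≈⟨ +-congˡ {F 0} (zeroˡ (shift F ⟨ 0# ⟩)) ⟩
    F 0 + 0#                    ≈⟨ +-identityʳ (F 0) ⟩
    F 0                         ∎
    where open SetoidReasoning setoid

  y≈A⟨0⟩ : y ≈ A ⟨ 0# ⟩
  y≈A⟨0⟩ = trans {y} y≈A₀ (sym {A ⟨ 0# ⟩} (⟨0⟩ A))

  1/[1-X] : (1# - X) * 1/[1- X ] ≈ 1#
  1/[1-X] = 1/[1-]-inverse X K.refl

  VX₀≈0 : (V * X) 0 K.≈ K.0#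
  VX₀≈0 = K.trans (K.+-identityʳ _) (K.zeroʳ v)

  1/[1-VX] : (1# - V * X) * 1/[1- V * X ] ≈ 1#
  1/[1-VX] = 1/[1-]-inverse (V * X) VX₀≈0

  1/[1-Xy] : (1# - X * y) * 1/[1- X * y ] ≈ 1#
  1/[1-Xy] = 1/[1-]-inverse (X * y) Xy₀≈0

  W : Carrier
  W = weight 0 0 0

  y-1≈X*W : y - 1# ≈ X * W
  y-1≈X*W = excess⇒product X y W y≈Y

  -- y - 1 = x W, where x cancels by shifting and `W` is a unit: its constant coefficient is q⁰, as
  -- the word 1 completes no run.
  y-1-cancel : ∀ f g → (y - 1#) * f ≈ (y - 1#) * g → f ≈ g
  y-1-cancel f g e = unit-cancel W 1/[1- 1# - W ] f g (1/[1-]-inverse (1# - W) 1-W₀≈0)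
    (var-cancel {W * f} {W * g} (begin
      X * (W * f)       ≈⟨ *-assoc X W f ⟨
      X * W * f         ≈⟨ *-congʳ {f} y-1≈X*W ⟨
      (y - 1#) * f      ≈⟨ e ⟩
      (y - 1#) * g      ≈⟨ *-congʳ {g} y-1≈X*W ⟩
      X * W * g         ≈⟨ *-assoc X W g ⟩
      X * (W * g)       ∎))
    where
    open SetoidReasoning setoid
    1-W₀≈0 : (1# - W) 0 K.≈ K.0#
    1-W₀≈0 = K.trans (K.+-congˡ (K.-‿cong (K.reflexive (≡.cong (q K.^_) (ω-zero 0)))))
      (K.-‿inverseʳ K.1#)

  -- `h` will be the part of `H l` in degrees below a, that is, what the range of i in `A₃` leaves
  -- out.
  D h : Carrier
  D = convolution a′
  h = X * D

  -- The term `T` has the factors x^(a-1) and y - 1, hence x^a. Modulo x^a the recurrence therefore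
  -- reads C = 1 + x C².
  A≈catalans : ∀ l → A l ≈[ a ] catalans
  A≈catalans = approx a ℕₚ.≤-refl
    where
    correction : ∀ l → T * indicator (suc m′) l ≈[ a ] 0#
    correction l = begin
      (Q - 1#) * X ^ suc a′ * (y - 1#) * indicator (suc m′) l
        ≈⟨ ≈⇒≈[] (*-congʳ {indicator (suc m′) l} (*-congˡ {(Q - 1#) * X ^ suc a′} y-1≈X*W)) ⟩
      (Q - 1#) * X ^ suc a′ * (X * W) * indicator (suc m′) l
        ≈⟨ ≈⇒≈[] (correction-vanishes (Q - 1#) (X ^ suc a′) W (indicator (suc m′) l) X) ⟩
      (Q - 1#) * W * indicator (suc m′) l * X ^ a
        ≈⟨ *^-vanish K.refl ((Q - 1#) * W * indicator (suc m′) l) a ⟩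
      0# ∎
      where open SetoidReasoning (truncatedSetoid a)

    weaken : ∀ {M N f g} → M ≤ N → f ≈[ N ] g → f ≈[ M ] g
    weaken M≤N f≈g n n<M = f≈g n (ℕₚ.<-≤-trans n<M M≤N)

    approx : ∀ N → N ≤ a → ∀ l → A l ≈[ N ] catalans
    approx zero    _   l n ()
    approx (suc N) N<a l = begin
      A l
        ≈⟨ ≈⇒≈[] (A-recurrence l) ⟩
      1# + X * y * A (suc l) + T * indicator (suc m′) l
        ≈⟨ +-cong-[] {f = 1# + X * y * A (suc l)} (λ _ _ → K.refl) (weaken N<a (correction l)) ⟩
      1# + X * y * A (suc l) + 0#
        ≈⟨ ≈⇒≈[] (+-identityʳ (1# + X * y * A (suc l))) ⟩
      1# + X * y * A (suc l)
        ≈⟨ ≈⇒≈[] (+-congˡ {1#} (*-assoc X y (A (suc l)))) ⟩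
      1# + X * (y * A (suc l))
        ≈⟨ +-cong-[] {f = 1#} (λ _ _ → K.refl) (*-raise-[] X K.refl
             (≈[]-trans {f = y * A (suc l)}
               (*-congˡ-[] y (approx N (ℕₚ.<⇒≤ N<a) (suc l)))
               (*-congʳ-[] catalans (≈[]-trans {f = y} (≈⇒≈[] y≈A₀) (approx N (ℕₚ.<⇒≤ N<a) 0))))) ⟩
      1# + X * (catalans * catalans)
        ≈⟨ ≈⇒≈[] (sym {catalans} catalans-quadratic) ⟩
      catalans ∎
      where open SetoidReasoning (truncatedSetoid (suc N))

  H : ℕ → Carrier
  H l n = aᵢ⁽ l ⁾ n 1

  A≈1+H+XA : ∀ l → A l ≈ 1# + H l + X * A (suc l)
  A≈1+H+XA l zero = K.sym (K.trans (K.+-cong (K.+-identityʳ K.1#) (var-*-zero (A (suc l)))) (K.+-identityʳ _))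
  A≈1+H+XA l (suc n) = K.trans (aᵢ-1 l n)
    (K.sym (K.+-cong (K.+-identityˡ _) (var-*-suc (A (suc l)) n)))

  h≈P : h ≈ P a - 1# - X * P (suc a′)
  h≈P = X*convolution a′

  P≈catalans : ∀ b → P b ≈[ b ] catalans
  P≈catalans b n n<b = polynomial-< catalan b n n<b

  -- In `A l - 1# - X * A (suc l)` both series are Catalan modulo x^a, and the dependence on l
  -- disappears. The factor `X` allows the shorter polynomial `P (suc a′)` in the last term.
  H≈h : ∀ l → H l ≈[ a ] h
  H≈h l = begin
    H l
      ≈⟨ ≈⇒≈[] (solve-first-letter X (A l) (A (suc l)) (H l) (A≈1+H+XA l)) ⟩
    A l - 1# - X * A (suc l)
      ≈⟨ +-cong-[] (+-cong-[] {f = A l} {g = - 1#} (λ n n<a → K.trans (A≈catalans l n n<a)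
             (K.sym (P≈catalans a n n<a))) (λ _ _ → K.refl))
           (λ n n<a → K.-‿cong (*-raise-[] X K.refl
             (λ k k<a → K.trans (A≈catalans (suc l) k (ℕₚ.m≤n⇒m≤1+n k<a))
                          (K.sym (P≈catalans (suc a′) k k<a))) n n<a)) ⟩
    P a - 1# - X * P (suc a′)
      ≈⟨ ≈⇒≈[] (sym {h} h≈P) ⟩
    h ∎
    where open SetoidReasoning (truncatedSetoid a)

  h-vanish : ∀ n → a ≤ suc n → h (suc n) K.≈ K.0#
  h-vanish n a≤ = K.trans (h≈P (suc n)) (K.trans
    (K.+-cong (K.+-cong (polynomial-≥ catalan a (suc n) a≤) K.-0#≈0#)
      (K.-‿cong (K.trans (var-*-suc (P (suc a′)) n) (polynomial-≥ catalan (suc a′) n (ℕₚ.≤-pred a≤)))))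
    (K.trans (K.+-congˡ K.-0#≈0#) (K.trans (K.+-identityʳ _) (K.+-identityʳ _))))

  VX*-suc : ∀ f n → (V * X * f) (suc n) K.≈ v K.* f n
  VX*-suc f n = K.trans (*-assoc V X f (suc n))
    (K.trans (const-* v (X * f) (suc n)) (K.*-congˡ (var-*-suc f n)))

  VX*-zero : ∀ f → (V * X * f) 0 K.≈ K.0#
  VX*-zero f = K.trans (*-assoc V X f 0)
    (K.trans (const-* v (X * f) 0) (K.trans (K.*-congˡ (var-*-zero f)) (K.zeroʳ v)))

  -- The term i = 1 is `H l`; the others lose their initial 1 by `aᵢ-suc`, which lowers n and the
  -- end n-a+1 of the range together. Where the range is empty `H l` agrees with `h`, and elsewhere
  -- the coefficient of `h` vanishes.
  A₃-recurrence : ∀ l → A₃ v l ≈ (H l - h) + V * X * A₃ v (suc l)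
  A₃-recurrence l zero = K.sym (K.trans
    (K.+-cong (K.trans (K.+-congʳ (H≈h l 0 (s≤s z≤n))) (K.-‿inverseʳ _)) (VX*-zero (A₃ v (suc l))))
    (K.+-identityʳ _))
  A₃-recurrence l (suc n) with n ≤? a′
  ... | yes n≤a′ = K.sym (K.trans
    (K.+-cong (K.trans (K.+-congʳ (H≈h l (suc n) (s≤s (s≤s n≤a′)))) (K.-‿inverseʳ _))
      (K.trans (VX*-suc (A₃ v (suc l)) n) (K.trans
        (K.*-congˡ (K.reflexive (≡.cong (λ k → K.∑ k (λ i → aᵢ⁽ suc l ⁾ n (suc i) K.* v^ i))
          (ℕₚ.m≤n⇒m∸n≡0 (ℕₚ.m≤n⇒m≤1+n n≤a′)))))
        (K.zeroʳ v))))
    (K.trans (K.+-identityʳ K.0#)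
      (K.reflexive (≡.cong (λ k → K.∑ k (λ i → aᵢ⁽ l ⁾ (suc n) (suc i) K.* v^ i))
        (≡.sym (ℕₚ.m≤n⇒m∸n≡0 n≤a′))))))
  ... | no n≰a′ = begin
    K.∑ (n ∸ a′) (λ i → aᵢ⁽ l ⁾ (suc n) (suc i) K.* v^ i)
      ≡⟨ ≡.cong (λ k → K.∑ k (λ i → aᵢ⁽ l ⁾ (suc n) (suc i) K.* v^ i)) (∸-suc n≰a′) ⟩
    H l (suc n) K.* K.1# K.+ K.∑ (n ∸ suc a′) (λ i → aᵢ⁽ l ⁾ (suc n) (2 ℕ.+ i) K.* (v K.* v^ i))
      ≈⟨ K.+-cong
           (K.trans (K.*-identityʳ _) (K.sym (K.trans
             (K.+-congˡ (K.trans (K.-‿cong (h-vanish n (s≤s (ℕₚ.≰⇒> n≰a′)))) K.-0#≈0#)) (K.+-identityʳ _))))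
           (K.trans (K.∑-cong (n ∸ suc a′) (λ i → aᵢ⁽ l ⁾ (suc n) (2 ℕ.+ i) K.* (v K.* v^ i))
               (λ i → v K.* (aᵢ⁽ suc l ⁾ n (suc i) K.* v^ i))
               (λ i _ → K.trans (K.*-congʳ (aᵢ-suc l n i)) (x∙yz≈y∙xz _ v _)))
             (K.sym (K.∑-*ˡ (n ∸ suc a′) v (λ i → aᵢ⁽ suc l ⁾ n (suc i) K.* v^ i)))) ⟩
    (H l (suc n) K.+ K.- h (suc n)) K.+ v K.* A₃ v (suc l) n
      ≈⟨ K.+-congˡ (VX*-suc (A₃ v (suc l)) n) ⟨
    (H l (suc n) K.+ K.- h (suc n)) K.+ (V * X * A₃ v (suc l)) (suc n) ∎
    where
    open SetoidReasoning K.setoid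
    open import Algebra.Properties.CommutativeSemigroup K.*-commutativeSemigroup using (x∙yz≈y∙xz)
    ∸-suc : ¬ n ≤ a′ → n ∸ a′ ≡ suc (n ∸ suc a′)
    ∸-suc n≰ = ℕₚ.+-∸-assoc 1 {n} {suc a′} (ℕₚ.≰⇒> n≰)

  A₃≈ : A₃ v 0 ≈ (λ l → H l - h) ⟨ V * X ⟩
  A₃≈ = ⟨⟩-unique (V * X) VX₀≈0 (A₃ v) (λ l → H l - h) A₃-recurrence

  H⟨VX⟩≈ : H ⟨ V * X ⟩ ≈ A₃ v 0 + h * 1/[1- V * X ]
  H⟨VX⟩≈ = begin
    H ⟨ V * X ⟩
      ≈⟨ ⟨⟩-cong (V * X) (λ l → split-excess (H l) h) ⟩
    (λ l → (H l - h) + h) ⟨ V * X ⟩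
      ≈⟨ ⟨⟩-+ (λ l → H l - h) (λ _ → h) (V * X) ⟩
    (λ l → H l - h) ⟨ V * X ⟩ + (λ _ → h) ⟨ V * X ⟩
      ≈⟨ +-cong (sym {A₃ v 0} A₃≈) (⟨⟩-constant (V * X) VX₀≈0 h) ⟩
    A₃ v 0 + h * 1/[1- V * X ] ∎
    where open SetoidReasoning setoid

  private
    -- Taking away the words 12⋯n, one of each length, removes the exception that `bump` makes at 0,
    -- and the recurrence loses its correction term.
    J : ℕ → Carrier
    J l = joint l - 1/[1- X ]

    ones≈ : (λ _ → K.1#) ≈ 1/[1- X ]
    ones≈ = trans {λ _ → K.1#} (fixpoint⇒quotient X 1/[1- X ] 1# (λ _ → K.1#) 1/[1-X] ones-fixpoint)
      (*-identityˡ 1/[1- X ])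
      where
      open CommutativeRingLemmas seriesRing using (fixpoint⇒quotient)
      ones-fixpoint : (λ _ → K.1#) ≈ 1# + X * (λ _ → K.1#)
      ones-fixpoint zero    = K.sym (K.trans (K.+-congˡ (var-*-zero (λ _ → K.1#))) (K.+-identityʳ _))
      ones-fixpoint (suc n) = K.sym (K.trans (K.+-congˡ (var-*-suc (λ _ → K.1#) n)) (K.+-identityˡ _))

    joint≈ : ∀ l → joint l ≈ 1# + V * H l + X * (V * joint (suc l) + (1# - V) * 1/[1- X ])
    joint≈ l zero = K.sym (K.trans (K.+-cong
      (K.trans (K.+-congˡ (K.trans (const-* v (H l) 0) (K.zeroʳ v))) (K.+-identityʳ _))
      (var-*-zero (V * joint (suc l) + (1# - V) * 1/[1- X ])))
      (K.trans (K.+-identityʳ _) (K.sym (joint-zero l))))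
    joint≈ l (suc n) = K.trans (joint-suc l n) (K.sym (K.+-cong
      (K.trans (K.+-identityˡ _) (const-* v (H l) (suc n)))
      (K.trans (var-*-suc (V * joint (suc l) + (1# - V) * 1/[1- X ]) n) (K.+-cong
        (const-* v (joint (suc l)) n)
        (K.trans (*-cong {1# - V} {const (K.1# K.+ K.- v)} {1/[1- X ]} {λ _ → K.1#}
          (sym {const (K.1# K.+ K.- v)} (trans {const (K.1# K.+ K.- v)} (const-+ K.1# (K.- v))
            (+-congˡ {1#} (const-neg v)))) (sym {λ _ → K.1#} ones≈) n)
          (const-* (K.1# K.+ K.- v) (λ _ → K.1#) n))))))
      where open Series K.rawRing using (const)

    J-recurrence : ∀ l → J l ≈ V * H l + V * X * J (suc l)
    J-recurrence l = trans {J l} (+-congʳ { - 1/[1- X ]} (joint≈ l))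
      (joint-step V X (H l) (joint (suc l)) 1/[1- X ] (1/[1-]-fixpoint X K.refl))

  jointGF≈ : jointGF ≈ V * A₃ v 0 + 1/[1- X ] + V * (h * 1/[1- V * X ])
  jointGF≈ = begin
    jointGF
      ≈⟨ (λ n → K.sumOver-cong (NC n) (λ π → K.*-congˡ (K.reflexive (≡.cong (λ w → q K.^ μ τ w)
           (≡.sym (≡.trans (Listₚ.map-cong ℕₚ.+-identityʳ π) (Listₚ.map-id π))))))) ⟩
    joint 0
      ≈⟨ split-excess (joint 0) 1/[1- X ] ⟩
    J 0 + 1/[1- X ]
      ≈⟨ +-congʳ {1/[1- X ]} (trans {J 0} (⟨⟩-unique (V * X) VX₀≈0 J (λ l → V * H l) J-recurrence)
           (trans {(λ l → V * H l) ⟨ V * X ⟩} (⟨⟩-*ˡ (V * X) VX₀≈0 V H) (*-congˡ {V} H⟨VX⟩≈))) ⟩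
    V * (A₃ v 0 + h * 1/[1- V * X ]) + 1/[1- X ]
      ≈⟨ joint-rearrange V (A₃ v 0) (h * 1/[1- V * X ]) 1/[1- X ] ⟩
    V * A₃ v 0 + 1/[1- X ] + V * (h * 1/[1- V * X ]) ∎
    where open SetoidReasoning setoid

  jointGF-2 : suc (suc a′) ≡ 2 → jointGF ≈ V * A₃ v ⟨ 0# ⟩ + 1/[1- X ]
  jointGF-2 ≡.refl = begin
    jointGF
      ≈⟨ jointGF≈ ⟩
    -- For a = 2 the convolution `D` is an empty sum.
    V * A₃ v 0 + 1/[1- X ] + V * (X * 0# * 1/[1- V * X ])
      ≈⟨ annihilate (V * A₃ v 0 + 1/[1- X ]) V X 1/[1- V * X ] ⟩
    V * A₃ v 0 + 1/[1- X ]
      ≈⟨ +-congʳ {1/[1- X ]} (*-congˡ {V} (sym {A₃ v ⟨ 0# ⟩} (⟨0⟩ (A₃ v)))) ⟩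
    V * A₃ v ⟨ 0# ⟩ + 1/[1- X ] ∎
    where open SetoidReasoning setoid

  private
    lower : ℕ → ℕ
    lower n = 1 ⊔ (n ℕ.+ 2 ∸ a)

    lower≡ : ∀ n → lower n ≡ 1 ⊔ (n ∸ a′)
    lower≡ n = ≡.cong (λ k → 1 ⊔ (k ∸ a)) (ℕₚ.+-comm n 2)

    lower-≤ : ∀ {n} → n ≤ suc a′ → lower n ≡ 1
    lower-≤ {n} n≤ = ≡.trans (lower≡ n) (ℕₚ.m≥n⇒m⊔n≡m (ℕₚ.m≤n+o⇒m∸n≤o n a′
      (≡.subst (n ≤_) (ℕₚ.+-comm 1 a′) n≤)))

    lower-> : ∀ {n} → a′ < n → lower (suc n) ≡ suc (lower n)
    lower-> {n} a′<n = ≡.trans (lower≡ (suc n)) (≡.trans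
      (≡.cong (1 ⊔_) (ℕₚ.+-∸-assoc 1 (ℕₚ.<⇒≤ a′<n)))
      (≡.cong suc (≡.sym (≡.trans (lower≡ n) (ℕₚ.m≤n⇒m⊔n≡n (ℕₚ.m<n⇒0<n∸m a′<n))))))

    term : ℕ → ℕ → K.Carrier
    term n j = K.ι (catalan (n ∸ j)) K.* v^ j

    sumFrom : ℕ → ℕ → K.Carrier
    sumFrom r n = K.∑ (n ∸ r) (λ i → term n (r ℕ.+ i))

    sumFrom-suc : ∀ r n → sumFrom (suc r) (suc n) K.≈ v K.* sumFrom r n
    sumFrom-suc r n = K.trans
      (K.∑-cong (n ∸ r) (λ i → term (suc n) (suc (r ℕ.+ i))) (λ i → v K.* term n (r ℕ.+ i))
        (λ i _ → x∙yz≈y∙xz (K.ι (catalan (n ∸ (r ℕ.+ i)))) v (v^ (r ℕ.+ i))))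
      (K.sym (K.∑-*ˡ (n ∸ r) v (λ i → term n (r ℕ.+ i))))
      where open import Algebra.Properties.CommutativeSemigroup K.*-commutativeSemigroup using (x∙yz≈y∙xz)

    doubleSum≡ : ∀ {n r} → lower n ≡ r → doubleSum n ≡ sumFrom r n
    doubleSum≡ {n} lower≡r = ≡.cong (λ r → sumFrom r n) lower≡r

    Pₐ₋₁-1 : Carrier
    Pₐ₋₁-1 = P (suc a′) - 1#

    -- The lower limit of j stays 1 up to n = a - 1 and then grows with n. So the step to n + 1
    -- admits the new term j = 1 exactly when 1 ≤ n ≤ a - 2, where `Pₐ₋₁-1` has its coefficients.
    doubleSum-recurrence : ∀ n → doubleSum (suc n) K.≈ v K.* (Pₐ₋₁-1 n K.+ doubleSum n)
    doubleSum-recurrence n with n ≤? a′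
    doubleSum-recurrence zero | yes 0≤a′ = begin
      doubleSum 1
        ≡⟨ doubleSum≡ {1} (lower-≤ (s≤s 0≤a′)) ⟩
      K.0#
        ≈⟨ K.trans (K.*-congˡ (K.+-identityˡ _)) (K.zeroʳ v) ⟨
      v K.* (K.0# K.+ K.0#)
        ≈⟨ K.*-congˡ (K.+-cong
             (K.trans (K.+-congʳ (K.trans (polynomial-< catalan (suc a′) 0 (s≤s z≤n)) (K.+-identityʳ _)))
               (K.-‿inverseʳ K.1#))
             (K.reflexive (doubleSum≡ {0} (lower-≤ z≤n)))) ⟨
      v K.* (Pₐ₋₁-1 0 K.+ doubleSum 0) ∎
      where open SetoidReasoning K.setoid
    doubleSum-recurrence (suc n) | yes n<a′ = begin
      doubleSum (2 ℕ.+ n)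
        ≡⟨ doubleSum≡ {2 ℕ.+ n} (lower-≤ (s≤s n<a′)) ⟩
      sumFrom 1 (2 ℕ.+ n)
        ≈⟨ sumFrom-suc 0 (suc n) ⟩
      v K.* (K.ι (catalan (suc n)) K.* K.1# K.+ sumFrom 1 (suc n))
        ≈⟨ K.*-congˡ (K.+-cong
             (K.trans (K.*-identityʳ _) (K.sym (K.trans
               (K.+-cong (polynomial-< catalan (suc a′) (suc n) (s≤s n<a′)) K.-0#≈0#) (K.+-identityʳ _))))
             (K.reflexive (≡.sym (doubleSum≡ {suc n} (lower-≤ (ℕₚ.m≤n⇒m≤1+n n<a′)))))) ⟩
      v K.* (Pₐ₋₁-1 (suc n) K.+ doubleSum (suc n)) ∎
      where open SetoidReasoning K.setoid
    doubleSum-recurrence zero | no 0≰a′ = contradiction z≤n 0≰a′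
    doubleSum-recurrence (suc n) | no n≰a′ = begin
      doubleSum (2 ℕ.+ n)
        ≡⟨ doubleSum≡ {2 ℕ.+ n} (lower-> (ℕₚ.≰⇒> n≰a′)) ⟩
      sumFrom (suc (lower (suc n))) (2 ℕ.+ n)
        ≈⟨ sumFrom-suc (lower (suc n)) (suc n) ⟩
      v K.* doubleSum (suc n)
        ≈⟨ K.*-congˡ (K.trans (K.+-congʳ (K.trans
             (K.+-cong (polynomial-≥ catalan (suc a′) (suc n) (ℕₚ.≰⇒> n≰a′)) K.-0#≈0#) (K.+-identityʳ _)))
             (K.+-identityˡ _)) ⟨
      v K.* (Pₐ₋₁-1 (suc n) K.+ doubleSum (suc n)) ∎
      where open SetoidReasoning K.setoid

  -- With k = n - j the limits become 1 ≤ k ≤ a - 2 and j ≥ 1 independently, so the double sum is a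
  -- product.
  doubleSum≈ : doubleSum ≈ V * X * (P (suc a′) - 1#) * 1/[1- V * X ]
  doubleSum≈ = fixpoint⇒quotient (V * X) 1/[1- V * X ] (V * X * Pₐ₋₁-1) doubleSum 1/[1-VX]
    (trans {doubleSum} fixpoint (distribˡ (V * X) Pₐ₋₁-1 doubleSum))
    where
    open CommutativeRingLemmas seriesRing using (fixpoint⇒quotient)
    fixpoint : doubleSum ≈ V * X * (Pₐ₋₁-1 + doubleSum)
    fixpoint zero    = K.trans (K.reflexive (doubleSum≡ {0} (lower-≤ z≤n)))
      (K.sym (VX*-zero (Pₐ₋₁-1 + doubleSum)))
    fixpoint (suc n) = K.trans (doubleSum-recurrence n) (K.sym (VX*-suc (Pₐ₋₁-1 + doubleSum) n))

  Cₐ₋₁ : Carrier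
  Cₐ₋₁ = ι (catalan (suc a′))

  jointGF-general : jointGF ≈ V * A₃ v ⟨ 0# ⟩ + 1/[1- X ]
    + (V ^ 2 * X ^ suc (suc a′) * Cₐ₋₁ - V ^ 2 * X ^ 2) * 1/[1- V * X ] + V * catalanPart + (V - 1#) * doubleSum
  jointGF-general = begin
    jointGF
      ≈⟨ jointGF≈ ⟩
    V * A₃ v 0 + 1/[1- X ] + V * (h * 1/[1- V * X ])
      ≈⟨ +-cong (+-congʳ {1/[1- X ]} (*-congˡ {V} (sym {A₃ v ⟨ 0# ⟩} (⟨0⟩ (A₃ v)))))
           (joint-remainder V X 1/[1- V * X ] D (P (suc a′)) Cₐ₋₁ (X ^ suc a′) catalanPart doubleSum
             1/[1-VX] (trans {h} h≈P (+-congʳ { - (X * P (suc a′))} (+-congʳ { - 1#} (P-suc (suc a′)))))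
             (sym {P a} (P-suc (suc a′))) doubleSum≈) ⟩
    V * A₃ v ⟨ 0# ⟩ + 1/[1- X ] +
      ((V ^ 2 * X ^ a * Cₐ₋₁ - V ^ 2 * X ^ 2) * 1/[1- V * X ] + V * catalanPart + (V - 1#) * doubleSum)
      ≈⟨ regroup (V * A₃ v ⟨ 0# ⟩ + 1/[1- X ])
           ((V ^ 2 * X ^ a * Cₐ₋₁ - V ^ 2 * X ^ 2) * 1/[1- V * X ])
           (V * catalanPart) ((V - 1#) * doubleSum) ⟩
    V * A₃ v ⟨ 0# ⟩ + 1/[1- X ]
      + (V ^ 2 * X ^ a * Cₐ₋₁ - V ^ 2 * X ^ 2) * 1/[1- V * X ] + V * catalanPart + (V - 1#) * doubleSum ∎
    where open SetoidReasoning setoid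

  private
    module S₂ where
      open CommutativeRing (PowerSeries.seriesRing seriesRing) public
      open Substitution seriesRing public
      open PowerSeries seriesRing public using (const-*)

  geometric : ∀ l → 1/[1- U ]₂ l ≈ 1#
  geometric zero = trans {1/[1- U ]₂ 0} (S₂.1/[1-]-fixpoint U (λ _ → K.refl) 0)
    (trans {1# + (U *₂ 1/[1- U ]₂) 0} (+-congˡ {1#} (S₂.var-*-zero 1/[1- U ]₂)) (+-identityʳ 1#))
  geometric (suc l) = trans {1/[1- U ]₂ (suc l)} (S₂.1/[1-]-fixpoint U (λ _ → K.refl) (suc l))
    (trans {0# + (U *₂ 1/[1- U ]₂) (suc l)} (+-identityˡ ((U *₂ 1/[1- U ]₂) (suc l)))
      (trans {(U *₂ 1/[1- U ]₂) (suc l)} (S₂.var-*-suc 1/[1- U ]₂ l) (geometric l)))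

  private
    geometric-* : ∀ f l → (1/[1- U ]₂ *₂ ↑ f) l ≈ f
    geometric-* f l = begin
      (1/[1- U ]₂ *₂ ↑ f) l   ≈⟨ S₂.*-comm 1/[1- U ]₂ (↑ f) l ⟩
      (↑ f *₂ 1/[1- U ]₂) l   ≈⟨ S₂.const-* f 1/[1- U ]₂ l ⟩
      f * 1/[1- U ]₂ l        ≈⟨ *-congˡ {f} (geometric l) ⟩
      f * 1#                  ≈⟨ *-identityʳ f ⟩
      f                       ∎
      where open SetoidReasoning setoid

    geometric-⟨⟩ : ∀ f g → g 0 K.≈ K.0# → (1/[1- U ]₂ *₂ ↑ f) ⟨ g ⟩ ≈ f * 1/[1- g ]
    geometric-⟨⟩ f g g₀≈0 = trans {(1/[1- U ]₂ *₂ ↑ f) ⟨ g ⟩} (⟨⟩-cong g (geometric-* f))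
      (⟨⟩-constant g g₀≈0 f)

  H≈ : ∀ l → H l ≈ X * (y - 1#) * A (suc l) + T * indicator (suc m′) l
  H≈ l = first-letter X y (A l) (A (suc l)) (H l) (T * indicator (suc m′) l) (A-recurrence l) (A≈1+H+XA l)

  vA₃≈ : V * A₃ v ⟨ 0# ⟩ ≈
    (y - 1#) * (A ⟨ V * X ⟩ - y) - V * M v ⟨ 0# ⟩
      + V * ((Q - 1#) * V ^ (suc (suc m′) ∸ 1) * X ^ (suc (suc a′) ℕ.+ suc (suc m′) ∸ 2) * (y - 1#) * 1/[1- V * X ])
  vA₃≈ = begin
    V * A₃ v ⟨ 0# ⟩
      ≈⟨ *-congˡ {V} (⟨0⟩ (A₃ v)) ⟩
    V * A₃ v 0
      ≈⟨ smallest-letter V X 1/[1- V * X ] y (Q - 1#) (X ^ suc a′) (V ^ suc m′) (X ^ suc m′) D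
           (H ⟨ V * X ⟩) (shift A ⟨ V * X ⟩) (A ⟨ V * X ⟩) (A₃ v 0) H⟨VX⟩≈ H⟨VX⟩≈′
           (trans {A ⟨ V * X ⟩} (⟨⟩-shift (V * X) VX₀≈0 A)
             (+-congʳ {V * X * shift A ⟨ V * X ⟩} (sym {y} y≈A₀))) ⟩
    (y - 1#) * (A ⟨ V * X ⟩ - y) - V * (X * 1/[1- V * X ] * D)
      + V * ((Q - 1#) * V ^ suc m′ * (X ^ suc a′ * X ^ suc m′) * (y - 1#) * 1/[1- V * X ])
      ≈⟨ +-cong
           (+-congˡ {(y - 1#) * (A ⟨ V * X ⟩ - y)} (-‿cong (*-congˡ {V} (sym {M v ⟨ 0# ⟩}
             (trans {M v ⟨ 0# ⟩} (⟨0⟩ (M v)) (geometric-* (X * 1/[1- V * X ] * D) 0))))))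
           (*-congˡ {V} (*-congʳ {1/[1- V * X ]} (*-congʳ {y - 1#} (*-congˡ {(Q - 1#) * V ^ suc m′}
             (sym {X ^ (a′ ℕ.+ m)} (X^[a+m-2]≈)))))) ⟩
    (y - 1#) * (A ⟨ V * X ⟩ - y) - V * M v ⟨ 0# ⟩
      + V * ((Q - 1#) * V ^ suc m′ * X ^ (a′ ℕ.+ m) * (y - 1#) * 1/[1- V * X ]) ∎
    where
    open SetoidReasoning setoid

    X^[a+m-2]≈ : X ^ (a′ ℕ.+ m) ≈ X ^ suc a′ * X ^ suc m′
    X^[a+m-2]≈ = trans {X ^ (a′ ℕ.+ m)} (reflexive (≡.cong (X ^_) (ℕₚ.+-suc a′ (suc m′))))
      (^-homo-* X (suc a′) (suc m′))

    H⟨VX⟩≈′ : H ⟨ V * X ⟩ ≈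
      X * (y - 1#) * shift A ⟨ V * X ⟩ + T * (V ^ suc m′ * X ^ suc m′ * 1/[1- V * X ])
    H⟨VX⟩≈′ = begin
      H ⟨ V * X ⟩
        ≈⟨ ⟨⟩-cong (V * X) H≈ ⟩
      (λ l → X * (y - 1#) * A (suc l) + T * indicator (suc m′) l) ⟨ V * X ⟩
        ≈⟨ ⟨⟩-+ (λ l → X * (y - 1#) * A (suc l)) (λ l → T * indicator (suc m′) l) (V * X) ⟩
      (λ l → X * (y - 1#) * A (suc l)) ⟨ V * X ⟩ + (λ l → T * indicator (suc m′) l) ⟨ V * X ⟩
        ≈⟨ +-cong (⟨⟩-*ˡ (V * X) VX₀≈0 (X * (y - 1#)) (shift A))
             (trans {(λ l → T * indicator (suc m′) l) ⟨ V * X ⟩} (⟨⟩-*ˡ (V * X) VX₀≈0 T (indicator (suc m′)))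
               (*-congˡ {T} (trans {indicator (suc m′) ⟨ V * X ⟩} (⟨⟩-indicator (V * X) VX₀≈0 (suc m′))
                 (*-congʳ {1/[1- V * X ]} (^-distrib-* V X (suc m′)))))) ⟩
      X * (y - 1#) * shift A ⟨ V * X ⟩ + T * (V ^ suc m′ * X ^ suc m′ * 1/[1- V * X ]) ∎

  diagonal≈ : (y - 1#) * A ⟨ X ⟩ ≈ y * y - 1/[1- X ] - T * X ^ suc m′ * 1/[1- X ]
  diagonal≈ = diagonal X 1/[1- X ] y T (X ^ suc m′) (shift A ⟨ X ⟩) (A ⟨ X ⟩) A⟨X⟩≈
    (trans {A ⟨ X ⟩} (⟨⟩-shift X K.refl A) (+-congʳ {X * shift A ⟨ X ⟩} (sym {y} y≈A₀)))
    where
    open SetoidReasoning setoid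
    A⟨X⟩≈ : A ⟨ X ⟩ ≈ 1# * 1/[1- X ] + X * y * shift A ⟨ X ⟩ + T * (X ^ suc m′ * 1/[1- X ])
    A⟨X⟩≈ = begin
      A ⟨ X ⟩
        ≈⟨ ⟨⟩-cong X A-recurrence ⟩
      (λ l → 1# + X * y * A (suc l) + T * indicator (suc m′) l) ⟨ X ⟩
        ≈⟨ ⟨⟩-+ (λ l → 1# + X * y * A (suc l)) (λ l → T * indicator (suc m′) l) X ⟩
      (λ l → 1# + X * y * A (suc l)) ⟨ X ⟩ + (λ l → T * indicator (suc m′) l) ⟨ X ⟩
        ≈⟨ +-cong
             (trans {(λ l → 1# + X * y * A (suc l)) ⟨ X ⟩} (⟨⟩-+ (λ _ → 1#) (λ l → X * y * A (suc l)) X)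
               (+-cong (⟨⟩-constant X K.refl 1#) (⟨⟩-*ˡ X K.refl (X * y) (shift A))))
             (trans {(λ l → T * indicator (suc m′) l) ⟨ X ⟩} (⟨⟩-*ˡ X K.refl T (indicator (suc m′)))
               (*-congˡ {T} (⟨⟩-indicator X K.refl (suc m′)))) ⟩
      1# * 1/[1- X ] + X * y * shift A ⟨ X ⟩ + T * (X ^ suc m′ * 1/[1- X ]) ∎

  -- The form that vx takes inside `M` at v = 1.
  1X : Carrier
  1X = const K.1# * X
    where open Series K.rawRing using (const)

  1/[1-1X]≈ : 1/[1- 1X ] ≈ 1/[1- X ]
  1/[1-1X]≈ = inverse-unique X 1/[1- 1X ] 1/[1- X ]
    (trans {(1# - X) * 1/[1- 1X ]}
      (*-congʳ {1/[1- 1X ]} (+-congˡ {1#} (-‿cong (sym {1X} (*-identityˡ X)))))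
      (1/[1-]-inverse 1X (K.trans (*-identityˡ X 0) K.refl)))
    1/[1-X]

  bracket≈ : X ^ a * Cₐ₋₁ * 1/[1- X ] - X * 1/[1- 1X ] * D + P a ≈ 1/[1- X ]
  bracket≈ = bracket X 1/[1- X ] 1/[1- 1X ] D (P (suc a′)) Cₐ₋₁ (X ^ suc a′) (P a)
    1/[1-X] 1/[1-1X]≈ (P-suc (suc a′)) h≈P

  A⟨X⟩-closed : A ⟨ X ⟩ ≈
    (Q - 1#) * X ^ (suc (suc a′) ∸ 2) * ((X * y) ^ suc (suc m′) * (1# - X) - X ^ suc (suc m′) * (1# - X * y))
      * 1/[1- X ] * 1/[1- X * y ]
      - M K.1# ⟨ X * y ⟩ + X ^ suc (suc a′) * Cₐ₋₁ * 1/[1- X ] * 1/[1- X * y ] + L ⟨ X * y ⟩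
  A⟨X⟩-closed = begin
    A ⟨ X ⟩
      ≈⟨ y-1-cancel (A ⟨ X ⟩) (F + 1/[1- X ] * 1/[1- X * y ])
           (trans {(y - 1#) * A ⟨ X ⟩} diagonal≈ (sym {(y - 1#) * (F + 1/[1- X ] * 1/[1- X * y ])}
             (diagonal-closed X y (Q - 1#) (X ^ a′) 1/[1- X ] 1/[1- X * y ] (X ^ suc m′) ((X * y) ^ suc m′)
               1/[1-X] 1/[1-Xy] y-closed))) ⟩
    F + 1/[1- X ] * 1/[1- X * y ]
      -- Read backwards, `bracket≈` spreads 1/(1 - x) over the Catalan terms that the statement
      -- displays.
      ≈⟨ +-congˡ {F} (*-congʳ {1/[1- X * y ]} (sym {k - d + p} bracket≈)) ⟩
    F + (k - d + p) * 1/[1- X * y ]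
      ≈⟨ distribute F k d p 1/[1- X * y ] ⟩
    F - d * 1/[1- X * y ] + k * 1/[1- X * y ] + p * 1/[1- X * y ]
      ≈⟨ +-cong (+-congʳ {k * 1/[1- X * y ]} (+-congˡ {F} (-‿cong
             (sym {M K.1# ⟨ X * y ⟩} (geometric-⟨⟩ d (X * y) Xy₀≈0)))))
           (sym {L ⟨ X * y ⟩} (geometric-⟨⟩ p (X * y) Xy₀≈0)) ⟩
    F - M K.1# ⟨ X * y ⟩ + k * 1/[1- X * y ] + L ⟨ X * y ⟩ ∎
    where
    open SetoidReasoning setoid
    F k d p : Carrier
    F = (Q - 1#) * X ^ a′ * ((X * y) ^ m * (1# - X) - X ^ m * (1# - X * y)) * 1/[1- X ] * 1/[1- X * y ]
    k = X ^ a * Cₐ₋₁ * 1/[1- X ]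
    d = X * 1/[1- 1X ] * D
    p = P a

-- A(x,u) as a series in two variables

module Bivariate {c ℓ} (R : CommutativeRing c ℓ) (q v : CommutativeRing.Carrier R) (a′ m′ : ℕ) where
  private
    module K = CommutativeRing R
    a = 2 ℕ.+ a′
    m = 2 ℕ.+ m′
  open GeneratingFunctions K.rawRing q v (suc (suc a′)) (suc (suc m′))
  open PowerSeries R using (shift)
  private
    seriesRing = PowerSeries.seriesRing R
    module S where
      open CommutativeRing seriesRing public
      open ClosedFormAlgebra seriesRing public
      open Substitution R public using (indicator)
    module S₂ where
      open CommutativeRing (PowerSeries.seriesRing seriesRing) public
      open Substitution seriesRing public
      open PowerSeries seriesRing public using (const-*)
      open ClosedFormAlgebra (PowerSeries.seriesRing seriesRing) public
  open FunctionalEquation R q v a′ m′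
  open ClosedForms R q v a′ m′

  private
    ↑-- : ∀ f g → ↑ (f - g) ≈₂ ↑ f -₂ ↑ g
    ↑-- f g = S₂.trans {↑ (f - g)} (S₂.const-+ f (- g)) (S₂.+-congˡ {↑ f} (S₂.const-neg g))

    J : Carrier₂
    J = 1/[1- U ]₂

    indicator≈ : ∀ k → (λ l → S.indicator k l) ≈₂ U ^₂ k *₂ J
    indicator≈ zero l = S.sym {(1₂ *₂ J) l} (S.trans {(1₂ *₂ J) l} (S₂.*-identityˡ J l) (geometric l))
    indicator≈ (suc k) = S₂.trans {λ l → S.indicator (suc k) l} step
      (S₂.trans {U *₂ (λ l → S.indicator k l)} (S₂.*-congˡ {U} (indicator≈ k))
        (S₂.sym {U *₂ U ^₂ k *₂ J} (S₂.*-assoc U (U ^₂ k) J)))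
      where
      step : (λ l → S.indicator (suc k) l) ≈₂ U *₂ (λ l → S.indicator k l)
      step zero    = S.sym {(U *₂ (λ l → S.indicator k l)) 0} (S₂.var-*-zero (λ l → S.indicator k l))
      step (suc l) = S.sym {(U *₂ (λ l → S.indicator k l)) (suc l)} (S₂.var-*-suc (λ l → S.indicator k l) l)

    t : Carrier
    t = (1# - Q) * X ^ suc a′

    i : Carrier
    i = 1/[1- X ]

    -- `A-recurrence` for all l at once. Eliminating `shift A` between this and `A≈₂` leaves the
    -- factor xy - u on the left.
    A≈₁ : A ≈₂ J +₂ ↑ X *₂ ↑ y *₂ shift A +₂ (S₂.- ↑ t) *₂ (↑ y -₂ 1₂) *₂ (U ^₂ suc m′ *₂ J)
    A≈₁ = begin
      A
        ≈⟨ (λ l → S.trans {A l} (A-recurrence l) (S.+-cong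
             (S.+-cong (S.sym {J l} (geometric l))
               (S.sym {(↑ (X * y) *₂ shift A) l} (S₂.const-* (X * y) (shift A) l)))
             (S.trans {T * S.indicator (suc m′) l} (S.*-congˡ {T} (indicator≈ (suc m′) l))
               (S.sym {(↑ T *₂ (U ^₂ suc m′ *₂ J)) l} (S₂.const-* T (U ^₂ suc m′ *₂ J) l))))) ⟩
      J +₂ ↑ (X * y) *₂ shift A +₂ ↑ T *₂ (U ^₂ suc m′ *₂ J)
        ≈⟨ S₂.+-cong (S₂.+-congˡ {J} (S₂.*-congʳ {shift A} (S₂.const-*-const X y)))
             (S₂.*-congʳ {U ^₂ suc m′ *₂ J} ↑T≈) ⟩
      J +₂ ↑ X *₂ ↑ y *₂ shift A +₂ (S₂.- ↑ t) *₂ (↑ y -₂ 1₂) *₂ (U ^₂ suc m′ *₂ J) ∎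
      where
      open SetoidReasoning S₂.setoid
      ↑T≈ : ↑ T ≈₂ (S₂.- ↑ t) *₂ (↑ y -₂ 1₂)
      ↑T≈ = begin
        ↑ T                                  ≈⟨ S₂.const-cong (S.negate-correction Q (X ^ suc a′) (y - 1#)) ⟩
        ↑ ((- t) * (y - 1#))                 ≈⟨ S₂.const-*-const (- t) (y - 1#) ⟩
        ↑ (- t) *₂ ↑ (y - 1#)                ≈⟨ S₂.*-cong (S₂.const-neg t) (↑-- y 1#) ⟩
        (S₂.- ↑ t) *₂ (↑ y -₂ 1₂)            ∎

    A≈₂ : A ≈₂ ↑ y +₂ U *₂ shift A
    A≈₂ = S₂.trans {A} (S₂.const+var*shift A)
      (S₂.+-congʳ {U *₂ shift A} (S₂.const-cong (S.sym {y} y≈A₀)))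

    inverse₁ : (1₂ -₂ ↑ X) *₂ ↑ i ≈₂ 1₂
    inverse₁ = begin
      (1₂ -₂ ↑ X) *₂ ↑ i     ≈⟨ S₂.*-congʳ {↑ i} (↑-- 1# X) ⟨
      ↑ (1# - X) *₂ ↑ i      ≈⟨ S₂.const-*-const (1# - X) i ⟨
      ↑ ((1# - X) * i)       ≈⟨ S₂.const-cong 1/[1-X] ⟩
      1₂                     ∎
      where open SetoidReasoning S₂.setoid

    p : Carrier
    p = X ^ suc m′

    -- The elimination leaves terms free of u, among them x y²; this identity lets them be written
    -- through A(x,x).
    diagonal₂ : ↑ (X * (y - 1#) * A ⟨ X ⟩) ≈₂
      ↑ X *₂ (↑ y *₂ ↑ y -₂ ↑ i) +₂ ↑ X *₂ (↑ t *₂ (↑ y -₂ 1₂) *₂ ↑ p *₂ ↑ i)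
    diagonal₂ = begin
      ↑ (X * (y - 1#) * A ⟨ X ⟩)
        ≈⟨ S₂.const-cong (S.scale-diagonal X y Q (X ^ suc a′) i p (A ⟨ X ⟩) diagonal≈) ⟩
      ↑ (X * (y * y - i) + X * (t * (y - 1#) * p * i))
        ≈⟨ S₂.const-+ (X * (y * y - i)) (X * (t * (y - 1#) * p * i)) ⟩
      ↑ (X * (y * y - i)) +₂ ↑ (X * (t * (y - 1#) * p * i))
        ≈⟨ S₂.+-cong
             (S₂.trans {↑ (X * (y * y - i))} (S₂.const-*-const X (y * y - i)) (S₂.*-congˡ {↑ X}
               (S₂.trans {↑ (y * y - i)} (↑-- (y * y) i)
                 (S₂.+-congʳ {S₂.- ↑ i} (S₂.const-*-const y y)))))
             (S₂.trans {↑ (X * (t * (y - 1#) * p * i))} (S₂.const-*-const X (t * (y - 1#) * p * i))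
               (S₂.*-congˡ {↑ X} (S₂.trans {↑ (t * (y - 1#) * p * i)} (S₂.const-*-const (t * (y - 1#) * p) i)
                 (S₂.*-congʳ {↑ i} (S₂.trans {↑ (t * (y - 1#) * p)} (S₂.const-*-const (t * (y - 1#)) p)
                   (S₂.*-congʳ {↑ p} (S₂.trans {↑ (t * (y - 1#))} (S₂.const-*-const t (y - 1#))
                     (S₂.*-congˡ {↑ t} (↑-- y 1#))))))))) ⟩
      ↑ X *₂ (↑ y *₂ ↑ y -₂ ↑ i) +₂ ↑ X *₂ (↑ t *₂ (↑ y -₂ 1₂) *₂ ↑ p *₂ ↑ i) ∎
      where open SetoidReasoning S₂.setoid

    k d : Carrier
    k = X ^ a * Cₐ₋₁ * i
    d = X * 1/[1- 1X ] * D

    bracket₂ : ↑ i *₂ J ≈₂ ↑ k *₂ J -₂ M K.1# +₂ L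
    bracket₂ = begin
      ↑ i *₂ J                         ≈⟨ S₂.*-congʳ {J} (S₂.const-cong bracket≈) ⟨
      ↑ (k - d + P a) *₂ J             ≈⟨ S₂.*-congʳ {J} (S₂.trans {↑ (k - d + P a)}
                                            (S₂.const-+ (k - d) (P a)) (S₂.+-congʳ {↑ P a} (↑-- k d))) ⟩
      (↑ k -₂ ↑ d +₂ ↑ P a) *₂ J       ≈⟨ S₂.factor-geometric J (↑ k) (↑ d) (↑ P a) ⟨
      ↑ k *₂ J -₂ J *₂ ↑ d +₂ J *₂ ↑ P a ∎
      where
      open SetoidReasoning S₂.setoid
      open CatalanPolynomials R using (P)

  A-closed : (↑ (X * y) -₂ U) *₂ A ≈₂
    (↑ X -₂ U) *₂ (↑ (X ^ suc (suc a′) * Cₐ₋₁ * 1/[1- X ]) *₂ 1/[1- U ]₂ -₂ M K.1# +₂ L)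
    +₂ ↑ ((1# - Q) * X ^ (suc (suc a′) ∸ 1))
       *₂ (U ^₂ suc (suc m′) *₂ ↑ (1# - X) -₂ ↑ (X ^ suc (suc m′)) *₂ (1₂ -₂ U))
       *₂ ↑ (y - 1#) *₂ 1/[1- U ]₂ *₂ ↑ 1/[1- X ]
    +₂ ↑ (X * (y - 1#) * A ⟨ X ⟩)
  A-closed = begin
    (↑ (X * y) -₂ U) *₂ A
      ≈⟨ S₂.*-congʳ {A} (S₂.+-congʳ {S₂.- U} (S₂.const-*-const X y)) ⟩
    (↑ X *₂ ↑ y -₂ U) *₂ A
      ≈⟨ S₂.bivariate (↑ X) U (↑ y) (↑ t) (↑ i) J (↑ p) (U ^₂ suc m′) A (shift A) Z
           inverse₁ (S₂.1/[1-]-inverse U (λ _ → K.refl)) A≈₁ A≈₂ diagonal₂ ⟩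
    (↑ X -₂ U) *₂ (↑ i *₂ J)
      +₂ ↑ t *₂ (U *₂ U ^₂ suc m′ *₂ (1₂ -₂ ↑ X) -₂ ↑ X *₂ ↑ p *₂ (1₂ -₂ U)) *₂ (↑ y -₂ 1₂) *₂ J *₂ ↑ i +₂ Z
      ≈⟨ S₂.+-congʳ {Z} (S₂.+-cong (S₂.*-congˡ {↑ X -₂ U} bracket₂)
           (S₂.*-congʳ {↑ i} (S₂.*-congʳ {J} (S₂.*-cong
             (S₂.*-congˡ {↑ t} (S₂.+-cong
               (S₂.*-congˡ {U ^₂ m} (S₂.sym {↑ (1# - X)} (↑-- 1# X)))
               (S₂.-‿cong (S₂.*-congʳ {1₂ -₂ U} (S₂.sym {↑ (X ^ m)} (S₂.const-*-const X p))))))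
             (S₂.sym {↑ (y - 1#)} (↑-- y 1#)))))) ⟩
    (↑ X -₂ U) *₂ (↑ k *₂ J -₂ M K.1# +₂ L)
      +₂ ↑ t *₂ (U ^₂ m *₂ ↑ (1# - X) -₂ ↑ (X ^ m) *₂ (1₂ -₂ U)) *₂ ↑ (y - 1#) *₂ J *₂ ↑ i +₂ Z ∎
    where
    open SetoidReasoning S₂.setoid
    Z : Carrier₂
    Z = ↑ (X * (y - 1#) * A ⟨ X ⟩)

theorem10 : ∀ {c ℓ} (R : CommutativeRing c ℓ) →
    (q v : CommutativeRing.Carrier R) (a m : ℕ) → 2 ≤ a → 2 ≤ m →
    let open GeneratingFunctions (CommutativeRing.rawRing R) q v a m
        1R = CommutativeRing.1# R
        Cₐ₋₁ = ι (catalan (a ∸ 1))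
    in
    -- y = A(x,0)
    (y ≈ A ⟨ 0# ⟩)
    ×
    -- the polynomial equation
    (X * y ^ 2 - y + 1# + (Q - 1#) * X ^ (a ℕ.+ m ∸ 2) * y ^ (m ∸ 1) * (y - 1#) ≈ 0#)
    ×
    -- the joint generating function
    (a ≡ 2 → jointGF ≈ V * A₃ v ⟨ 0# ⟩ + 1/[1- X ])
    ×
    (3 ≤ a → jointGF ≈
      V * A₃ v ⟨ 0# ⟩ + 1/[1- X ]
      + (V ^ 2 * X ^ a * Cₐ₋₁ - V ^ 2 * X ^ 2) * 1/[1- V * X ]
      + V * catalanPart
      + (V - 1#) * doubleSum)
    ×
    -- A(x,0,v), multiplied through by v
    (V * A₃ v ⟨ 0# ⟩ ≈
      (y - 1#) * (A ⟨ V * X ⟩ - y)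
      - V * M v ⟨ 0# ⟩
      + V * ((Q - 1#) * V ^ (m ∸ 1) * X ^ (a ℕ.+ m ∸ 2) * (y - 1#) * 1/[1- V * X ]))
    ×
    -- A(x,u), multiplied through by xy - u, with x - u distributed over the
    -- bracket and cancelled against the denominators x - u there
    ((↑ (X * y) -₂ U) *₂ A ≈₂
      (↑ X -₂ U) *₂ (↑ (X ^ a * Cₐ₋₁ * 1/[1- X ]) *₂ 1/[1- U ]₂ -₂ M 1R +₂ L)
      +₂ ↑ ((1# - Q) * X ^ (a ∸ 1))
         *₂ (U ^₂ m *₂ ↑ (1# - X) -₂ ↑ (X ^ m) *₂ (1₂ -₂ U))
         *₂ ↑ (y - 1#) *₂ 1/[1- U ]₂ *₂ ↑ 1/[1- X ]
      +₂ ↑ (X * (y - 1#) * A ⟨ X ⟩))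
    ×
    -- A(x,x)
    (A ⟨ X ⟩ ≈
      (Q - 1#) * X ^ (a ∸ 2) * ((X * y) ^ m * (1# - X) - X ^ m * (1# - X * y))
        * 1/[1- X ] * 1/[1- X * y ]
      - M 1R ⟨ X * y ⟩
      + X ^ a * Cₐ₋₁ * 1/[1- X ] * 1/[1- X * y ]
      + L ⟨ X * y ⟩)
-- The lower bounds turn into the offsets `a′` and `m′`, under which the truncated subtractions in
-- the statement compute.
theorem10 R q v (suc (suc a′)) (suc (suc m′)) (s≤s (s≤s z≤n)) (s≤s (s≤s z≤n)) =
  CF.y≈A⟨0⟩ , FunctionalEquation.y-polynomial R q v a′ m′ , CF.jointGF-2 ,
  (λ _ → CF.jointGF-general) , CF.vA₃≈ , Bivariate.A-closed R q v a′ m′ , CF.A⟨X⟩-closed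
  where module CF = ClosedForms R q v a′ m′
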